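{- Let $m,n,r$ be fixed integers with $n\ge m>r\ge 1$. Then, as $H\to\infty$: \begin{itemize} \item if $r=1$, then $\#\mathcal{L}_{m,n,1}(\mathbb{Z}^{ -1};H)\le H^{n+o(1)}$; \item if $r=2$, then \[\#\mathcal{L}_{m,n,2}(\mathbb{Z}^{ -1};H)\ll\begin{cases} H^{7+o(1)}, & \text{if } (m,n)=(3,3),\\ H^{2n+m-3+o(1)}, & \text{if } (m,n)\ne(3,3);\end{cases}\] \item if $r\ge 3$, then \[\#\mathcal{L}_{m,n,r}(\mathbb{Z}^{ -1};H)\ll\begin{cases} H^{(n-r)(r+1)/2+mr+o(1)}, & \text{if } 2m\ge n+r,\\ H^{nr+m-r}, & \text{if } 2m<n+r.\end{cases}\] \end{itemize}
   Context: For a real $H\ge 1$, let $\mathcal{E}(H)=\{1/a:\ a\in\mathbb{Z},\ 1\le |a|\le H\}$ (Egyptian or unit fractions). Let $\mathcal{M}_{m,n}(\mathbb{Z}^{ -1};H)$ be the set of $m\times n$ matrices all of whose entries lie in $\mathcal{E}(H)$, and $\mathcal{L}_{m,n,r}(\mathbb{Z}^{ -1};H)=\{A\in\mathcal{M}_{m,n}(\mathbb{Z}^{ -1};H):\ \operatorname{rank}A=r\}$. A bound $X\le H^{c+o(1)}$ means that for every $\varepsilon>0$, $X\le H^{c+\varepsilon}$ for all sufficiently large $H$; implied constants in $\ll$ depend only on $m,n$ (and $r$). -}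

module Defs where

open import Data.Nat using (ℕ; zero; suc; _≤_; _^_)
open import Data.Integer using (ℤ; ∣_∣)
open import Data.Rational using (ℚ; 0ℚ; 1ℚ; _*_; _+_; _/_)
open import Data.Fin using (Fin; zero; suc)
open import Data.Vec using (Vec; lookup)
open import Data.List using (List; length)
open import Data.List.Relation.Unary.All using (All)
open import Data.List.Relation.Unary.Unique.Propositional using (Unique)
open import Data.Product using (Σ; _×_)
open import Relation.Binary.PropositionalEquality using (_≡_)
open import Relation.Nullary using (¬_)

Matrix : ℕ → ℕ → Set
Matrix m n = Vec (Vec ℚ n) m

entry : ∀ {m n} → Matrix m n → Fin m → Fin n → ℚ
entry A i j = lookup (lookup A i) j

Σℚ : (k : ℕ) → (Fin k → ℚ) → ℚ
Σℚ zero    f = 0ℚ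
Σℚ (suc k) f = f zero + Σℚ k (λ j → f (suc j))

IsEgyptian : ℕ → ℚ → Set
IsEgyptian H x = Σ ℤ λ a → (1 ≤ ∣ a ∣) × (∣ a ∣ ≤ H) × (x * (a / 1) ≡ 1ℚ)

ColsIndep : ∀ {m n k} → Matrix m n → (Fin k → Fin n) → Set
ColsIndep {m} {n} {k} A g =
  (c : Fin k → ℚ) →
  ((i : Fin m) → Σℚ k (λ j → c j * entry A i (g j)) ≡ 0ℚ) →
  (j : Fin k) → c j ≡ 0ℚ

HasRank : ∀ {m n} → Matrix m n → ℕ → Set
HasRank {m} {n} A r =
  (Σ (Fin r → Fin n) λ g → ColsIndep A g) ×
  ((g : Fin (suc r) → Fin n) → ¬ ColsIndep A g)

AllEgyptian : ∀ {m n} → ℕ → Matrix m n → Set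
AllEgyptian {m} {n} H A = (i : Fin m) → (j : Fin n) → IsEgyptian H (entry A i j)

InL : (m n r H : ℕ) → Matrix m n → Set
InL m n r H A = AllEgyptian H A × HasRank A r

-- (#S)^k ≤ B, for a set S given as a predicate: every duplicate-free list of
-- elements of S has length ℓ with ℓ^k ≤ B
CardPowLE : {X : Set} → (X → Set) → ℕ → ℕ → Set
CardPowLE {X} S k B = (xs : List X) → Unique xs → All S xs → length xs ^ k ≤ B

-- A rank one matrix is fixed, up to H^o(1) choices, by its corner and one diagonal entry per row-column
-- pair (a₁₁aᵢᵢ = aᵢ₁a₁ᵢ and the divisor bound). A rank two matrix either has its rows or its columns in two
-- classes of proportional vectors, or contains a 3 × 3 core with nonvanishing minors; then each further
-- row or column solves αx + βy + γz = 0 in unit fractions, which has H^(1+o(1)) solutions.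
-- For larger r, choose r columns spanning the others and r rows spanning the others inside these columns.
-- If every remaining row is a combination of at most t basis rows, with t attained at row i⋆, the rows cost
-- H^(r² + t(m-r)), and each remaining column solves a linear equation in t + 1 unit fractions, which has
-- H^((t+1)/2 + o(1)) solutions because the product of the denominators is essentially squarefull. The total
-- exponent is linear in t, hence extremal at t = r or t = 1, and at t = 1 no o(1) is lost.

module Submission where

open import Defs
open import Data.Nat using (ℕ; suc; _≤_; _<_; _∸_; _^_)
open import Data.Bool using (Bool; true; false; if_then_else_; not; _∧_)
import Data.Bool.Properties as Bool
open import Data.Empty using (⊥; ⊥-elim)
open import Data.Unit using (⊤; tt)
open import Data.Fin using (Fin; zero; suc; toℕ; fromℕ<)
import Data.Fin.Properties as Fin
open import Data.Product using (Σ; _×_; _,_; proj₁; proj₂)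
open import Data.Sum using (_⊎_; inj₁; inj₂)
open import Data.Vec as Vec using (Vec; []; _∷_; lookup)
import Data.Vec.Properties as Vec
open import Function using (_∘_; id; case_of_)
open import Relation.Nullary using (¬_; yes; no; Dec; does)
open import Relation.Nullary.Decidable using (¬?; _×-dec_; decidable-stable; dec-true; dec-false)
open import Relation.Binary using (DecidableEquality)
open import Relation.Binary.PropositionalEquality hiding (J)

-- Every H^o(1) has one source: if M is at most a fixed power of 2H, only H^o(1) integers below a
-- fixed power of 2H are composed of primes dividing M. Divisors of M are such integers, which gives
-- the divisor bound. In a linear equation in unit fractions all denominators are composed of primes
-- dividing QM, where Q depends on the coefficients and M * M divides the product of the
-- denominators; M is the only costly choice, and this is the origin of the exponent (t + 1)/2. Both
-- uses require the numerators and denominators of the coefficients to be bounded by a fixed power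
-- of 2H. The elimination that produces the relations between rows therefore carries explicit
-- heights. The exceptional pair (3,3) comes from the core: two columns of three free entries, then
-- one factor H for each further column and row, give H^(6 + (n - 2) + (m - 3)) = H^(n + m + 1),
-- while matrices with two classes of rows give H^(2n). The inequality n + m + 1 ≤ 2n + m - 3 needs
-- n ≥ 4.

module Counting where

  open import Data.Nat using (zero; _+_; _*_; z≤n; s≤s; >-nonZero; ≢-nonZero⁻¹; nonTrivial⇒n>1; _<?_)
  open import Data.Nat.Properties
  open import Data.Nat.Divisibility
  open import Data.Nat.Primality using (Prime; euclidsLemma; prime⇒nonZero; prime⇒nonTrivial)
  open import Data.Nat.Primality.Factorisation using (PrimeFactorisation; factorise; factorisationHasAllPrimeFactors)
  open import Data.Nat.Induction using (<-rec)
  open import Data.Nat.ListAction using (product)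
  open import Data.Nat.ListAction.Properties using (∈⇒∣product)
  open import Data.Nat.Solver using (module +-*-Solver)
  open import Data.List as List using (List; []; _∷_; length; map; filter)
  open import Data.List.Properties using (length-map; filter-accept; filter-reject)
  open import Data.List.Membership.Propositional using (_∈_)
  open import Data.List.Membership.Propositional.Properties using (∈-lookup; ∈-map⁺)
  open import Data.List.Relation.Unary.Any using (here; there)
  open import Data.List.Relation.Unary.All as All using (All; []; _∷_)
  import Data.List.Relation.Unary.All.Properties as All
  open import Data.List.Relation.Unary.AllPairs using (AllPairs; []; _∷_)
  open import Data.List.Relation.Unary.Unique.Propositional using (Unique)
  import Data.List.Relation.Unary.Unique.Propositional.Properties as Unique

  -- Cardinalities through their powers

  ^-distribʳ-* : ∀ k a b → (a * b) ^ k ≡ a ^ k * b ^ k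
  ^-distribʳ-* zero a b = refl
  ^-distribʳ-* (suc k) a b = trans (cong (a * b *_) (^-distribʳ-* k a b)) ([m*n]*[o*p]≡[m*o]*[n*p] a b (a ^ k) (b ^ k))

  1≤^ : ∀ n k → 1 ≤ n → 1 ≤ n ^ k
  1≤^ n zero 1≤n = ≤-refl
  1≤^ n (suc k) 1≤n = *-mono-≤ 1≤n (1≤^ n k 1≤n)

  ^-cancelˡ-≤ : ∀ a b k → a ^ suc k ≤ b ^ suc k → a ≤ b
  ^-cancelˡ-≤ a b k h = ≮⇒≥ λ b<a → <⇒≱ (^-monoˡ-< (suc k) b<a) h

  unique-lookup : ∀ {X : Set} {xs : List X} → Unique xs → ∀ i j → List.lookup xs i ≡ List.lookup xs j → i ≡ j
  unique-lookup (_ ∷ _) zero zero _ = refl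
  unique-lookup (a ∷ _) zero (suc j) e = ⊥-elim (All.lookup a (∈-lookup j) e)
  unique-lookup (a ∷ _) (suc i) zero e = ⊥-elim (All.lookup a (∈-lookup i) (sym e))
  unique-lookup (_ ∷ u) (suc i) (suc j) e = cong suc (unique-lookup u i j e)

  unique-<⇒length≤ : ∀ N (xs : List ℕ) → Unique xs → All (_< N) xs → length xs ≤ N
  unique-<⇒length≤ N xs u a = Fin.injective⇒≤ {f = λ i → fromℕ< (All.lookup a (∈-lookup {xs = xs} i))}
    λ {i} {j} eq → unique-lookup u i j (Fin.fromℕ<-injective _ _ _ _ eq)

  module _ {X Y : Set} (_≟_ : DecidableEquality Y) where

    fiber : Y → List (X × Y) → List (X × Y)
    fiber y = filter (λ z → proj₂ z ≟ y)

    others : Y → List (X × Y) → List (X × Y)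
    others y = filter (λ z → ¬? (proj₂ z ≟ y))

    length-fiber+others : ∀ y zs → length zs ≡ length (fiber y zs) + length (others y zs)
    length-fiber+others y [] = refl
    length-fiber+others y (z ∷ zs) with proj₂ z ≟ y
    ... | yes _ = cong suc (length-fiber+others y zs)
    ... | no  _ = trans (cong suc (length-fiber+others y zs)) (sym (+-suc _ _))

    fiber-others : ∀ y y′ zs → length (fiber y (others y′ zs)) ≤ length (fiber y zs)
    fiber-others y y′ [] = z≤n
    fiber-others y y′ (z ∷ zs) with proj₂ z ≟ y′
    fiber-others y y′ (z ∷ zs) | yes _ with proj₂ z ≟ y
    ... | yes _ = ≤-trans (fiber-others y y′ zs) (n≤1+n _)
    ... | no _  = fiber-others y y′ zs
    fiber-others y y′ (z ∷ zs) | no _ with proj₂ z ≟ y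
    ... | yes _ = s≤s (fiber-others y y′ zs)
    ... | no _  = fiber-others y y′ zs

    length≤labels*fiber : ∀ F (ys : List Y) (zs : List (X × Y)) → All (λ z → proj₂ z ∈ ys) zs →
      (∀ y → y ∈ ys → length (fiber y zs) ≤ F) → length zs ≤ length ys * F
    length≤labels*fiber F [] [] _ _ = z≤n
    length≤labels*fiber F [] (z ∷ zs) (() ∷ _) _
    length≤labels*fiber F (y ∷ ys) zs a f = begin
      length zs ≡⟨ length-fiber+others y zs ⟩
      length (fiber y zs) + length (others y zs) ≤⟨ +-mono-≤ (f y (here refl))
        (length≤labels*fiber F ys (others y zs)
          (All.zipWith (λ { (¬eq , here eq) → ⊥-elim (¬eq eq) ; (_ , there h) → h })
            (All.all-filter (λ z → ¬? (proj₂ z ≟ y)) zs , All.filter⁺ (λ z → ¬? (proj₂ z ≟ y)) a))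
          (λ y′ h → ≤-trans (fiber-others y′ y zs) (f y′ (there h)))) ⟩
      F + length ys * F ∎
      where open ≤-Reasoning

  -- The fibre sizes are bounded only through their powers, and `M` need not be a perfect power.
  -- Taking the size of an actual largest fibre for `F` avoids extracting a root.
  maximum-fiber : ∀ {Y : Set} k M (fl : Y → ℕ) (ys : List Y) → (∀ y → y ∈ ys → fl y ^ suc k ≤ M) →
    Σ ℕ λ F → (∀ y → y ∈ ys → fl y ≤ F) × (F ^ suc k ≤ M)
  maximum-fiber k M fl [] h = 0 , (λ _ ()) , z≤n
  maximum-fiber k M fl (y ∷ ys) h with maximum-fiber k M fl ys (λ y′ m → h y′ (there m))
  ... | F , b , c with ≤-total (fl y) F
  ... | inj₁ le = F , (λ { _ (here refl) → le ; y′ (there m) → b y′ m }) , c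
  ... | inj₂ ge = fl y , (λ { _ (here refl) → ≤-refl ; y′ (there m) → ≤-trans (b y′ m) ge }) , h y (here refl)

  module _ {X Y : Set} (_≟_ : DecidableEquality Y) where

    open import Data.List.Membership.DecPropositional _≟_ using (_∈?_)

    support : List Y → List Y
    support [] = []
    support (y ∷ ys) with y ∈? support ys
    ... | yes _ = support ys
    ... | no  _ = y ∷ support ys

    support-unique : ∀ ys → Unique (support ys)
    support-unique [] = []
    support-unique (y ∷ ys) with y ∈? support ys
    ... | yes _ = support-unique ys
    ... | no ¬m = All.¬Any⇒All¬ (support ys) ¬m ∷ support-unique ys

    ∈-support : ∀ {y} ys → y ∈ ys → y ∈ support ys
    ∈-support (y ∷ ys) m with y ∈? support ys
    ∈-support (y ∷ ys) (here refl) | yes i = i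
    ∈-support (y ∷ ys) (there m)   | yes i = ∈-support ys m
    ∈-support (y ∷ ys) (here refl) | no _  = here refl
    ∈-support (y ∷ ys) (there m)   | no _  = there (∈-support ys m)

    support-All : ∀ {P : Y → Set} ys → All P ys → All P (support ys)
    support-All [] [] = []
    support-All (y ∷ ys) (p ∷ ps) with y ∈? support ys
    ... | yes _ = support-All ys ps
    ... | no  _ = p ∷ support-All ys ps

  -- CardPowLE as a record, so that its parameters can be inferred.
  record Card {X : Set} (P : X → Set) (k N : ℕ) : Set where
    constructor card
    field bound : CardPowLE P k N

  open Card public

  -- The number of labels times the largest fibre bounds the size, and the powers of both multiply.
  -- The label may depend on the proof of `P x`, and the fibres `R y` may overlap: each element is
  -- recorded under one label.
  fibration : ∀ {X Y : Set} {P : X → Set} {T : Y → Set} {R : Y → X → Set} {k N M} → DecidableEquality Y →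
    (∀ x → P x → Σ Y λ y → T y × R y x) →
    Card T (suc k) N → (∀ y → T y → Card (R y) (suc k) M) → Card P (suc k) (N * M)
  fibration {X} {Y} {P} {T} {R} {k} {N} {M} _≟_ label cT cR = card counted
    where
    counted : CardPowLE P (suc k) (N * M)
    counted xs uxs axs = begin
      length xs ^ suc k ≡⟨ cong (_^ suc k) (trans (sym (length-map proj₁ zs)) (cong length fst)) ⟨
      length zs ^ suc k ≤⟨ ^-monoˡ-≤ (suc k) (length≤labels*fiber _≟_ F ys zs inys F≥) ⟩
      (length ys * F) ^ suc k ≡⟨ ^-distribʳ-* (suc k) (length ys) F ⟩
      length ys ^ suc k * F ^ suc k ≤⟨ *-mono-≤ (bound cT ys (support-unique {X} _≟_ (map proj₂ zs)) (support-All {X} _≟_ _ (All.map⁺ (All.map proj₁ azs)))) F^≤ ⟩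
      N * M ∎
      where
      open ≤-Reasoning
      labelled : ∀ xs → All P xs → Σ (List (X × Y)) λ zs → map proj₁ zs ≡ xs × All (λ z → T (proj₂ z) × R (proj₂ z) (proj₁ z)) zs
      labelled [] [] = [] , refl , []
      labelled (x ∷ xs) (p ∷ ps) with label x p | labelled xs ps
      ... | y , t , r | zs , e , a = (x , y) ∷ zs , cong (x ∷_) e , (t , r) ∷ a
      zs = proj₁ (labelled xs axs)
      fst = proj₁ (proj₂ (labelled xs axs))
      azs = proj₂ (proj₂ (labelled xs axs))
      ys = support {X} _≟_ (map proj₂ zs)
      inys : All (λ z → proj₂ z ∈ ys) zs
      inys = All.tabulate λ m → ∈-support {X} _≟_ (map proj₂ zs) (∈-map⁺ proj₂ m)
      uzs : Unique (map proj₁ zs)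
      uzs = subst Unique (sym fst) uxs
      fiber-unique : ∀ y zs → Unique (map proj₁ zs) → Unique (map proj₁ (fiber {X} _≟_ y zs))
      fiber-unique y [] [] = []
      fiber-unique y (z ∷ zs) (a ∷ u) with proj₂ z ≟ y
      ... | yes _ = All.map⁺ (All.filter⁺ (λ z → proj₂ z ≟ y) (All.map⁻ a)) ∷ fiber-unique y zs u
      ... | no  _ = fiber-unique y zs u
      Ty : ∀ y → y ∈ ys → T y
      Ty y m = All.lookup (support-All {X} _≟_ _ (All.map⁺ (All.map proj₁ azs))) m
      fib≤ : ∀ y → y ∈ ys → length (fiber {X} _≟_ y zs) ^ suc k ≤ M
      fib≤ y m = subst (λ l → l ^ suc k ≤ M) (length-map proj₁ (fiber {X} _≟_ y zs))
        (bound (cR y (Ty y m)) (map proj₁ (fiber {X} _≟_ y zs)) (fiber-unique y zs uzs)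
          (All.map⁺ (All.zipWith (λ { (e , t , r) → subst (λ y → R y _) e r })
            (All.all-filter (λ z → proj₂ z ≟ y) zs , All.filter⁺ (λ z → proj₂ z ≟ y) azs))))
      mx = maximum-fiber k M (λ y → length (fiber {X} _≟_ y zs)) ys fib≤
      F = proj₁ mx
      F≥ = proj₁ (proj₂ mx)
      F^≤ = proj₂ (proj₂ mx)

  card-mono : ∀ {X : Set} {P : X → Set} {k N M} → N ≤ M → Card P k N → Card P k M
  card-mono N≤M c = card λ xs u a → ≤-trans (bound c xs u a) N≤M

  -- The empty list meets every bound because the exponent is positive, so a member may be assumed.
  -- Side conditions on a parameter that are stored inside the predicate become available in this
  -- way.
  card-witness : ∀ {X : Set} {P : X → Set} {k N} → (∀ x → P x → Card P (suc k) N) → Card P (suc k) N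
  card-witness c = card λ { [] u a → z≤n ; (x ∷ xs) u a@(p ∷ _) → bound (c x p) (x ∷ xs) u a }

  card-⊆ : ∀ {X : Set} {P Q : X → Set} {k N} → (∀ x → P x → Q x) → Card Q k N → Card P k N
  card-⊆ h c = card λ xs u a → bound c xs u (All.map (h _) a)

  card-subsingleton : ∀ {X : Set} {P : X → Set} {k} → (∀ x y → P x → P y → x ≡ y) → Card P (suc k) 1
  card-subsingleton {k = k} h = card λ where
    [] u a → z≤n
    (x ∷ []) u a → ≤-reflexive (^-zeroˡ (suc k))
    (x ∷ y ∷ xs) ((x≢y ∷ _) ∷ _) (p ∷ q ∷ _) → ⊥-elim (x≢y (h x y p q))

  card-inj : ∀ {X Y : Set} {P : X → Set} {Q : Y → Set} {k N} → DecidableEquality Y → (f : X → Y) →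
    (∀ x → P x → Q (f x)) → (∀ x y → P x → P y → f x ≡ f y → x ≡ y) →
    Card Q (suc k) N → Card P (suc k) N
  card-inj {P = P} {k = k} {N} _≟_ f h inj c = subst (Card _ (suc k)) (*-identityʳ N)
    (fibration {R = λ y x → P x × f x ≡ y} _≟_ (λ x p → f x , h x p , p , refl) c
      (λ y _ → card-subsingleton λ x x′ (p , e) (p′ , e′) → inj x x′ p p′ (trans e (sym e′))))

  -- A list whose largest element is m has at most m elements, and m already satisfies the power
  -- inequality; no integer root of `X` is formed.
  card-bounded-power : ∀ k X → Card (λ y → 1 ≤ y × y ^ suc k ≤ X) (suc k) X
  card-bounded-power k X = card λ
    { [] u a → z≤n
    ; xs@(_ ∷ _) u a → let (m , 1≤m , m^≤ , all≤) = top xs (s≤s z≤n) a in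
        ≤-trans (^-monoˡ-≤ (suc k) (below m xs u all≤)) m^≤ }
    where
    top : ∀ xs → 1 ≤ length xs → All (λ y → 1 ≤ y × y ^ suc k ≤ X) xs →
      Σ ℕ λ m → 1 ≤ m × m ^ suc k ≤ X × All (λ y → 1 ≤ y × y ≤ m) xs
    top (x ∷ []) _ ((1≤x , x≤) ∷ []) = x , 1≤x , x≤ , (1≤x , ≤-refl) ∷ []
    top (x ∷ xs@(_ ∷ _)) _ ((1≤x , x≤) ∷ as) with top xs (s≤s z≤n) as
    ... | m , 1≤m , m≤ , al with ≤-total x m
    ... | inj₁ x≤m = m , 1≤m , m≤ , (1≤x , x≤m) ∷ al
    ... | inj₂ m≤x = x , 1≤x , x≤ , (1≤x , ≤-refl) ∷ All.map (λ (p , q) → p , ≤-trans q m≤x) al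
    map-pred-unique : ∀ {xs} → All (λ y → 1 ≤ y) xs → Unique xs → Unique (map (_∸ 1) xs)
    map-pred-unique [] [] = []
    map-pred-unique (p ∷ ps) (a ∷ u) = All.map⁺ (All.zipWith (λ { (q , ne) e → ne (∸-cancelʳ-≡ p q e) }) (ps , a)) ∷ map-pred-unique ps u
    below : ∀ m xs → Unique xs → All (λ y → 1 ≤ y × y ≤ m) xs → length xs ≤ m
    below m xs u a = subst (_≤ m) (length-map (_∸ 1) xs) (unique-<⇒length≤ m (map (_∸ 1) xs) (map-pred-unique (All.map proj₁ a) u)
      (All.map⁺ (All.map (λ { {suc y} (_ , q) → q }) a)))

  card-Fin : ∀ k n → Card {Fin n} (λ _ → ⊤) (suc k) (n ^ suc k)
  card-Fin k n = card-inj _≟_ (suc ∘ toℕ) (λ i _ → s≤s z≤n , ^-monoˡ-≤ (suc k) (Fin.toℕ<n i))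
    (λ i j _ _ e → Fin.toℕ-injective (suc-injective e)) (card-bounded-power k (n ^ suc k))

  card-Bool : ∀ k → Card {Bool} (λ _ → ⊤) (suc k) (2 ^ suc k)
  card-Bool k = card-inj Fin._≟_ (λ { false → zero ; true → suc zero }) _
    (λ { false false _ _ _ → refl ; true true _ _ _ → refl ; false true _ _ () ; true false _ _ () }) (card-Fin k 2)

  -- Masks and vectors with two kinds of coordinates

  countT : ∀ {n} → Vec Bool n → ℕ
  countT [] = 0
  countT (true ∷ b) = suc (countT b)
  countT (false ∷ b) = countT b

  countF : ∀ {n} → Vec Bool n → ℕ
  countF [] = 0
  countF (true ∷ b) = countF b
  countF (false ∷ b) = suc (countF b)

  countT≤ : ∀ {n} (b : Vec Bool n) → countT b ≤ n
  countT≤ [] = z≤n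
  countT≤ (true ∷ b) = s≤s (countT≤ b)
  countT≤ (false ∷ b) = m≤n⇒m≤1+n (countT≤ b)

  countF≡ : ∀ {n} (b : Vec Bool n) → countF b ≡ n ∸ countT b
  countF≡ [] = refl
  countF≡ (true ∷ b) = countF≡ b
  countF≡ (false ∷ b) = trans (cong suc (countF≡ b)) (sym (+-∸-assoc 1 (countT≤ b)))

  -- Vectors keep their full length and a mask marks the coordinates of the second kind, so that
  -- rows and columns of a matrix need no reindexing when a basis among them is singled out.
  card-Vec : ∀ {X : Set} {k N₀ N₁ n} → DecidableEquality X → (b : Vec Bool n) (Q₀ Q₁ : Fin n → X → Set) →
    (∀ j → Card (Q₀ j) (suc k) N₀) → (∀ j → Card (Q₁ j) (suc k) N₁) →
    Card {Vec X n} (λ v → ∀ j → (if lookup b j then Q₁ j else Q₀ j) (lookup v j)) (suc k)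
      (N₁ ^ countT b * N₀ ^ countF b)
  card-Vec _≟_ [] Q₀ Q₁ c₀ c₁ = card-subsingleton λ { [] [] _ _ → refl }
  card-Vec {k = k} {N₀} {N₁} _≟_ (t ∷ b) Q₀ Q₁ c₀ c₁ = card-mono (≤-reflexive (bound′ t))
    (fibration {R = λ x w → Vec.head w ≡ x × (∀ j → (if lookup b j then Q₁ (suc j) else Q₀ (suc j)) (lookup (Vec.tail w) j))} _≟_
      (λ { (x ∷ w) p → x , p zero , refl , λ j → p (suc j) })
      (first t)
      (λ x _ → card-inj (Vec.≡-dec _≟_) Vec.tail (λ _ → proj₂) (λ { (x ∷ w) (.x ∷ .w) (refl , _) (refl , _) refl → refl })
        (card-Vec _≟_ b (Q₀ ∘ suc) (Q₁ ∘ suc) (c₀ ∘ suc) (c₁ ∘ suc))))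
    where
    N : Bool → ℕ
    N t = if t then N₁ else N₀
    first : ∀ t → Card (if t then Q₁ zero else Q₀ zero) (suc k) (N t)
    first true = c₁ zero
    first false = c₀ zero
    bound′ : ∀ t → N t * (N₁ ^ countT b * N₀ ^ countF b) ≡ N₁ ^ countT (t ∷ b) * N₀ ^ countF (t ∷ b)
    bound′ true = sym (*-assoc N₁ (N₁ ^ countT b) (N₀ ^ countF b))
    bound′ false = trans (sym (*-assoc N₀ (N₁ ^ countT b) _)) (trans (cong (_* N₀ ^ countF b) (*-comm N₀ (N₁ ^ countT b))) (*-assoc (N₁ ^ countT b) N₀ _))

  -- Bd P p e bounds the 2K-th power of the number of elements of P H i by C H^(pK + e), for every K ≥ 1,
  -- uniformly in the parameter i: this is #(P H i) ≤ H^(p/2 + o(1)), and #(P H i) ≪ H^(p/2) when e = 0.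
  record Bd {I X : Set} (P : ℕ → I → X → Set) (p e : ℕ) : Set where
    constructor bd
    field at : ∀ k → Σ ℕ λ C → (1 ≤ C) × (∀ H → 1 ≤ H → ∀ i → Card (P H i) (2 * suc k) (C * H ^ (p * suc k + e)))

  open Bd public

  -- The new parameter may be read off a member of the set, since an empty set needs no bound. Data
  -- hidden in the predicate, such as numerators, denominators or relations between rows, become
  -- parameters in this way.
  bd-⊆ : ∀ {I J X : Set} {P : ℕ → I → X → Set} {Q : ℕ → J → X → Set} {p e p′ e′} →
    (∀ H i x → 1 ≤ H → P H i x → Σ J λ j → ∀ y → P H i y → Q H j y) → p ≤ p′ → e ≤ e′ → Bd Q p e → Bd P p′ e′
  bd-⊆ h p≤ e≤ q = bd λ k → let (C , 1≤C , c) = at q k in C , 1≤C , λ H 1≤H i →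
    card-witness λ x px → let (j , f) = h H i x 1≤H px in
      card-⊆ f (card-mono (*-monoʳ-≤ C (^-monoʳ-≤ H {{>-nonZero 1≤H}} (+-mono-≤ (*-monoˡ-≤ (suc k) p≤) e≤))) (c H 1≤H j))

  bd-weaken : ∀ {I X : Set} {P : ℕ → I → X → Set} {p e p′ e′} → p ≤ p′ → e ≤ e′ → Bd P p e → Bd P p′ e′
  bd-weaken = bd-⊆ λ _ i _ _ _ → i , λ _ q → q

  -- Successive choices: main exponents add, losses add, and the chosen label joins the parameters
  -- of the next choice.
  bd-fibration : ∀ {I J X Y : Set} {P : ℕ → I → X → Set} {T : ℕ → I → Y → Set} {R : ℕ → J → X → Set} {p e q f} →
    DecidableEquality Y → (g : I → Y → J) →
    (∀ H i x → 1 ≤ H → P H i x → Σ Y λ y → T H i y × R H (g i y) x) →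
    Bd T p e → Bd R q f → Bd P (p + q) (e + f)
  bd-fibration {p = p} {e} {q} {f} _≟_ g label t r = bd λ k → let (C , 1≤C , c) = at t k ; (D , 1≤D , d) = at r k in
    C * D , *-mono-≤ 1≤C 1≤D , λ H 1≤H i →
      card-mono (≤-reflexive (trans ([m*n]*[o*p]≡[m*o]*[n*p] C (H ^ (p * suc k + e)) D (H ^ (q * suc k + f)))
        (cong (C * D *_) (trans (sym (^-distribˡ-+-* H (p * suc k + e) (q * suc k + f))) (cong (H ^_)
          (solve 5 (λ p q e f k → (p :* k :+ e) :+ (q :* k :+ f) := (p :+ q) :* k :+ (e :+ f)) refl p q e f (suc k)))))))
        (fibration _≟_ (λ x → label H i x 1≤H) (c H 1≤H i) (λ y _ → d H 1≤H (g i y)))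
    where open +-*-Solver

  bd-subsingleton : ∀ {I X : Set} {P : ℕ → I → X → Set} → (∀ H i x y → 1 ≤ H → P H i x → P H i y → x ≡ y) → Bd P 0 0
  bd-subsingleton h = bd λ k → 1 , ≤-refl , λ H 1≤H i → card-subsingleton λ x y → h H i x y 1≤H

  bd-inj : ∀ {I J X Y : Set} {P : ℕ → I → X → Set} {Q : ℕ → J → Y → Set} {p e} → DecidableEquality Y →
    (f : I → X → Y) → (g : I → J) → (∀ H i x → 1 ≤ H → P H i x → Q H (g i) (f i x)) →
    (∀ H i x y → 1 ≤ H → P H i x → P H i y → f i x ≡ f i y → x ≡ y) → Bd Q p e → Bd P p e
  bd-inj _≟_ f g h inj q = bd λ k → let (C , 1≤C , c) = at q k in C , 1≤C , λ H 1≤H i →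
    card-inj _≟_ (f i) (λ x → h H i x 1≤H) (λ x y → inj H i x y 1≤H) (c H 1≤H (g i))

  bd-Fin : ∀ {I : Set} n → Bd {I} {Fin n} (λ _ _ _ → ⊤) 0 0
  bd-Fin n = bd λ k → suc n ^ (2 * suc k) , 1≤^ (suc n) (2 * suc k) (s≤s z≤n) , λ H _ _ →
    card-mono (≤-trans (^-monoˡ-≤ (2 * suc k) (n≤1+n n)) (≤-reflexive (sym (*-identityʳ _)))) (card-Fin _ n)

  bd-Bool : ∀ {I : Set} → Bd {I} {Bool} (λ _ _ _ → ⊤) 0 0
  bd-Bool = bd λ k → 2 ^ (2 * suc k) , 1≤^ 2 (2 * suc k) (s≤s z≤n) , λ H _ _ →
    card-mono (≤-reflexive (sym (*-identityʳ _))) (card-Bool _)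

  -- The mask is a parameter, but the exponents must not depend on it. Hence the number `s` of
  -- marked coordinates is fixed outside and the predicate asks that the mask have exactly that
  -- many.
  bd-Vec : ∀ {J X : Set} {Q₀ Q₁ : ℕ → J → X → Set} {n p₀ e₀ p₁ e₁} s → DecidableEquality X →
    Bd Q₀ p₀ e₀ → Bd Q₁ p₁ e₁ →
    Bd {Vec Bool n × (Fin n → J)} {Vec X n}
      (λ H (b , ι) v → countT b ≡ s × (∀ j → (if lookup b j then Q₁ H (ι j) else Q₀ H (ι j)) (lookup v j)))
      (s * p₁ + (n ∸ s) * p₀) (s * e₁ + (n ∸ s) * e₀)
  bd-Vec {Q₀ = Q₀} {Q₁} {n} {p₀} {e₀} {p₁} {e₁} s _≟_ q₀ q₁ = bd λ k → let (C₀ , 1≤C₀ , c₀) = at q₀ k ; (C₁ , 1≤C₁ , c₁) = at q₁ k in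
    C₁ ^ s * C₀ ^ (n ∸ s) , *-mono-≤ (1≤^ C₁ s 1≤C₁) (1≤^ C₀ (n ∸ s) 1≤C₀) , λ { H 1≤H (b , ι) →
      card-witness λ { _ (refl , _) → card-⊆ (λ _ → proj₂)
        (card-mono (≤-reflexive (trans (cong (λ f → (C₁ * H ^ (p₁ * suc k + e₁)) ^ countT b * (C₀ * H ^ (p₀ * suc k + e₀)) ^ f) (countF≡ b))
            (bound′ k C₁ C₀ H (countT b) (n ∸ countT b))))
          (card-Vec _≟_ b (λ j → Q₀ H (ι j)) (λ j → Q₁ H (ι j)) (λ j → c₀ H 1≤H (ι j)) (λ j → c₁ H 1≤H (ι j)))) } }
    where
    open +-*-Solver
    bound′ : ∀ k C₁ C₀ H s t → (C₁ * H ^ (p₁ * suc k + e₁)) ^ s * (C₀ * H ^ (p₀ * suc k + e₀)) ^ t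
      ≡ C₁ ^ s * C₀ ^ t * H ^ ((s * p₁ + t * p₀) * suc k + (s * e₁ + t * e₀))
    bound′ k C₁ C₀ H s t = begin
      (C₁ * H ^ a) ^ s * (C₀ * H ^ b) ^ t
        ≡⟨ cong₂ _*_ (trans (^-distribʳ-* s C₁ (H ^ a)) (cong (C₁ ^ s *_) (^-*-assoc H a s)))
                     (trans (^-distribʳ-* t C₀ (H ^ b)) (cong (C₀ ^ t *_) (^-*-assoc H b t))) ⟩
      (C₁ ^ s * H ^ (a * s)) * (C₀ ^ t * H ^ (b * t))
        ≡⟨ [m*n]*[o*p]≡[m*o]*[n*p] (C₁ ^ s) (H ^ (a * s)) (C₀ ^ t) (H ^ (b * t)) ⟩
      (C₁ ^ s * C₀ ^ t) * (H ^ (a * s) * H ^ (b * t))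
        ≡⟨ cong (C₁ ^ s * C₀ ^ t *_) (sym (^-distribˡ-+-* H (a * s) (b * t))) ⟩
      C₁ ^ s * C₀ ^ t * H ^ (a * s + b * t)
        ≡⟨ cong (λ z → C₁ ^ s * C₀ ^ t * H ^ z) (solve 7 (λ p₁ p₀ e₁ e₀ k s t →
            (p₁ :* k :+ e₁) :* s :+ (p₀ :* k :+ e₀) :* t := (s :* p₁ :+ t :* p₀) :* k :+ (s :* e₁ :+ t :* e₀)) refl p₁ p₀ e₁ e₀ (suc k) s t) ⟩
      C₁ ^ s * C₀ ^ t * H ^ ((s * p₁ + t * p₀) * suc k + (s * e₁ + t * e₀)) ∎
      where
      open ≡-Reasoning
      a = p₁ * suc k + e₁
      b = p₀ * suc k + e₀

  -- Smooth numbers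

  Smooth : ℕ → ℕ → Set
  Smooth M x = ∀ p → Prime p → p ∣ x → p ∣ M

  module _ (k : ℕ) where

    private
      K = suc k

    -- What remains of a smooth number once the largest visible K-th power is removed: every prime
    -- keeps its exponent modulo K.
    power-code : (ps : List ℕ) → Vec (Fin K) (length ps) → ℕ
    power-code [] [] = 1
    power-code (p ∷ ps) (r ∷ rs) = p ^ toℕ r * power-code ps rs

    -- One more factor p raises its exponent by one; when the exponent would reach K it falls back
    -- to zero and p moves into the K-th power.
    power-code-* : ∀ {p ps} → p ∈ ps → ∀ r → Σ ℕ λ s → Σ (Vec (Fin K) (length ps)) λ r′ →
      p * power-code ps r ≡ s ^ K * power-code ps r′
    power-code-* {p} {_ ∷ ps} (here refl) (r ∷ rs) with suc (toℕ r) <? K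
    ... | yes r+1<K = 1 , fromℕ< r+1<K ∷ rs , (begin
      p * (p ^ toℕ r * power-code ps rs) ≡⟨ sym (*-assoc p (p ^ toℕ r) _) ⟩
      p ^ suc (toℕ r) * power-code ps rs ≡⟨ cong (λ e → p ^ e * power-code ps rs) (sym (Fin.toℕ-fromℕ< r+1<K)) ⟩
      p ^ toℕ (fromℕ< r+1<K) * power-code ps rs ≡⟨ sym (*-identityˡ _) ⟩
      1 * (p ^ toℕ (fromℕ< r+1<K) * power-code ps rs) ≡⟨ cong (_* (p ^ toℕ (fromℕ< r+1<K) * power-code ps rs)) (sym (^-zeroˡ K)) ⟩
      1 ^ K * (p ^ toℕ (fromℕ< r+1<K) * power-code ps rs) ∎)
      where open ≡-Reasoning
    ... | no r+1≮K = p , zero ∷ rs , (begin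
      p * (p ^ toℕ r * power-code ps rs) ≡⟨ sym (*-assoc p (p ^ toℕ r) _) ⟩
      p ^ suc (toℕ r) * power-code ps rs ≡⟨ cong (λ e → p ^ e * power-code ps rs) (≤-antisym (Fin.toℕ<n r) (≮⇒≥ r+1≮K)) ⟩
      p ^ K * power-code ps rs ≡⟨ cong (p ^ K *_) (sym (*-identityˡ _)) ⟩
      p ^ K * (1 * power-code ps rs) ∎)
      where open ≡-Reasoning
    power-code-* {p} {q ∷ ps} (there m) (r ∷ rs) with power-code-* m rs
    ... | s , rs′ , e = s , r ∷ rs′ , (begin
      p * (q ^ toℕ r * power-code ps rs) ≡⟨ x∙yz≈y∙xz p (q ^ toℕ r) _ ⟩
      q ^ toℕ r * (p * power-code ps rs) ≡⟨ cong (q ^ toℕ r *_) e ⟩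
      q ^ toℕ r * (s ^ K * power-code ps rs′) ≡⟨ x∙yz≈y∙xz (q ^ toℕ r) (s ^ K) _ ⟩
      s ^ K * (q ^ toℕ r * power-code ps rs′) ∎)
      where
      open ≡-Reasoning
      open import Algebra.Properties.CommutativeSemigroup *-commutativeSemigroup using (x∙yz≈y∙xz)

    power-decompose : ∀ ps fs → All (_∈ ps) fs → Σ ℕ λ y → Σ (Vec (Fin K) (length ps)) λ r → product fs ≡ y ^ K * power-code ps r
    power-decompose ps [] [] = 1 , zeros ps , sym (trans (cong (_* power-code ps (zeros ps)) (^-zeroˡ K)) (trans (*-identityˡ _) (code-zeros ps)))
      where
      zeros : ∀ ps → Vec (Fin K) (length ps)
      zeros [] = []
      zeros (_ ∷ ps) = zero ∷ zeros ps
      code-zeros : ∀ ps → power-code ps (zeros ps) ≡ 1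
      code-zeros [] = refl
      code-zeros (_ ∷ ps) = trans (*-identityˡ _) (code-zeros ps)
    power-decompose ps (f ∷ fs) (m ∷ ms) with power-decompose ps fs ms
    ... | y , r , e with power-code-* m r
    ... | s , r′ , e′ = s * y , r′ , (begin
      f * product fs ≡⟨ cong (f *_) e ⟩
      f * (y ^ K * power-code ps r) ≡⟨ x∙yz≈y∙xz f (y ^ K) _ ⟩
      y ^ K * (f * power-code ps r) ≡⟨ cong (y ^ K *_) e′ ⟩
      y ^ K * (s ^ K * power-code ps r′) ≡⟨ sym (*-assoc (y ^ K) (s ^ K) _) ⟩
      y ^ K * s ^ K * power-code ps r′ ≡⟨ cong (_* power-code ps r′) (trans (*-comm (y ^ K) (s ^ K)) (sym (^-distribʳ-* K s y))) ⟩
      (s * y) ^ K * power-code ps r′ ∎)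
      where
      open ≡-Reasoning
      open import Algebra.Properties.CommutativeSemigroup *-commutativeSemigroup using (x∙yz≈y∙xz)

  -- There are at most B distinct entries below B, paid for by `B ^ B`; every other entry is at
  -- least B and pays for its own factor. Applied to the primes dividing M, this bounds B^ω(M) by a
  -- constant times M.
  ^length≤product : ∀ B → 1 ≤ B → ∀ ps → Unique ps → All (1 ≤_) ps → B ^ length ps ≤ B ^ B * product ps
  ^length≤product B 1≤B ps u a = ≤-trans (split ps a)
    (*-monoˡ-≤ (product ps) (^-monoʳ-≤ B {{>-nonZero 1≤B}} (unique-<⇒length≤ B small (Unique.filter⁺ (_<? B) u) (All.all-filter (_<? B) ps))))
    where
    small = filter (_<? B) ps
    split : ∀ ps → All (1 ≤_) ps → B ^ length ps ≤ B ^ length (filter (_<? B) ps) * product ps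
    split [] [] = ≤-refl
    split (p ∷ ps) (1≤p ∷ a) with p <? B
    ... | yes p<B rewrite filter-accept (_<? B) {xs = ps} p<B = ≤-trans (*-monoʳ-≤ B (split ps a)) (≤-trans (≤-reflexive (sym (*-assoc B _ _)))
        (*-monoʳ-≤ (B * B ^ length (filter (_<? B) ps)) (m≤n*m (product ps) p {{>-nonZero 1≤p}})))
    ... | no p≮B rewrite filter-reject (_<? B) {xs = ps} p≮B = ≤-trans (*-mono-≤ (≮⇒≥ p≮B) (split ps a)) (≤-reflexive (x∙yz≈y∙xz p (B ^ length (filter (_<? B) ps)) _))
      where open import Algebra.Properties.CommutativeSemigroup *-commutativeSemigroup using (x∙yz≈y∙xz)

  product-support : ∀ ps → All (1 ≤_) ps → product (support {ℕ} _≟_ ps) ≤ product ps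
  product-support [] [] = ≤-refl
  product-support (p ∷ ps) (1≤p ∷ a) with p ∈? support {ℕ} _≟_ ps
    where open import Data.List.Membership.DecPropositional _≟_ using (_∈?_)
  ... | yes _ = ≤-trans (product-support ps a) (m≤n*m (product ps) p {{>-nonZero 1≤p}})
  ... | no  _ = *-monoʳ-≤ p (product-support ps a)

  -- An M-smooth x is y^K ∏ p^r(p) with r(p) < K, so there are at most X^(1/K) K^ω(M) of them up to X.
  card-smooth : ∀ k → Σ ℕ λ C → 1 ≤ C × (∀ M X → 1 ≤ M → Card (λ x → 1 ≤ x × x ≤ X × Smooth M x) (suc k) (C * M * X))
  card-smooth k = B ^ B , 1≤^ B B 1≤B , count
    where
    K = suc k
    -- The number of codes is K^ω, and its K-th power is (K^K)^ω.
    B = K ^ K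
    1≤B = 1≤^ K K (s≤s z≤n)
    count : ∀ M X → 1 ≤ M → Card (λ x → 1 ≤ x × x ≤ X × Smooth M x) K (B ^ B * M * X)
    count M@(suc _) X 1≤M = card-mono (*-monoˡ-≤ X ω-bound)
      (fibration {R = λ r x → 1 ≤ x × x ≤ X × Σ ℕ λ y → x ≡ y ^ K * power-code k ps r} (Vec.≡-dec Fin._≟_) label
        (codes (length ps)) fibre)
      where
      open PrimeFactorisation
      fs = factors (factorise M)
      ps = support {ℕ} _≟_ fs
      codes : ∀ n → Card {Vec (Fin K) n} (λ _ → ⊤) K (B ^ n)
      codes zero = card-subsingleton λ { [] [] _ _ → refl }
      codes (suc n) = fibration {R = λ r v → Vec.head v ≡ r} Fin._≟_ (λ v _ → Vec.head v , tt , refl) (card-Fin k K)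
        (λ r _ → card-inj (Vec.≡-dec Fin._≟_) Vec.tail _ (λ { (r ∷ v) (.r ∷ .v) refl refl refl → refl }) (codes n))
      positive : All (1 ≤_) fs
      positive = All.map (λ pr → n≢0⇒n>0 (≢-nonZero⁻¹ _ {{prime⇒nonZero pr}})) (factorsPrime (factorise M))
      ω-bound : B ^ length ps ≤ B ^ B * M
      ω-bound = ≤-trans (^length≤product B 1≤B ps (support-unique {ℕ} _≟_ fs) (support-All {ℕ} _≟_ fs positive))
        (*-monoʳ-≤ (B ^ B) (≤-trans (product-support fs positive) (≤-reflexive (sym (isFactorisation (factorise M))))))
      label : ∀ x → 1 ≤ x × x ≤ X × Smooth M x → Σ (Vec (Fin K) (length ps)) λ r →
        ⊤ × (1 ≤ x × x ≤ X × Σ ℕ λ y → x ≡ y ^ K * power-code k ps r)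
      label x@(suc _) (1≤x , x≤X , sm) = let
          gs = factors (factorise x)
          e = isFactorisation (factorise x)
          prime = factorsPrime (factorise x)
          inps : All (_∈ ps) gs
          inps = All.tabulate λ {p} p∈ → ∈-support {ℕ} _≟_ fs (factorisationHasAllPrimeFactors (All.lookup prime p∈)
            (subst (p ∣_) (isFactorisation (factorise M)) (sm p (All.lookup prime p∈) (subst (p ∣_) (sym e) (∈⇒∣product p∈))))
            (factorsPrime (factorise M)))
          (y , r , d) = power-decompose k ps gs inps
        in r , tt , 1≤x , x≤X , y , trans e d
      fibre : ∀ r → ⊤ → Card (λ x → 1 ≤ x × x ≤ X × Σ ℕ λ y → x ≡ y ^ K * power-code k ps r) K X
      fibre r _ = subst (Card _ K) (*-identityʳ X) (fibration {R = λ y x → x ≡ y ^ K * power-code k ps r} _≟_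
        (λ { x (1≤x , x≤X , y , e) → y , (root-positive y x e 1≤x , ≤-trans (root≤ y x e 1≤x) x≤X) , e })
        (card-bounded-power k X) (λ y _ → card-subsingleton λ { _ _ refl refl → refl }))
        where
        root-positive : ∀ y x → x ≡ y ^ K * power-code k ps r → 1 ≤ x → 1 ≤ y
        root-positive zero x refl ()
        root-positive (suc y) x _ _ = s≤s z≤n
        root≤ : ∀ y x → x ≡ y ^ K * power-code k ps r → 1 ≤ x → y ^ K ≤ x
        root≤ y x refl 1≤x with power-code k ps r
        ... | zero = ⊥-elim (<⇒≱ 1≤x (≤-reflexive (*-zeroʳ (y ^ K))))
        ... | suc c = m≤m*n (y ^ K) (suc c)

  -- The bounds on M and on x enter the 2K-th power of the count only once, whatever K is. They are
  -- therefore pure loss, and the main exponent is 0.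
  bd-smooth : ∀ c d → Bd {ℕ} {ℕ} (λ H M x → (1 ≤ M × M ≤ (2 * H) ^ c) × (1 ≤ x × x ≤ (2 * H) ^ d) × Smooth M x) 0 (c + d)
  -- `k + 1 * suc k` is the predecessor of `2 * suc k`, so the power counted is exactly the 2K-th.
  bd-smooth c d = bd λ k → let (C , 1≤C , count) = card-smooth (k + 1 * suc k) in
    C * 2 ^ (c + d) , *-mono-≤ 1≤C (1≤^ 2 (c + d) (s≤s z≤n)) , λ H 1≤H M →
      card-witness λ { _ ((1≤M , M≤) , _) → card-⊆ (λ _ (_ , (1≤x , x≤) , s) → 1≤x , x≤ , s)
        (card-mono (≤-trans (*-monoˡ-≤ ((2 * H) ^ d) (*-monoʳ-≤ C M≤)) (≤-reflexive (begin
          C * (2 * H) ^ c * (2 * H) ^ d ≡⟨ *-assoc C _ _ ⟩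
          C * ((2 * H) ^ c * (2 * H) ^ d) ≡⟨ cong (C *_) (sym (^-distribˡ-+-* (2 * H) c d)) ⟩
          C * (2 * H) ^ (c + d) ≡⟨ cong (C *_) (^-distribʳ-* (c + d) 2 H) ⟩
          C * (2 ^ (c + d) * H ^ (c + d)) ≡⟨ sym (*-assoc C _ _) ⟩
          C * 2 ^ (c + d) * H ^ (c + d) ∎)))
        (count M ((2 * H) ^ d) 1≤M)) }
    where open ≡-Reasoning

  -- Square divisors

  ∣q²-cancel : ∀ {p q} D → Prime p → ¬ p ∣ q → p ∣ q * q * D → p ∣ D
  ∣q²-cancel {p} {q} D pr p∤q h with euclidsLemma (q * q) D pr h
  ... | inj₂ p∣D = p∣D
  ... | inj₁ p∣q² with euclidsLemma q q pr p∣q²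
  ... | inj₁ p∣q = ⊥-elim (p∤q p∣q)
  ... | inj₂ p∣q = ⊥-elim (p∤q p∣q)

  ∣²-cancel : ∀ {p q D} → Prime p → ¬ p ∣ q → p * p ∣ q * q * D → p * p ∣ D
  ∣²-cancel {p} {q} {D} pr p∤q h with ∣q²-cancel D pr p∤q (∣-trans (m∣m*n p) h)
  ... | divides D′ refl = *-monoˡ-∣ p (∣q²-cancel D′ pr p∤q (*-cancelˡ-∣ p {{prime⇒nonZero pr}} (subst (p * p ∣_) (reorder q D′ p) h)))
    where
    open +-*-Solver
    reorder : ∀ q D p → q * q * (D * p) ≡ p * (q * q * D)
    reorder = solve 3 (λ q D p → q :* q :* (D :* p) := p :* (q :* q :* D)) refl

  prime≥2 : ∀ {p} → Prime p → 2 ≤ p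
  prime≥2 {p} pr = nonTrivial⇒n>1 p {{prime⇒nonTrivial pr}}

  -- Strong induction: a square q * q with q ≥ 2 is stripped from D and q joins M. A prime whose
  -- square divides D either divides q, or its square survives in the cofactor. When nothing can be
  -- stripped, D is squarefree and M = 1.
  square-part : ∀ D → 1 ≤ D → Σ ℕ λ M → M * M ∣ D × (∀ p → Prime p → p * p ∣ D → p ∣ M)
  square-part = <-rec (λ D → 1 ≤ D → Σ ℕ λ M → M * M ∣ D × (∀ p → Prime p → p * p ∣ D → p ∣ M)) λ D rec 1≤D → case anyUpTo? (λ q → (2 ≤? q) ×-dec (q * q ∣? D)) (suc D) of λ where
    (yes (q , _ , 2≤q , divides D′ D≡)) → let
        1≤D′ : 1 ≤ D′
        1≤D′ = n≢0⇒n>0 λ { refl → <⇒≱ 1≤D (≤-reflexive D≡) }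
        D′<D : D′ < D
        D′<D = subst (D′ <_) (sym D≡) (m<m*n D′ (q * q) {{>-nonZero 1≤D′}} (≤-trans 2≤q (m≤m*n q q {{>-nonZero (≤-trans (s≤s z≤n) 2≤q)}})))
        (M , M²∣ , h) = rec {D′} D′<D 1≤D′
      in q * M ,
         subst₂ _∣_ ([m*n]*[o*p]≡[m*o]*[n*p] q q M M) (trans (*-comm (q * q) D′) (sym D≡)) (*-monoʳ-∣ (q * q) M²∣) ,
         λ p pr p²∣D → case p ∣? q of λ where
           (yes p∣q) → ∣-trans p∣q (m∣m*n M)
           (no p∤q) → ∣-trans (h p pr (∣²-cancel pr p∤q (subst (p * p ∣_) (trans D≡ (*-comm D′ (q * q))) p²∣D))) (n∣m*n q)
    (no none) → 1 , 1∣ D , λ p pr p²∣D → ⊥-elim (none (p ,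
        s≤s (≤-trans (m≤m*n p p {{prime⇒nonZero pr}}) (∣⇒≤ {{>-nonZero 1≤D}} p²∣D)) , prime≥2 pr , p²∣D))

module EgyptianMatrices where

  open Counting
  open import Data.Nat as ℕ using (zero; z≤n; s≤s; >-nonZero)
  open import Data.Nat.Properties hiding (_≟_)
  open import Data.Nat.Divisibility using (_∣_; _∣?_; divides; ∣-trans; ∣⇒≤; m∣m*n; n∣m*n; ∣m⇒∣m*n; ∣n⇒∣m*n; *-pres-∣; ∣1⇒≡1)
  open import Data.Nat.Primality using (Prime; euclidsLemma; ¬prime[1])
  open import Data.Nat.Solver using () renaming (module +-*-Solver to ℕSolver)
  open import Data.List as List using ()
  open import Data.Integer as ℤ using (ℤ; +_; -[1+_]; ∣_∣)
  import Data.Integer.Properties as ℤ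
  import Data.Integer.Solver as ℤSolver
  open import Data.Rational as ℚ using (ℚ; 0ℚ; 1ℚ; _+_; _*_; _-_; -_; _/_)
  import Data.Rational.Properties as ℚ
  import Data.Rational.Unnormalised as ℚᵘ
  import Data.Rational.Unnormalised.Properties as ℚᵘ
  open import Data.Rational.Solver using (module +-*-Solver)
  open import Algebra.Bundles using (module AbelianGroup)
  import Data.Product.Properties as Product

  -- Unit fractions and heights

  ι : ℤ → ℚ
  ι a = a / 1

  toℚᵘ-ι : ∀ a → ℚ.toℚᵘ (ι a) ℚᵘ.≃ ℚᵘ.mkℚᵘ a 0
  toℚᵘ-ι a = ℚ.toℚᵘ-fromℚᵘ (ℚᵘ.mkℚᵘ a 0)

  ι-injective : ∀ {a b} → ι a ≡ ι b → a ≡ b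
  ι-injective {a} {b} e with ℚᵘ.≃-trans (ℚᵘ.≃-sym (toℚᵘ-ι a)) (ℚᵘ.≃-trans (ℚᵘ.≃-reflexive (cong ℚ.toℚᵘ e)) (toℚᵘ-ι b))
  ... | ℚᵘ.*≡* h = trans (sym (ℤ.*-identityʳ a)) (trans h (ℤ.*-identityʳ b))

  ι-* : ∀ a b → ι (a ℤ.* b) ≡ ι a * ι b
  ι-* a b = ℚ.toℚᵘ-injective (ℚᵘ.≃-trans (toℚᵘ-ι (a ℤ.* b)) (ℚᵘ.≃-sym
    (ℚᵘ.≃-trans (ℚ.toℚᵘ-homo-* (ι a) (ι b)) (ℚᵘ.*-cong (toℚᵘ-ι a) (toℚᵘ-ι b)))))

  ι-+ : ∀ a b → ι (a ℤ.+ b) ≡ ι a + ι b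
  ι-+ a b = ℚ.toℚᵘ-injective (ℚᵘ.≃-trans (toℚᵘ-ι (a ℤ.+ b)) (ℚᵘ.≃-sym
    (ℚᵘ.≃-trans (ℚ.toℚᵘ-homo-+ (ι a) (ι b)) (ℚᵘ.≃-trans (ℚᵘ.+-cong (toℚᵘ-ι a) (toℚᵘ-ι b))
      (ℚᵘ.≃-reflexive (cong (λ z → ℚᵘ.mkℚᵘ z 0) (cong₂ ℤ._+_ (ℤ.*-identityʳ a) (ℤ.*-identityʳ b))))))))

  ι-neg : ∀ a → ι (ℤ.- a) ≡ - ι a
  ι-neg a = ℚ.toℚᵘ-injective (ℚᵘ.≃-trans (toℚᵘ-ι (ℤ.- a)) (ℚᵘ.≃-sym
    (ℚᵘ.≃-trans (ℚ.toℚᵘ-homo‿- (ι a)) (ℚᵘ.-‿cong (toℚᵘ-ι a)))))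

  ι≢0 : ∀ {a} → 1 ≤ ∣ a ∣ → ι a ≢ 0ℚ
  ι≢0 {a} 1≤a e with ι-injective {a} {+ 0} e
  ι≢0 {a} () e | refl

  1ℚ≢0ℚ : 1ℚ ≢ 0ℚ
  1ℚ≢0ℚ ()

  recip : ∀ q → q ≢ 0ℚ → Σ ℚ λ q⁻¹ → q * q⁻¹ ≡ 1ℚ
  recip q q≢0 = (ℚ.1/ q) {{ℚ.≢-nonZero q≢0}} , ℚ.*-inverseʳ q {{ℚ.≢-nonZero q≢0}}

  *-unit-≢0 : ∀ {x y} → x * y ≡ 1ℚ → x ≢ 0ℚ
  *-unit-≢0 {x} {y} e refl = 1ℚ≢0ℚ (trans (sym e) (ℚ.*-zeroˡ y))

  *-cancelˡ : ∀ {x y z} → x ≢ 0ℚ → x * y ≡ x * z → y ≡ z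
  *-cancelˡ {x} {y} {z} x≢0 e = let (w , xw) = recip x x≢0 ; h = λ y → trans (solve 3 (λ x w y → w :* (x :* y) := (x :* w) :* y) refl x w y) (trans (cong (_* y) xw) (ℚ.*-identityˡ y)) in
    trans (sym (h y)) (trans (cong (w *_) e) (h z))
    where open +-*-Solver

  *≡0⇒ : ∀ {x y} → x ≢ 0ℚ → x * y ≡ 0ℚ → y ≡ 0ℚ
  *≡0⇒ {x} x≢0 e = *-cancelˡ x≢0 (trans e (sym (ℚ.*-zeroʳ x)))

  *-≢0 : ∀ {x y} → x ≢ 0ℚ → y ≢ 0ℚ → x * y ≢ 0ℚ
  *-≢0 x≢0 y≢0 e = y≢0 (*≡0⇒ x≢0 e)

  -- The sign is a Boolean label, so it affects only the constant.
  bd-sign : ∀ {I : Set} {P : ℕ → I → ℕ → Set} {p e} → Bd P p e → Bd (λ H i a → P H i ∣ a ∣) p e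
  bd-sign {I} {P} q = bd-fibration {R = λ H (i , s) a → P H i ∣ a ∣ × negative a ≡ s} {p = 0} {e = 0} Bool._≟_ _,_
    (λ H i a _ h → negative a , tt , h , refl) bd-Bool
    (bd-inj ℕ._≟_ (λ _ → ∣_∣) proj₁ (λ _ _ _ _ → proj₁) (λ { H (i , s) a b _ (_ , e) (_ , f) g → same a b g (trans e (sym f)) }) q)
    where
    negative : ℤ → Bool
    negative (+ _) = false
    negative (-[1+ _ ]) = true
    same : ∀ a b → ∣ a ∣ ≡ ∣ b ∣ → negative a ≡ negative b → a ≡ b
    same (+ a) (+ b) refl _ = refl
    same (-[1+ a ]) (-[1+ b ]) e _ = cong -[1+_] (suc-injective e)

  -- Main exponents are measured in halves: a free denominator up to H costs 2.
  bd-interval : ∀ {I : Set} → Bd {I} {ℕ} (λ H _ a → 1 ≤ a × a ≤ H) 2 0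
  bd-interval = bd λ k → 1 , s≤s z≤n , λ H 1≤H _ → card-mono
    (≤-reflexive (trans (cong (H ^_) (sym (+-identityʳ (2 ℕ.* suc k)))) (sym (*-identityˡ _))))
    (card-⊆ (λ a (1≤a , a≤H) → 1≤a , ^-monoˡ-≤ (2 ℕ.* suc k) a≤H) (card-bounded-power _ (H ^ (2 ℕ.* suc k))))

  Inverse : ℤ → ℚ → Set
  Inverse a x = x * ι a ≡ 1ℚ

  inverse-unique : ∀ {a x y} → Inverse a x → Inverse a y → x ≡ y
  inverse-unique {a} {x} {y} h k = *-cancelˡ {x = ι a} (*-unit-≢0 (trans (ℚ.*-comm (ι a) x) h))
    (trans (ℚ.*-comm (ι a) x) (trans (trans h (sym k)) (ℚ.*-comm y (ι a))))

  bd-Egyptian : ∀ {I : Set} → Bd {I} {ℚ} (λ H _ → IsEgyptian H) 2 0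
  bd-Egyptian = bd-fibration {R = λ _ a → Inverse a} {q = 0} ℤ._≟_ (λ _ a → a) (λ { H _ x _ (a , 1≤a , a≤H , h) → a , (1≤a , a≤H) , h })
    (bd-sign bd-interval) (bd-subsingleton λ H a x y _ → inverse-unique {a})

  egyptian≢0 : ∀ {H x} → IsEgyptian H x → x ≢ 0ℚ
  egyptian≢0 (_ , _ , _ , h) = *-unit-≢0 h

  abs-*-≥1 : ∀ a b → 1 ≤ ∣ a ∣ → 1 ≤ ∣ b ∣ → 1 ≤ ∣ a ℤ.* b ∣
  abs-*-≥1 a b 1≤a 1≤b = subst (1 ≤_) (sym (ℤ.abs-* a b)) (*-mono-≤ 1≤a 1≤b)

  abs-*-≤ : ∀ X {c d} a b → ∣ a ∣ ≤ X ^ c → ∣ b ∣ ≤ X ^ d → ∣ a ℤ.* b ∣ ≤ X ^ (c ℕ.+ d)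
  abs-*-≤ X {c} {d} a b a≤ b≤ = subst₂ _≤_ (sym (ℤ.abs-* a b)) (sym (^-distribˡ-+-* X c d)) (*-mono-≤ a≤ b≤)

  -- The fraction need not be reduced. With base 2H instead of H, the factor 2 that appears in the
  -- numerator of a sum is absorbed by one more power, even when H = 1.
  record Ht (c H : ℕ) (q : ℚ) : Set where
    constructor ht
    field
      num den : ℤ
      num≤ : ∣ num ∣ ≤ (2 ℕ.* H) ^ c
      den≥1 : 1 ≤ ∣ den ∣
      den≤ : ∣ den ∣ ≤ (2 ℕ.* H) ^ c
      fraction : q * ι den ≡ ι num

  module _ {H : ℕ} (1≤H : 1 ≤ H) where

    open +-*-Solver

    private
      1≤2H : 1 ≤ 2 ℕ.* H
      1≤2H = *-mono-≤ {1} {2} (s≤s z≤n) 1≤H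

    2H^-mono : ∀ {c d} → c ≤ d → (2 ℕ.* H) ^ c ≤ (2 ℕ.* H) ^ d
    2H^-mono = ^-monoʳ-≤ (2 ℕ.* H) {{>-nonZero 1≤2H}}

    H≤2H : H ≤ (2 ℕ.* H) ^ 1
    H≤2H = ≤-trans (m≤m+n H _) (≤-reflexive (sym (^-identityʳ _)))

    ht-mono : ∀ {c d q} → c ≤ d → Ht c H q → Ht d H q
    ht-mono c≤d (ht a d a≤ 1≤d d≤ h) = ht a d (≤-trans a≤ (2H^-mono c≤d)) 1≤d (≤-trans d≤ (2H^-mono c≤d)) h

    ht-0 : Ht 0 H 0ℚ
    ht-0 = ht (+ 0) (+ 1) z≤n (s≤s z≤n) (s≤s z≤n) refl

    ht-1 : Ht 0 H 1ℚ
    ht-1 = ht (+ 1) (+ 1) (s≤s z≤n) (s≤s z≤n) (s≤s z≤n) refl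

    ht-Egyptian : ∀ {x} → IsEgyptian H x → Ht 1 H x
    ht-Egyptian (a , 1≤a , a≤H , h) = ht (+ 1) a (2H^-mono {0} {1} z≤n) 1≤a (≤-trans a≤H H≤2H) h

    ht-* : ∀ {c d x y} → Ht c H x → Ht d H y → Ht (c ℕ.+ d) H (x * y)
    ht-* {c} {d} {x} {y} (ht a e a≤ 1≤e e≤ h) (ht b f b≤ 1≤f f≤ k) = ht
      (a ℤ.* b) (e ℤ.* f) (abs-*-≤ (2 ℕ.* H) {c} {d} a b a≤ b≤) (abs-*-≥1 e f 1≤e 1≤f) (abs-*-≤ (2 ℕ.* H) {c} {d} e f e≤ f≤) (begin
        x * y * ι (e ℤ.* f) ≡⟨ cong (x * y *_) (ι-* e f) ⟩
        x * y * (ι e * ι f) ≡⟨ solve 4 (λ x y e f → x :* y :* (e :* f) := x :* e :* (y :* f)) refl x y (ι e) (ι f) ⟩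
        x * ι e * (y * ι f) ≡⟨ cong₂ _*_ h k ⟩
        ι a * ι b ≡⟨ sym (ι-* a b) ⟩
        ι (a ℤ.* b) ∎)
      where open ≡-Reasoning

    ht-+ : ∀ {c d x y} → Ht c H x → Ht d H y → Ht (suc (c ℕ.+ d)) H (x + y)
    ht-+ {c} {d} {x} {y} (ht a e a≤ 1≤e e≤ h) (ht b f b≤ 1≤f f≤ k) = ht
      (a ℤ.* f ℤ.+ b ℤ.* e) (e ℤ.* f)
      (≤-trans (ℤ.∣i+j∣≤∣i∣+∣j∣ (a ℤ.* f) (b ℤ.* e)) (≤-trans
        (+-mono-≤ (abs-*-≤ (2 ℕ.* H) {c} {d} a f a≤ f≤) (≤-trans (abs-*-≤ (2 ℕ.* H) {d} {c} b e b≤ e≤) (≤-reflexive (cong ((2 ℕ.* H) ^_) (+-comm d c)))))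
        (≤-trans (≤-reflexive (cong ((2 ℕ.* H) ^ (c ℕ.+ d) ℕ.+_) (sym (+-identityʳ _)))) (*-monoˡ-≤ _ (*-monoʳ-≤ 2 1≤H)))))
      (abs-*-≥1 e f 1≤e 1≤f) (≤-trans (abs-*-≤ (2 ℕ.* H) {c} {d} e f e≤ f≤) (2H^-mono (n≤1+n (c ℕ.+ d)))) (begin
        (x + y) * ι (e ℤ.* f) ≡⟨ cong ((x + y) *_) (ι-* e f) ⟩
        (x + y) * (ι e * ι f) ≡⟨ solve 4 (λ x y e f → (x :+ y) :* (e :* f) := x :* e :* f :+ y :* f :* e) refl x y (ι e) (ι f) ⟩
        x * ι e * ι f + y * ι f * ι e ≡⟨ cong₂ (λ u v → u * ι f + v * ι e) h k ⟩
        ι a * ι f + ι b * ι e ≡⟨ sym (cong₂ _+_ (ι-* a f) (ι-* b e)) ⟩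
        ι (a ℤ.* f) + ι (b ℤ.* e) ≡⟨ sym (ι-+ (a ℤ.* f) (b ℤ.* e)) ⟩
        ι (a ℤ.* f ℤ.+ b ℤ.* e) ∎)
      where open ≡-Reasoning

    ht-neg : ∀ {c x} → Ht c H x → Ht c H (- x)
    ht-neg {c} {x} (ht a e a≤ 1≤e e≤ h) = ht (ℤ.- a) e (subst (_≤ _) (sym (ℤ.∣-i∣≡∣i∣ a)) a≤) 1≤e e≤
      (trans (sym (ℚ.neg-distribˡ-* x (ι e))) (trans (cong -_ h) (sym (ι-neg a))))

    ht-− : ∀ {c d x y} → Ht c H x → Ht d H y → Ht (suc (c ℕ.+ d)) H (x - y)
    ht-− h k = ht-+ h (ht-neg k)

    ht-recip : ∀ {c x y} → x ≢ 0ℚ → x * y ≡ 1ℚ → Ht c H x → Ht c H y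
    ht-recip {c} {x} {y} x≢0 xy (ht a d a≤ 1≤d d≤ h) = ht d a d≤ (1≤a a refl) a≤ (begin
        y * ι a ≡⟨ cong (y *_) (sym h) ⟩
        y * (x * ι d) ≡⟨ solve 3 (λ x y d → y :* (x :* d) := (x :* y) :* d) refl x y (ι d) ⟩
        x * y * ι d ≡⟨ cong (_* ι d) xy ⟩
        1ℚ * ι d ≡⟨ ℚ.*-identityˡ (ι d) ⟩
        ι d ∎)
      where
      open ≡-Reasoning
      1≤a : ∀ b → b ≡ a → 1 ≤ ∣ b ∣
      1≤a (+ zero) refl = ⊥-elim (*-≢0 x≢0 (ι≢0 {d} 1≤d) h)
      1≤a (+ suc _) _ = s≤s z≤n
      1≤a (-[1+ _ ]) _ = s≤s z≤n

    ht-Σ : ∀ {c} m {f : Fin m → ℚ} → (∀ i → Ht c H (f i)) → Ht (m ℕ.* suc c) H (Σℚ m f)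
    ht-Σ zero h = ht-0
    ht-Σ {c} (suc m) h = ht-+ (h zero) (ht-Σ m (λ i → h (suc i)))

  -- Linear equations in unit fractions

  -- Any loss that does not depend on K amounts to H^o(1), so its value is hidden.
  Bdo : {I X : Set} → (ℕ → I → X → Set) → ℕ → Set
  Bdo P p = Σ ℕ (Bd P p)

  -- A divisor of M is M-smooth and at most M, so the divisor bound is a case of the count of smooth
  -- numbers.
  bd-divisor : ∀ c → Bd {ℤ} {ℤ} (λ H M w → (1 ≤ ∣ M ∣ × ∣ M ∣ ≤ (2 ℕ.* H) ^ c) × (∣ w ∣ ∣ ∣ M ∣)) 0 (c ℕ.+ c)
  bd-divisor c = bd-sign {P = λ H M w → (1 ≤ ∣ M ∣ × ∣ M ∣ ≤ (2 ℕ.* H) ^ c) × (w ∣ ∣ M ∣)} (bd-⊆ (λ H M _ _ _ → ∣ M ∣ , λ w → λ { ((1≤M , M≤) , w∣M) →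
    (1≤M , M≤) , (positive w ∣ M ∣ 1≤M w∣M , ≤-trans (∣⇒≤ {{>-nonZero 1≤M}} w∣M) M≤) , λ p _ p∣w → ∣-trans p∣w w∣M })
    ≤-refl ≤-refl (bd-smooth c c))
    where
    positive : ∀ w M → 1 ≤ M → w ∣ M → 1 ≤ w
    positive zero M 1≤M (divides q e) = ⊥-elim (<⇒≱ 1≤M (≤-reflexive (trans e (*-zeroʳ q))))
    positive (suc w) _ _ _ = s≤s z≤n

  IntegerThreeTerm : ℕ → ℕ → ℤ × ℤ × ℤ → ℚ × ℚ × ℚ → Set
  IntegerThreeTerm c H (A , B , C) (x , y , z) =
    (1 ≤ ∣ A ∣ × 1 ≤ ∣ B ∣ × 1 ≤ ∣ C ∣) × (∣ B ∣ ≤ (2 ℕ.* H) ^ c × ∣ C ∣ ≤ (2 ℕ.* H) ^ c) ×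
    (IsEgyptian H x × IsEgyptian H y × IsEgyptian H z) × ι A * x + ι B * y + ι C * z ≡ 0ℚ

  -- With x = 1/a, y = 1/b, z = 1/c the equation reads (Ab + Ba)(Ac + Ca) = BCa²,
  -- so once a is fixed Ab + Ba is one of the divisors of BCa².
  bd-IntegerThreeTerm : ∀ c → Bdo (IntegerThreeTerm c) 2
  bd-IntegerThreeTerm c = _ , bd-fibration {T = λ H i a → 1 ≤ ∣ a ∣ × ∣ a ∣ ≤ H} {R = R₁} {p = 2} {e = 0} {q = 0} ℤ._≟_ _,_
    (λ { H i (x , y , z) 1≤H h@(_ , _ , (( a , 1≤a , a≤H , xa) , _) , _) → a , (1≤a , a≤H) , (1≤a , a≤H) , xa , h })
    (bd-sign bd-interval)
    (bd-fibration {T = T₂} {R = R₂} {p = 0} {e = E} {q = 0} {f = 0} ℤ._≟_ _,_ label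
      (bd-⊆ (λ { H ((A , B , C) , a) w _ _ → B ℤ.* C ℤ.* (a ℤ.* a) , λ _ h → h }) ≤-refl ≤-refl (bd-divisor (c ℕ.+ c ℕ.+ 2)))
      (bd-subsingleton single))
    where
    E = (c ℕ.+ c ℕ.+ 2) ℕ.+ (c ℕ.+ c ℕ.+ 2)
    T₂ : ℕ → (ℤ × ℤ × ℤ) × ℤ → ℤ → Set
    T₂ H ((A , B , C) , a) w = (1 ≤ ∣ B ℤ.* C ℤ.* (a ℤ.* a) ∣ × ∣ B ℤ.* C ℤ.* (a ℤ.* a) ∣ ≤ (2 ℕ.* H) ^ (c ℕ.+ c ℕ.+ 2)) × (∣ w ∣ ∣ ∣ B ℤ.* C ℤ.* (a ℤ.* a) ∣)
    R₁ : ℕ → (ℤ × ℤ × ℤ) × ℤ → ℚ × ℚ × ℚ → Set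
    R₁ H (i , a) t@(x , y , z) = (1 ≤ ∣ a ∣ × ∣ a ∣ ≤ H) × Inverse a x × IntegerThreeTerm c H i t
    R₂ : ℕ → ((ℤ × ℤ × ℤ) × ℤ) × ℤ → ℚ × ℚ × ℚ → Set
    R₂ H (((A , B , C) , a) , w) (x , y , z) = 1 ≤ ∣ A ∣ × 1 ≤ ∣ C ∣ × Inverse a x ×
      (Σ ℤ λ b → Inverse b y × A ℤ.* b ℤ.+ B ℤ.* a ≡ w) × ι A * x + ι B * y + ι C * z ≡ 0ℚ
    -- The values a and w determine b, hence y, because A is not zero; the linear equation then
    -- determines z, because C is not zero.
    single : ∀ H i t t′ → 1 ≤ H → R₂ H i t → R₂ H i t′ → t ≡ t′
    single H (((A , B , C) , a) , w) (x , y , z) (x′ , y′ , z′) _ (1≤A , 1≤C , hx , (b , hy , e) , eq) (_ , _ , hx′ , (b′ , hy′ , e′) , eq′) =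
      cong₂ _,_ x≡x′ (cong₂ _,_ y≡y′ z≡z′)
      where
      open import Algebra.Properties.Group (AbelianGroup.group ℤ.+-0-abelianGroup) using (∙-cancelʳ)
      open import Algebra.Properties.Group ℚ.+-0-group using (∙-cancelˡ)
      x≡x′ : x ≡ x′
      x≡x′ = inverse-unique {a} hx hx′
      b≡b′ : b ≡ b′
      b≡b′ = ℤ.*-cancelˡ-≡ A b b′ {{>-nonZero 1≤A}} (∙-cancelʳ (B ℤ.* a) (A ℤ.* b) (A ℤ.* b′) (trans e (sym e′)))
      y≡y′ : y ≡ y′
      y≡y′ = inverse-unique {b} hy (subst (λ b → Inverse b y′) (sym b≡b′) hy′)
      z≡z′ : z ≡ z′
      z≡z′ = *-cancelˡ (ι≢0 {C} 1≤C) (∙-cancelˡ (ι A * x + ι B * y) (ι C * z) (ι C * z′) (trans eq (trans (sym eq′)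
        (cong (_+ ι C * z′) (sym (cong₂ (λ u v → ι A * u + ι B * v) x≡x′ y≡y′))))))
    label : ∀ H i t → 1 ≤ H → R₁ H i t → Σ ℤ λ w → T₂ H i w × R₂ H (i , w) t
    label H ((A , B , C) , a) (x , y , z) 1≤H ((1≤a , a≤H) , xa , (1≤A , 1≤B , 1≤C) , (B≤ , C≤) , (_ , (b , _ , _ , yb) , (d , _ , _ , zd)) , eq) =
      A ℤ.* b ℤ.+ B ℤ.* a , ((1≤M , M≤) , w∣M) , 1≤A , 1≤C , xa , (b , yb , refl) , eq
      where
      M = B ℤ.* C ℤ.* (a ℤ.* a)
      1≤M = abs-*-≥1 (B ℤ.* C) (a ℤ.* a) (abs-*-≥1 B C 1≤B 1≤C) (abs-*-≥1 a a 1≤a 1≤a)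
      M≤ : ∣ M ∣ ≤ (2 ℕ.* H) ^ (c ℕ.+ c ℕ.+ 2)
      M≤ = begin
        ∣ B ℤ.* C ℤ.* (a ℤ.* a) ∣ ≡⟨ trans (ℤ.abs-* (B ℤ.* C) (a ℤ.* a)) (cong₂ ℕ._*_ (ℤ.abs-* B C) (ℤ.abs-* a a)) ⟩
        ∣ B ∣ ℕ.* ∣ C ∣ ℕ.* (∣ a ∣ ℕ.* ∣ a ∣) ≤⟨ *-mono-≤ (*-mono-≤ B≤ C≤) (*-mono-≤ (≤-trans a≤H (H≤2H 1≤H)) (≤-trans a≤H (H≤2H 1≤H))) ⟩
        X ^ c ℕ.* X ^ c ℕ.* (X ^ 1 ℕ.* X ^ 1) ≡⟨ sym (cong₂ ℕ._*_ (^-distribˡ-+-* X c c) (^-distribˡ-+-* X 1 1)) ⟩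
        X ^ (c ℕ.+ c) ℕ.* X ^ 2 ≡⟨ sym (^-distribˡ-+-* X (c ℕ.+ c) 2) ⟩
        X ^ (c ℕ.+ c ℕ.+ 2) ∎
        where
        open ≤-Reasoning
        X = 2 ℕ.* H
      -- The given equation multiplied by a * b * d.
      cleared : A ℤ.* b ℤ.* d ℤ.+ B ℤ.* a ℤ.* d ℤ.+ C ℤ.* a ℤ.* b ≡ + 0
      cleared = ι-injective {b = + 0} (begin
        ι (A ℤ.* b ℤ.* d ℤ.+ B ℤ.* a ℤ.* d ℤ.+ C ℤ.* a ℤ.* b)
          ≡⟨ trans (ι-+ (A ℤ.* b ℤ.* d ℤ.+ B ℤ.* a ℤ.* d) (C ℤ.* a ℤ.* b)) (cong₂ _+_ (trans (ι-+ (A ℤ.* b ℤ.* d) (B ℤ.* a ℤ.* d)) (cong₂ _+_ (ι-** A b d) (ι-** B a d))) (ι-** C a b)) ⟩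
        ι A * ι b * ι d + ι B * ι a * ι d + ι C * ι a * ι b
          ≡⟨ solve 6 (λ A B C a b d → A :* b :* d :+ B :* a :* d :+ C :* a :* b := A :* con 1ℚ :* b :* d :+ B :* con 1ℚ :* a :* d :+ C :* con 1ℚ :* a :* b) refl (ι A) (ι B) (ι C) (ι a) (ι b) (ι d) ⟩
        ι A * 1ℚ * ι b * ι d + ι B * 1ℚ * ι a * ι d + ι C * 1ℚ * ι a * ι b
          ≡⟨ cong₂ _+_ (cong₂ _+_ (cong (λ u → ι A * u * ι b * ι d) (sym xa)) (cong (λ u → ι B * u * ι a * ι d) (sym yb))) (cong (λ u → ι C * u * ι a * ι b) (sym zd)) ⟩
        ι A * (x * ι a) * ι b * ι d + ι B * (y * ι b) * ι a * ι d + ι C * (z * ι d) * ι a * ι b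
          ≡⟨ solve 9 (λ A B C a b d x y z → A :* (x :* a) :* b :* d :+ B :* (y :* b) :* a :* d :+ C :* (z :* d) :* a :* b := (A :* x :+ B :* y :+ C :* z) :* (a :* b :* d)) refl (ι A) (ι B) (ι C) (ι a) (ι b) (ι d) x y z ⟩
        (ι A * x + ι B * y + ι C * z) * (ι a * ι b * ι d)
          ≡⟨ trans (cong (_* (ι a * ι b * ι d)) eq) (ℚ.*-zeroˡ (ι a * ι b * ι d)) ⟩
        0ℚ ∎)
        where
        open ≡-Reasoning
        open +-*-Solver
        ι-** : ∀ p q r → ι (p ℤ.* q ℤ.* r) ≡ ι p * ι q * ι r
        ι-** p q r = trans (ι-* (p ℤ.* q) r) (cong (_* ι r) (ι-* p q))
      factored : (A ℤ.* b ℤ.+ B ℤ.* a) ℤ.* (A ℤ.* d ℤ.+ C ℤ.* a) ≡ M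
      factored = trans (solve 6 (λ A B C a b d → (A :* b :+ B :* a) :* (A :* d :+ C :* a) := A :* (A :* b :* d :+ B :* a :* d :+ C :* a :* b) :+ B :* C :* (a :* a)) refl A B C a b d)
        (trans (cong (λ u → A ℤ.* u ℤ.+ M) cleared) (trans (cong (ℤ._+ M) (ℤ.*-zeroʳ A)) (ℤ.+-identityˡ M)))
        where open ℤSolver.+-*-Solver
      w∣M : ∣ A ℤ.* b ℤ.+ B ℤ.* a ∣ ∣ ∣ M ∣
      w∣M = divides ∣ A ℤ.* d ℤ.+ C ℤ.* a ∣ (trans (cong ∣_∣ (sym factored)) (trans (ℤ.abs-* (A ℤ.* b ℤ.+ B ℤ.* a) (A ℤ.* d ℤ.+ C ℤ.* a)) (*-comm ∣ A ℤ.* b ℤ.+ B ℤ.* a ∣ _)))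

  ThreeTerm : ℕ → ℕ → ℚ × ℚ × ℚ → ℚ × ℚ × ℚ → Set
  ThreeTerm c H (α , β , γ) (x , y , z) =
    (α ≢ 0ℚ × β ≢ 0ℚ × γ ≢ 0ℚ) × (Ht c H α × Ht c H β × Ht c H γ) ×
    (IsEgyptian H x × IsEgyptian H y × IsEgyptian H z) × α * x + β * y + γ * z ≡ 0ℚ

  _≟³_ : DecidableEquality (ℚ × ℚ × ℚ)
  _≟³_ = Product.≡-dec ℚ._≟_ (Product.≡-dec ℚ._≟_ ℚ._≟_)

  num≢0 : ∀ {c H q} (h : Ht c H q) → q ≢ 0ℚ → 1 ≤ ∣ Ht.num h ∣
  num≢0 {q = q} (ht n d _ 1≤d _ e) q≢0 = go n e
    where
    go : ∀ n → q * ι d ≡ ι n → 1 ≤ ∣ n ∣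
    go (+ zero) e = ⊥-elim (*-≢0 q≢0 (ι≢0 {d} 1≤d) e)
    go (+ suc _) _ = s≤s z≤n
    go (-[1+ _ ]) _ = s≤s z≤n

  -- Multiplication by the product of the three denominators makes the coefficients integral. Each
  -- becomes a product of three factors of size at most (2H)^c, whence the exponent 3c.
  bd-ThreeTerm : ∀ c → Bdo (ThreeTerm c) 2
  bd-ThreeTerm c = _ , bd-⊆ clear ≤-refl ≤-refl (proj₂ (bd-IntegerThreeTerm (c ℕ.+ (c ℕ.+ c))))
    where
    clear : ∀ H i t → 1 ≤ H → ThreeTerm c H i t → Σ (ℤ × ℤ × ℤ) λ j → ∀ t → ThreeTerm c H i t → IntegerThreeTerm (c ℕ.+ (c ℕ.+ c)) H j t
    clear H (α , β , γ) _ 1≤H ((α≢0 , β≢0 , γ≢0) , (hα@(ht A D A≤ 1≤D D≤ αD) , hβ@(ht B E B≤ 1≤E E≤ βE) , hγ@(ht C F C≤ 1≤F F≤ γF)) , _) =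
      (A ℤ.* (E ℤ.* F) , B ℤ.* (D ℤ.* F) , C ℤ.* (D ℤ.* E)) , λ { (x , y , z) (_ , _ , eg , eq) →
        (abs-*-≥1 A (E ℤ.* F) (num≢0 hα α≢0) (abs-*-≥1 E F 1≤E 1≤F) ,
         abs-*-≥1 B (D ℤ.* F) (num≢0 hβ β≢0) (abs-*-≥1 D F 1≤D 1≤F) ,
         abs-*-≥1 C (D ℤ.* E) (num≢0 hγ γ≢0) (abs-*-≥1 D E 1≤D 1≤E)) ,
        (abs-*-≤ X {c} {c ℕ.+ c} B (D ℤ.* F) B≤ (abs-*-≤ X {c} {c} D F D≤ F≤) , abs-*-≤ X {c} {c ℕ.+ c} C (D ℤ.* E) C≤ (abs-*-≤ X {c} {c} D E D≤ E≤)) ,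
        eg , cleared x y z eq }
      where
      X = 2 ℕ.* H
      open ≡-Reasoning
      open +-*-Solver
      ι-** : ∀ p q r {u} → u ≡ ι p → u * (ι q * ι r) ≡ ι (p ℤ.* (q ℤ.* r))
      ι-** p q r refl = sym (trans (ι-* p (q ℤ.* r)) (cong (ι p *_) (ι-* q r)))
      cleared : ∀ x y z → α * x + β * y + γ * z ≡ 0ℚ → ι (A ℤ.* (E ℤ.* F)) * x + ι (B ℤ.* (D ℤ.* F)) * y + ι (C ℤ.* (D ℤ.* E)) * z ≡ 0ℚ
      cleared x y z eq = begin
        ι (A ℤ.* (E ℤ.* F)) * x + ι (B ℤ.* (D ℤ.* F)) * y + ι (C ℤ.* (D ℤ.* E)) * z
          ≡⟨ sym (cong₂ _+_ (cong₂ _+_ (cong (_* x) (ι-** A E F αD)) (cong (_* y) (ι-** B D F βE))) (cong (_* z) (ι-** C D E γF))) ⟩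
        α * ι D * (ι E * ι F) * x + β * ι E * (ι D * ι F) * y + γ * ι F * (ι D * ι E) * z
          ≡⟨ solve 9 (λ α β γ x y z D E F → α :* D :* (E :* F) :* x :+ β :* E :* (D :* F) :* y :+ γ :* F :* (D :* E) :* z := (α :* x :+ β :* y :+ γ :* z) :* (D :* E :* F)) refl α β γ x y z (ι D) (ι E) (ι F) ⟩
        (α * x + β * y + γ * z) * (ι D * ι E * ι F)
          ≡⟨ trans (cong (_* (ι D * ι E * ι F)) eq) (ℚ.*-zeroˡ (ι D * ι E * ι F)) ⟩
        0ℚ ∎

  -- The corner a and the diagonal entry w of a 2 × 2 minor satisfy a w = u v, that is a′ w′ = u′ v′ for the inverses.
  CornerPair : ℕ → ℤ → ℚ × ℚ → Set
  CornerPair H a (u , v) = (1 ≤ ∣ a ∣ × ∣ a ∣ ≤ H) × (IsEgyptian H u × IsEgyptian H v) ×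
    Σ ℤ λ w → (1 ≤ ∣ w ∣ × ∣ w ∣ ≤ H) × u * v * ι (a ℤ.* w) ≡ 1ℚ

  -- The diagonal entry w costs H. After that the denominators of u and v have the known product a *
  -- w, so that of u is one of H^o(1) divisors, and v follows.
  bd-CornerPair : Bdo CornerPair 2
  bd-CornerPair = _ , bd-fibration {T = λ H a w → 1 ≤ ∣ w ∣ × ∣ w ∣ ≤ H} {R = R₁} {p = 2} {e = 0} {q = 0} ℤ._≟_ (λ a w → a ℤ.* w)
    (λ { H a (u , v) 1≤H ((1≤a , a≤H) , eg , w , (1≤w , w≤H) , e) → w , (1≤w , w≤H) ,
         (abs-*-≥1 a w 1≤a 1≤w , abs-*-≤ (2 ℕ.* H) {1} {1} a w (≤-trans a≤H (H≤2H 1≤H)) (≤-trans w≤H (H≤2H 1≤H))) , eg , e })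
    (bd-sign bd-interval)
    (bd-fibration {R = λ { H (M , b) (u , v) → Inverse b u × u * v * ι M ≡ 1ℚ }} {p = 0} {q = 0} {f = 0} ℤ._≟_ _,_
      (λ { H M (u , v) 1≤H (M-bounds , ((b , _ , _ , ub) , (d , _ , _ , vd)) , e) → b ,
           (M-bounds , divides ∣ d ∣ (trans (cong ∣_∣ (product M b d u v ub vd e)) (ℤ.abs-* d b))) , ub , e })
      (bd-divisor 2)
      (bd-subsingleton λ { H (M , b) (u , v) (u′ , v′) _ (ub , e) (ub′ , e′) → let u≡u′ = inverse-unique {b} ub ub′ in
        cong₂ _,_ u≡u′ (*-cancelˡ {u * ι M} (nonzero M u v e) (trans (swap u v (ι M)) (trans (trans e (sym e′)) (trans (sym (swap u′ v′ (ι M))) (cong (λ u → u * ι M * v′) (sym u≡u′)))))) }))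
    where
    open +-*-Solver
    R₁ : ℕ → ℤ → ℚ × ℚ → Set
    R₁ H M (u , v) = (1 ≤ ∣ M ∣ × ∣ M ∣ ≤ (2 ℕ.* H) ^ 2) × (IsEgyptian H u × IsEgyptian H v) × u * v * ι M ≡ 1ℚ
    swap : ∀ u v m → u * m * v ≡ u * v * m
    swap = solve 3 (λ u v m → u :* m :* v := u :* v :* m) refl
    nonzero : ∀ M u v → u * v * ι M ≡ 1ℚ → u * ι M ≢ 0ℚ
    nonzero M u v e = *-unit-≢0 {u * ι M} {v} (trans (swap u v (ι M)) e)
    product : ∀ M b d u v → Inverse b u → Inverse d v → u * v * ι M ≡ 1ℚ → M ≡ d ℤ.* b
    product M b d u v ub vd e = ι-injective (begin
      ι M ≡⟨ solve 1 (λ M → M := M :* con 1ℚ :* con 1ℚ) refl (ι M) ⟩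
      ι M * 1ℚ * 1ℚ ≡⟨ sym (cong₂ (λ s t → ι M * s * t) ub vd) ⟩
      ι M * (u * ι b) * (v * ι d) ≡⟨ solve 5 (λ M u v b d → M :* (u :* b) :* (v :* d) := u :* v :* M :* (d :* b)) refl (ι M) u v (ι b) (ι d) ⟩
      u * v * ι M * (ι d * ι b) ≡⟨ cong (_* (ι d * ι b)) e ⟩
      1ℚ * (ι d * ι b) ≡⟨ ℚ.*-identityˡ _ ⟩
      ι d * ι b ≡⟨ sym (ι-* d b) ⟩
      ι (d ℤ.* b) ∎)
      where open ≡-Reasoning

  -- Products of denominators and integrality at a prime

  Πℕ : ∀ m → (Fin m → ℕ) → ℕ
  Πℕ zero f = 1
  Πℕ (suc m) f = f zero ℕ.* Πℕ m (f ∘ suc)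

  ∣Πℕ : ∀ m f (i : Fin m) → f i ∣ Πℕ m f
  ∣Πℕ (suc m) f zero = m∣m*n _
  ∣Πℕ (suc m) f (suc i) = ∣n⇒∣m*n (f zero) (∣Πℕ m (f ∘ suc) i)

  p²∣Πℕ : ∀ m f {i j : Fin m} {p} → i ≢ j → p ∣ f i → p ∣ f j → p ℕ.* p ∣ Πℕ m f
  p²∣Πℕ (suc m) f {zero} {zero} ne _ _ = ⊥-elim (ne refl)
  p²∣Πℕ (suc m) f {zero} {suc j} _ h k = *-pres-∣ h (∣-trans k (∣Πℕ m (f ∘ suc) j))
  p²∣Πℕ (suc m) f {suc i} {zero} _ h k = *-pres-∣ k (∣-trans h (∣Πℕ m (f ∘ suc) i))
  p²∣Πℕ (suc m) f {suc i} {suc j} ne h k = ∣n⇒∣m*n (f zero) (p²∣Πℕ m (f ∘ suc) (ne ∘ cong suc) h k)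

  Πℕ≥1 : ∀ m f → (∀ i → 1 ≤ f i) → 1 ≤ Πℕ m f
  Πℕ≥1 zero f h = ≤-refl
  Πℕ≥1 (suc m) f h = *-mono-≤ (h zero) (Πℕ≥1 m (f ∘ suc) (h ∘ suc))

  Πℕ≤^ : ∀ m f B → (∀ i → f i ≤ B) → Πℕ m f ≤ B ^ m
  Πℕ≤^ zero f B h = ≤-refl
  Πℕ≤^ (suc m) f B h = *-mono-≤ (h zero) (Πℕ≤^ m (f ∘ suc) B (h ∘ suc))

  Πℕ≤^countT : ∀ {m} f B (T : Vec Bool m) → (∀ i → lookup T i ≡ true → f i ≤ B) → (∀ i → lookup T i ≡ false → f i ≤ 1) → Πℕ m f ≤ B ^ countT T
  Πℕ≤^countT f B [] h k = ≤-refl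
  Πℕ≤^countT f B (true ∷ T) h k = *-mono-≤ (h zero refl) (Πℕ≤^countT (f ∘ suc) B T (h ∘ suc) (k ∘ suc))
  Πℕ≤^countT f B (false ∷ T) h k = ≤-trans (*-mono-≤ (k zero refl) (Πℕ≤^countT (f ∘ suc) B T (h ∘ suc) (k ∘ suc))) (≤-reflexive (*-identityˡ _))

  prime∣abs-* : ∀ {p} → Prime p → ∀ a b → p ∣ ∣ a ℤ.* b ∣ → (p ∣ ∣ a ∣) ⊎ (p ∣ ∣ b ∣)
  prime∣abs-* {p} pr a b h = euclidsLemma ∣ a ∣ ∣ b ∣ pr (subst (p ∣_) (ℤ.abs-* a b) h)

  prime∤1 : ∀ {p} → Prime p → ¬ p ∣ 1
  prime∤1 {p} pr h = ¬prime[1] (subst Prime (∣1⇒≡1 h) pr)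

  -- Membership in the localisation of the integers at p, witnessed by any fraction whose
  -- denominator p does not divide.
  record Integral (p : ℕ) (y : ℚ) : Set where
    constructor integral
    field
      den num : ℤ
      p∤den : ¬ (p ∣ ∣ den ∣)
      fraction : y * ι den ≡ ι num

  module _ {p} (pr : Prime p) where

    open +-*-Solver
    open ≡-Reasoning

    integral-0 : Integral p 0ℚ
    integral-0 = integral (+ 1) (+ 0) (prime∤1 pr) refl

    integral-− : ∀ {x y} → Integral p x → Integral p y → Integral p (x - y)
    integral-− {x} {y} (integral d a p∤d h) (integral e b p∤e k) = integral (d ℤ.* e) (a ℤ.* e ℤ.- b ℤ.* d)
      (λ p∣de → case prime∣abs-* pr d e p∣de of λ { (inj₁ p∣d) → p∤d p∣d ; (inj₂ p∣e) → p∤e p∣e }) (begin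
        (x - y) * ι (d ℤ.* e) ≡⟨ cong ((x - y) *_) (ι-* d e) ⟩
        (x - y) * (ι d * ι e) ≡⟨ solve 4 (λ x y d e → (x :- y) :* (d :* e) := x :* d :* e :- y :* e :* d) refl x y (ι d) (ι e) ⟩
        x * ι d * ι e - y * ι e * ι d ≡⟨ cong₂ (λ u v → u * ι e - v * ι d) h k ⟩
        ι a * ι e - ι b * ι d ≡⟨ sym (cong₂ _-_ (ι-* a e) (ι-* b d)) ⟩
        ι (a ℤ.* e) - ι (b ℤ.* d) ≡⟨ cong (λ u → ι (a ℤ.* e) + u) (sym (ι-neg (b ℤ.* d))) ⟩
        ι (a ℤ.* e) + ι (ℤ.- (b ℤ.* d)) ≡⟨ sym (ι-+ (a ℤ.* e) (ℤ.- (b ℤ.* d))) ⟩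
        ι (a ℤ.* e ℤ.- b ℤ.* d) ∎)

    integral-+ : ∀ {x y} → Integral p x → Integral p y → Integral p (x + y)
    integral-+ {x} {y} h k = subst (Integral p) (solve 2 (λ x y → x :- (con 0ℚ :- y) := x :+ y) refl x y) (integral-− h (integral-− integral-0 k))

    integral-Σ : ∀ m {f : Fin m → ℚ} → (∀ i → Integral p (f i)) → Integral p (Σℚ m f)
    integral-Σ zero h = integral-0
    integral-Σ (suc m) h = integral-+ (h zero) (integral-Σ m (h ∘ suc))

    -- The localisation is a subgroup of the rationals: when the total is integral at p, one term
    -- alone cannot have p in its denominator.
    integral-summand : ∀ m {f : Fin m → ℚ} → Integral p (Σℚ m f) → ∀ i → (∀ j → j ≢ i → Integral p (f j)) → Integral p (f i)
    integral-summand (suc m) {f} hΣ zero h = subst (Integral p) (solve 2 (λ a s → (a :+ s) :- s := a) refl (f zero) (Σℚ m (f ∘ suc)))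
      (integral-− hΣ (integral-Σ m (λ j → h (suc j) λ ())))
    integral-summand (suc m) {f} hΣ (suc i) h = integral-summand m
      (subst (Integral p) (solve 2 (λ a s → (a :+ s) :- a := s) refl (f zero) (Σℚ m (f ∘ suc))) (integral-− hΣ (h zero λ ())))
      i (λ j j≢i → h (suc j) (λ e → j≢i (Fin.suc-injective e)))

  -- The unknowns are the entries on `T`. All others are set to zero, so that vectors keep the
  -- length m, and `s` records the number of unknowns, from which the exponent is read.
  LinearEquation : ∀ {m} → ℕ → ℕ → ℕ → Vec Bool m × (Fin m → ℚ) → Vec ℚ m → Set
  LinearEquation {m} h s H (T , c) x =
    countT T ≡ s × (∀ k → Ht h H (c k)) × (∀ k → lookup T k ≡ true → c k ≢ 0ℚ) ×
    (∀ k → lookup T k ≡ true → IsEgyptian H (lookup x k)) × (∀ k → lookup T k ≡ false → lookup x k ≡ 0ℚ) ×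
    Σℚ m (λ k → c k * lookup x k) ≡ 0ℚ

  -- Let x_k = 1/a_k and let Q be the product of the numerators and denominators of the coefficients on T.
  -- A prime dividing a_k but not Q divides another a_j, so its square divides ∏ a_k. Hence, if M² is the
  -- largest square dividing ∏ a_k, every a_k is QM-smooth, and M ≤ H^(s/2).
  module _ {m : ℕ} (h s : ℕ) where

    private
      Coefficients = Vec Bool m × (Fin m → ℚ) × (Fin m → ℤ) × (Fin m → ℤ)

      -- The factor 1 off `T`, where coefficients may vanish, keeps the product Q positive.
      size : Vec Bool m → (Fin m → ℤ) → (Fin m → ℤ) → Fin m → ℕ
      size T C D k = if lookup T k then ∣ C k ∣ ℕ.* ∣ D k ∣ else 1

      Q : Coefficients → ℕ
      Q (T , _ , C , D) = Πℕ m (size T C D)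

      Cleared : ℕ → Coefficients → Vec ℚ m → Set
      Cleared H (T , c , C , D) x = countT T ≡ s ×
        (∀ k → 1 ≤ ∣ D k ∣ × ∣ C k ∣ ≤ (2 ℕ.* H) ^ h × ∣ D k ∣ ≤ (2 ℕ.* H) ^ h × c k * ι (D k) ≡ ι (C k)) ×
        (∀ k → lookup T k ≡ true → 1 ≤ ∣ C k ∣) ×
        (∀ k → lookup T k ≡ true → IsEgyptian H (lookup x k)) × (∀ k → lookup T k ≡ false → lookup x k ≡ 0ℚ) ×
        Σℚ m (λ k → c k * lookup x k) ≡ 0ℚ

      SmoothInverse : ℕ → ℕ → ℚ → Set
      SmoothInverse H N x = Σ ℤ λ a → Inverse a x × (1 ≤ N × N ≤ (2 ℕ.* H) ^ (m ℕ.* (h ℕ.+ h) ℕ.+ s)) × (1 ≤ ∣ a ∣ × ∣ a ∣ ≤ (2 ℕ.* H) ^ 1) × Smooth N ∣ a ∣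

      Factored : ℕ → Vec Bool m × (Fin m → ℕ) → Vec ℚ m → Set
      Factored H (T , N) x = countT T ≡ s × (∀ k → (if lookup T k then SmoothInverse H (N k) else (_≡ 0ℚ)) (lookup x k))

    private
      bd-SmoothInverse : Bd SmoothInverse 0 (m ℕ.* (h ℕ.+ h) ℕ.+ s ℕ.+ 1 ℕ.+ 0)
      bd-SmoothInverse = bd-fibration {R = λ H a x → Inverse a x} {p = 0} {q = 0} ℤ._≟_ (λ _ a → a) (λ { H N x _ (a , xa , r) → a , r , xa })
        (bd-sign (bd-smooth (m ℕ.* (h ℕ.+ h) ℕ.+ s) 1)) (bd-subsingleton λ H a x y _ → inverse-unique {a})

      bd-Factored : Bdo Factored 0
      bd-Factored = _ , bd-⊆ {Q = λ H i x → _} (λ H i x _ _ → i , λ _ q → q) (≤-reflexive (cong₂ ℕ._+_ (*-zeroʳ s) (*-zeroʳ (m ∸ s)))) ≤-refl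
        (bd-Vec {Q₀ = λ _ _ x → x ≡ 0ℚ} s ℚ._≟_ (bd-subsingleton λ { _ _ _ _ _ refl refl → refl }) bd-SmoothInverse)

      SquareRoot : ℕ → Coefficients → ℕ → Set
      SquareRoot H _ M = 1 ≤ M × M ℕ.* M ≤ H ^ s

      -- M * M ≤ H^s leaves H^(s/2) values of M, that is the exponent s in halves, and nothing is
      -- lost here.
      bd-SquareRoot : Bd SquareRoot s 0
      bd-SquareRoot = bd λ k → 1 , ≤-refl , λ H 1≤H _ → card-⊆ (λ M (1≤M , M²≤) → 1≤M , (begin
        M ^ (2 ℕ.* suc k) ≡⟨ sym (^-*-assoc M 2 (suc k)) ⟩
        (M ^ 2) ^ suc k ≡⟨ cong (λ z → (M ℕ.* z) ^ suc k) (*-identityʳ M) ⟩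
        (M ℕ.* M) ^ suc k ≤⟨ ^-monoˡ-≤ (suc k) M²≤ ⟩
        (H ^ s) ^ suc k ≡⟨ ^-*-assoc H s (suc k) ⟩
        H ^ (s ℕ.* suc k) ≡⟨ cong (H ^_) (sym (+-identityʳ (s ℕ.* suc k))) ⟩
        H ^ (s ℕ.* suc k ℕ.+ 0) ≡⟨ sym (*-identityˡ _) ⟩
        1 ℕ.* H ^ (s ℕ.* suc k ℕ.+ 0) ∎)) (card-bounded-power _ _)
        where open ≤-Reasoning

      factor : ∀ H i x → 1 ≤ H → Cleared H i x → Σ ℕ λ M → SquareRoot H i M × Factored H (proj₁ i , λ _ → Q i ℕ.* M) x
      factor H i@(T , c , C , D) x 1≤H (count , frac , C≥1 , eg , off , eq) = M , (1≤M , M²≤) , count , λ k → entries k (lookup T k) refl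
        where
        inverse : ∀ k b → lookup T k ≡ b → Σ ℤ λ a → 1 ≤ ∣ a ∣ × (b ≡ true → ∣ a ∣ ≤ H × Inverse a (lookup x k)) × (b ≡ false → ∣ a ∣ ≤ 1)
        inverse k true e = let (a , 1≤a , a≤H , xa) = eg k e in a , 1≤a , (λ _ → a≤H , xa) , λ ()
        -- Off `T` the default denominator 1 brings neither size nor primes into the product.
        inverse k false e = + 1 , ≤-refl , (λ ()) , λ _ → ≤-refl
        a : Fin m → ℤ
        a k = proj₁ (inverse k (lookup T k) refl)
        a≥1 : ∀ k → 1 ≤ ∣ a k ∣
        a≥1 k = proj₁ (proj₂ (inverse k (lookup T k) refl))
        on : ∀ k → lookup T k ≡ true → ∣ a k ∣ ≤ H × Inverse (a k) (lookup x k)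
        on k = proj₁ (proj₂ (proj₂ (inverse k (lookup T k) refl)))
        P = Πℕ m (λ k → ∣ a k ∣)
        P≥1 = Πℕ≥1 m (λ k → ∣ a k ∣) a≥1
        root = square-part P P≥1
        M = proj₁ root
        M²≤P : M ℕ.* M ≤ P
        M²≤P = ∣⇒≤ {{>-nonZero P≥1}} (proj₁ (proj₂ root))
        1≤M : 1 ≤ M
        1≤M = positive M (proj₁ (proj₂ root))
          where
          positive : ∀ M → M ℕ.* M ∣ P → 1 ≤ M
          positive zero (divides q e) = ⊥-elim (<⇒≱ P≥1 (≤-reflexive (trans e (*-zeroʳ q))))
          positive (suc _) _ = s≤s z≤n
        M²≤ : M ℕ.* M ≤ H ^ s
        M²≤ = ≤-trans M²≤P (subst (λ s → P ≤ H ^ s) count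
          (Πℕ≤^countT (λ k → ∣ a k ∣) H T (λ k e → proj₁ (on k e)) (λ k → proj₂ (proj₂ (proj₂ (inverse k (lookup T k) refl))))))
        X = 2 ℕ.* H
        size≥1 : ∀ k → 1 ≤ size T C D k
        size≥1 k = go (lookup T k) (λ e → C≥1 k e)
          where
          go : ∀ b → (b ≡ true → 1 ≤ ∣ C k ∣) → 1 ≤ (if b then ∣ C k ∣ ℕ.* ∣ D k ∣ else 1)
          go true e = *-mono-≤ (e refl) (proj₁ (frac k))
          go false _ = ≤-refl
        size≤ : ∀ k → size T C D k ≤ X ^ (h ℕ.+ h)
        size≤ k = go (lookup T k)
          where
          go : ∀ b → (if b then ∣ C k ∣ ℕ.* ∣ D k ∣ else 1) ≤ X ^ (h ℕ.+ h)
          go true = ≤-trans (*-mono-≤ (proj₁ (proj₂ (frac k))) (proj₁ (proj₂ (proj₂ (frac k))))) (≤-reflexive (sym (^-distribˡ-+-* X h h)))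
          go false = 2H^-mono 1≤H {0} {h ℕ.+ h} z≤n
        Q≥1 = Πℕ≥1 m (size T C D) size≥1
        QM≤ : Q i ℕ.* M ≤ X ^ (m ℕ.* (h ℕ.+ h) ℕ.+ s)
        QM≤ = ≤-trans (*-mono-≤ (≤-trans (Πℕ≤^ m (size T C D) (X ^ (h ℕ.+ h)) size≤) (≤-reflexive (trans (^-*-assoc X (h ℕ.+ h) m) (cong (X ^_) (*-comm (h ℕ.+ h) m)))))
            (≤-trans (m≤m*n M M {{>-nonZero 1≤M}}) (≤-trans M²≤ (^-monoˡ-≤ s (m≤m+n H _)))))
          (≤-reflexive (sym (^-distribˡ-+-* X (m ℕ.* (h ℕ.+ h)) s)))
        ∣Q : ∀ k {p} → lookup T k ≡ true → p ∣ ∣ C k ∣ ℕ.* ∣ D k ∣ → p ∣ Q i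
        ∣Q k {p} e d = ∣-trans (subst (λ b → p ∣ (if b then ∣ C k ∣ ℕ.* ∣ D k ∣ else 1)) (sym e) d) (∣Πℕ m (size T C D) k)
        summand : ∀ k → lookup T k ≡ true → c k * lookup x k * ι (D k ℤ.* a k) ≡ ι (C k)
        summand k e = begin
          c k * lookup x k * ι (D k ℤ.* a k) ≡⟨ cong (c k * lookup x k *_) (ι-* (D k) (a k)) ⟩
          c k * lookup x k * (ι (D k) * ι (a k)) ≡⟨ solve 4 (λ c x d a → c :* x :* (d :* a) := c :* d :* (x :* a)) refl (c k) (lookup x k) (ι (D k)) (ι (a k)) ⟩
          c k * ι (D k) * (lookup x k * ι (a k)) ≡⟨ cong₂ _*_ (proj₂ (proj₂ (proj₂ (frac k)))) (proj₂ (on k e)) ⟩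
          ι (C k) * 1ℚ ≡⟨ ℚ.*-identityʳ (ι (C k)) ⟩
          ι (C k) ∎
          where
          open ≡-Reasoning
          open +-*-Solver
        smooth : ∀ k → lookup T k ≡ true → Smooth (Q i ℕ.* M) ∣ a k ∣
        smooth k e p pr p∣a with p ∣? Q i ℕ.* M
        ... | yes d = d
        ... | no p∤QM with Fin.any? (λ j → ¬? (j Fin.≟ k) ×-dec (p ∣? ∣ a j ∣))
        ... | yes (j , j≢k , p∣aj) = ∣-trans (proj₂ (proj₂ root) p pr (p²∣Πℕ m (λ k → ∣ a k ∣) j≢k p∣aj p∣a)) (n∣m*n (Q i))
        -- All the other summands are integral at p, hence so is the k-th, which equals C k / (D k *
        -- a k). Since p divides a k, it must divide C k, a factor of Q, against the assumption on
        -- p.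
        ... | no none = ⊥-elim (p∤QM (∣m⇒∣m*n M (∣Q k e p∣CD)))
          where
          integral′ : ∀ j → j ≢ k → Integral p (c j * lookup x j)
          integral′ j j≢k = go (lookup T j) refl
            where
            go : ∀ b → lookup T j ≡ b → Integral p (c j * lookup x j)
            go true t = integral (D j ℤ.* a j) (C j) (λ d → case prime∣abs-* pr (D j) (a j) d of λ
              { (inj₁ p∣D) → p∤QM (∣m⇒∣m*n M (∣Q j t (∣n⇒∣m*n ∣ C j ∣ p∣D))) ; (inj₂ p∣aj) → none (j , j≢k , p∣aj) }) (summand j t)
            go false t = subst (Integral p) (sym (trans (cong (c j *_) (off j t)) (ℚ.*-zeroʳ (c j)))) (integral-0 pr)
          p∣C : Integral p (c k * lookup x k) → p ∣ ∣ C k ∣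
          p∣C (integral d n p∤d y) = case prime∣abs-* pr (C k) d (subst (λ z → p ∣ ∣ z ∣) cross
              (subst (p ∣_) (sym (ℤ.abs-* n (D k ℤ.* a k))) (∣n⇒∣m*n ∣ n ∣ (subst (p ∣_) (sym (ℤ.abs-* (D k) (a k))) (∣n⇒∣m*n ∣ D k ∣ p∣a))))) of λ
              { (inj₁ r) → r ; (inj₂ r) → ⊥-elim (p∤d r) }
            where
            open ≡-Reasoning
            open +-*-Solver
            cross : n ℤ.* (D k ℤ.* a k) ≡ C k ℤ.* d
            cross = ι-injective (begin
              ι (n ℤ.* (D k ℤ.* a k)) ≡⟨ ι-* n (D k ℤ.* a k) ⟩
              ι n * ι (D k ℤ.* a k) ≡⟨ cong (_* ι (D k ℤ.* a k)) (sym y) ⟩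
              c k * lookup x k * ι d * ι (D k ℤ.* a k) ≡⟨ solve 3 (λ u d w → u :* d :* w := u :* w :* d) refl (c k * lookup x k) (ι d) (ι (D k ℤ.* a k)) ⟩
              c k * lookup x k * ι (D k ℤ.* a k) * ι d ≡⟨ cong (_* ι d) (summand k e) ⟩
              ι (C k) * ι d ≡⟨ sym (ι-* (C k) d) ⟩
              ι (C k ℤ.* d) ∎)
          p∣CD : p ∣ ∣ C k ∣ ℕ.* ∣ D k ∣
          p∣CD = ∣m⇒∣m*n ∣ D k ∣ (p∣C (integral-summand pr m (subst (Integral p) (sym eq) (integral-0 pr)) k integral′))
        entries : ∀ k b → lookup T k ≡ b → (if b then SmoothInverse H (Q i ℕ.* M) else (_≡ 0ℚ)) (lookup x k)
        entries k true e = a k , proj₂ (on k e) , (*-mono-≤ Q≥1 1≤M , QM≤) , (a≥1 k , ≤-trans (proj₁ (on k e)) (H≤2H 1≤H)) , smooth k e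
        entries k false e = off k e

    bd-LinearEquation : Bdo (LinearEquation {m} h s) s
    bd-LinearEquation = _ , bd-⊆ clear (≤-reflexive (+-identityʳ s)) ≤-refl
      (bd-fibration {P = Cleared} {R = Factored} ℕ._≟_ (λ i M → proj₁ i , λ _ → Q i ℕ.* M) factor bd-SquareRoot (proj₂ bd-Factored))
      where
      clear : ∀ H i x → 1 ≤ H → LinearEquation h s H i x → Σ Coefficients λ j → ∀ y → LinearEquation h s H i y → Cleared H j y
      clear H (T , c) _ 1≤H (_ , hts , c≢0 , _) = (T , c , (λ k → Ht.num (hts k)) , (λ k → Ht.den (hts k))) ,
        λ { y (count , _ , _ , eg , off , eq) → count , (λ k → Ht.den≥1 (hts k) , Ht.num≤ (hts k) , Ht.den≤ (hts k) , Ht.fraction (hts k)) ,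
            (λ k e → num≢0 (hts k) (c≢0 k e)) , eg , off , eq }

  -- Rank one and rank two

  vec-ext : ∀ {X : Set} {n} (v w : Vec X n) → (∀ i → lookup v i ≡ lookup w i) → v ≡ w
  vec-ext [] [] h = refl
  vec-ext (x ∷ v) (y ∷ w) h = cong₂ _∷_ (h zero) (vec-ext v w (h ∘ suc))

  matrix-ext : ∀ {m n} (A B : Matrix m n) → (∀ i j → entry A i j ≡ entry B i j) → A ≡ B
  matrix-ext A B h = vec-ext A B λ i → vec-ext (lookup A i) (lookup B i) (h i)

  transposed : ∀ {m n} → Matrix m n → Matrix n m
  transposed A = Vec.tabulate λ j → Vec.tabulate λ i → entry A i j

  entry-transposed : ∀ {m n} (A : Matrix m n) i j → entry (transposed A) j i ≡ entry A i j
  entry-transposed A i j = trans (cong (λ v → lookup v i) (Vec.lookup∘tabulate (λ j → Vec.tabulate λ i → entry A i j) j)) (Vec.lookup∘tabulate (λ i → entry A i j) i)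

  transposed-injective : ∀ {m n} (A B : Matrix m n) → transposed A ≡ transposed B → A ≡ B
  transposed-injective A B e = matrix-ext A B λ i j →
    trans (sym (entry-transposed A i j)) (trans (cong (λ M → entry M j i) e) (entry-transposed B i j))

  _≟ᵛ_ : ∀ {n} → DecidableEquality (Vec ℚ n)
  _≟ᵛ_ = Vec.≡-dec ℚ._≟_

  _≟ᵐ_ : ∀ {m n} → DecidableEquality (Matrix m n)
  _≟ᵐ_ = Vec.≡-dec _≟ᵛ_

  bd-× : ∀ {I X Y : Set} {P : ℕ → I → X → Set} {Q : ℕ → I → Y → Set} {p e q f} → DecidableEquality X → DecidableEquality Y →
    Bd P p e → Bd Q q f → Bd (λ H i (z : X × Y) → P H i (proj₁ z) × Q H i (proj₂ z)) (p ℕ.+ q) (e ℕ.+ f)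
  bd-× {I} {X} {P = P} {Q} _≟₁_ _≟₂_ bP bQ = bd-fibration {R = λ H (i , x) z → Q H i (proj₂ z) × proj₁ z ≡ x} _≟₁_ _,_
    (λ { H i (x , y) _ (p , q) → x , p , q , refl }) bP
    (bd-inj _≟₂_ (λ _ → proj₂) proj₁ (λ _ _ _ _ → proj₁) (λ { H i (x , y) (x′ , y′) _ (_ , refl) (_ , refl) refl → refl }) bQ)

  -- A Boolean label tells which alternative holds; the product of the constants and the maximum of
  -- the losses serve both.
  bdo-⊎ : ∀ {I X : Set} {P Q R : ℕ → I → X → Set} {p} → (∀ H i x → 1 ≤ H → R H i x → P H i x ⊎ Q H i x) →
    Bdo P p → Bdo Q p → Bdo R p
  bdo-⊎ {I} {X} {P} {Q} {R} {p} split (e , bP) (f , bQ) = e ℕ.⊔ f ,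
    bd-fibration {R = either} {p = 0} {e = 0} Bool._≟_ _,_ label bd-Bool (bd λ k →
      let (C , 1≤C , c) = at bP k ; (D , 1≤D , d) = at bQ k in C ℕ.* D , *-mono-≤ 1≤C 1≤D , λ
        { H 1≤H (i , true) → card-mono (*-mono-≤ (m≤m*n C D {{>-nonZero 1≤D}}) (^-monoʳ-≤ H {{>-nonZero 1≤H}} (+-monoʳ-≤ (p ℕ.* suc k) (m≤m⊔n e f)))) (c H 1≤H i)
        ; H 1≤H (i , false) → card-mono (*-mono-≤ (m≤n*m D C {{>-nonZero 1≤C}}) (^-monoʳ-≤ H {{>-nonZero 1≤H}} (+-monoʳ-≤ (p ℕ.* suc k) (m≤n⊔m e f)))) (d H 1≤H i) })
    where
    either : ℕ → I × Bool → X → Set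
    either H (i , b) x = if b then P H i x else Q H i x
    label : ∀ H i x → 1 ≤ H → R H i x → Σ Bool λ b → ⊤ × either H (i , b) x
    label H i x 1≤H r with split H i x 1≤H r
    ... | inj₁ p = true , tt , p
    ... | inj₂ q = false , tt , q

  bdo-⋃Bool : ∀ {I X : Set} m {P : Vec Bool m → ℕ → I → X → Set} {p} → (∀ b → Bdo (P b) p) → Bdo (λ H i x → Σ (Vec Bool m) λ b → P b H i x) p
  bdo-⋃Bool zero {P} h = _ , bd-⊆ {Q = P []} (λ { H i x _ ([] , _) → i , λ { _ ([] , q) → q } }) ≤-refl ≤-refl (proj₂ (h []))
  bdo-⋃Bool (suc m) {P} h = bdo-⊎ (λ { H i x _ (true ∷ b , q) → inj₁ (b , q) ; H i x _ (false ∷ b , q) → inj₂ (b , q) })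
    (bdo-⋃Bool m (λ b → h (true ∷ b))) (bdo-⋃Bool m (λ b → h (false ∷ b)))

  bdo-⋃< : ∀ {I X : Set} n {P : ℕ → ℕ → I → X → Set} {p} → (∀ t → t < n → Bdo (P t) p) → Bdo (λ H i x → Σ ℕ λ t → t < n × P t H i x) p
  bdo-⋃< zero h = 0 , bd λ k → 1 , ≤-refl , λ H _ i → card-witness λ { x (t , () , _) }
  bdo-⋃< (suc n) {P} h = bdo-⊎ {P = λ H i x → Σ ℕ λ t → t < n × P t H i x} {Q = P n} split (bdo-⋃< n (λ t t<n → h t (m<n⇒m<1+n t<n))) (h n ≤-refl)
    where
    split : ∀ H i x → 1 ≤ H → (Σ ℕ λ t → t < suc n × P t H i x) → (Σ ℕ λ t → t < n × P t H i x) ⊎ P n H i x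
    split H i x _ (t , s≤s t≤n , q) with m≤n⇒m<n∨m≡n t≤n
    ... | inj₁ t<n = inj₁ (t , t<n , q)
    ... | inj₂ refl = inj₂ q

  countT-replicate : ∀ n → countT (Vec.replicate n true) ≡ n
  countT-replicate zero = refl
  countT-replicate (suc n) = cong suc (countT-replicate n)

  bd-Vec-all : ∀ {J X : Set} {Q : ℕ → J → X → Set} {p e} n → DecidableEquality X → Bd Q p e →
    Bd (λ H i (v : Vec X n) → ∀ j → Q H i (lookup v j)) (n ℕ.* p) (n ℕ.* e)
  bd-Vec-all {J} {X} {Q} {p} {e} n _≟_ q = bd-⊆
    (λ H i _ _ _ → (Vec.replicate n true , λ _ → i) , λ v h → countT-replicate n ,
      λ j → subst (λ b → (if b then Q H i else Q H i) (lookup v j)) (sym (Vec.lookup-replicate j true)) (h j))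
    (exponent p) (exponent e) (bd-Vec n _≟_ q q)
    where
    exponent : ∀ p → n ℕ.* p ℕ.+ (n ∸ n) ℕ.* p ≤ n ℕ.* p
    exponent p = ≤-reflexive (trans (cong (λ z → n ℕ.* p ℕ.+ z ℕ.* p) (n∸n≡0 n)) (+-identityʳ _))

  -- For rows without zero entries this is proportionality, expressed without naming the ratio.
  Minors : ∀ {m n} → (Fin m → Fin n → ℚ) → Fin m → Fin m → Set
  Minors F i k = ∀ j l → F i j * F k l ≡ F i l * F k j

  RankOne : ∀ {I : Set} {k l} → ℕ → I → Matrix k l → Set
  RankOne H _ A = AllEgyptian H A × (∀ i k → Minors (entry A) i k)

  private
    -- `u` and `v` stand for the first column and the first row without their common corner 1/a. The
    -- entry of the matrix in position (i, j) is then u_i v_j a, and the last clause says that it is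
    -- a unit fraction 1/w.
    Corner : ∀ {k l} → ℕ → ℤ → Vec ℚ k × Vec ℚ l → Set
    Corner H a (u , v) = (1 ≤ ∣ a ∣ × ∣ a ∣ ≤ H) × (∀ i → IsEgyptian H (lookup u i)) × (∀ j → IsEgyptian H (lookup v j)) ×
      (∀ i j → Σ ℤ λ w → (1 ≤ ∣ w ∣ × ∣ w ∣ ≤ H) × lookup u i * lookup v j * ι (a ℤ.* w) ≡ 1ℚ)

    bd-Egyptian-Vec : ∀ {I : Set} n → Bd {I} (λ H _ (v : Vec ℚ n) → ∀ j → IsEgyptian H (lookup v j)) (2 ℕ.* n) 0
    bd-Egyptian-Vec n = bd-weaken
      (≤-reflexive (*-comm n 2)) (≤-reflexive (*-zeroʳ n)) (bd-Vec-all n ℚ._≟_ bd-Egyptian)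

    -- Each pair (u_i, v_i) costs one factor H thanks to its diagonal entry. When the shorter vector
    -- is exhausted, each remaining entry of the longer one costs H as well, so the total is the
    -- larger length.
    bd-Corner : ∀ k l → Bdo (Corner {k} {l}) (2 ℕ.* (k ℕ.⊔ l))
    bd-Corner zero l = _ , bd-inj {Q = λ H (_ : ℤ) v → ∀ j → IsEgyptian H (lookup v j)} _≟ᵛ_ (λ _ → proj₂) id
      (λ _ _ _ _ (_ , _ , q , _) → q) (λ { _ _ ([] , _) ([] , _) _ _ _ refl → refl }) (bd-Egyptian-Vec l)
    bd-Corner k@(suc _) zero = _ , bd-inj {Q = λ H (_ : ℤ) v → ∀ j → IsEgyptian H (lookup v j)} _≟ᵛ_ (λ _ → proj₁) id
      (λ _ _ _ _ (_ , q , _) → q) (λ { _ _ (_ , []) (_ , []) _ _ _ refl → refl }) (bd-Egyptian-Vec k)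
    bd-Corner (suc k) (suc l) = _ , bd-weaken (≤-reflexive (sym (*-suc 2 (k ℕ.⊔ l)))) ≤-refl
      (bd-fibration {R = Rest} (Product.≡-dec ℚ._≟_ ℚ._≟_) _,_
        (λ { H a (u ∷ us , v ∷ vs) _ (a-bounds , us-eg , vs-eg , diag) → (u , v) , (a-bounds , (us-eg zero , vs-eg zero) , diag zero zero) ,
             refl , a-bounds , us-eg ∘ suc , vs-eg ∘ suc , λ i j → diag (suc i) (suc j) })
        (proj₂ bd-CornerPair)
        (bd-inj (Product.≡-dec _≟ᵛ_ _≟ᵛ_) (λ _ → tails) proj₁ (λ _ _ _ _ → proj₂)
          (λ { H (a , _) (u ∷ us , v ∷ vs) (u′ ∷ us′ , v′ ∷ vs′) _ (refl , _) (refl , _) refl → refl }) (proj₂ (bd-Corner k l))))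
      where
      tails : Vec ℚ (suc k) × Vec ℚ (suc l) → Vec ℚ k × Vec ℚ l
      tails (u , v) = Vec.tail u , Vec.tail v
      Rest : ℕ → ℤ × (ℚ × ℚ) → Vec ℚ (suc k) × Vec ℚ (suc l) → Set
      Rest H (a , y) w = (Vec.head (proj₁ w) , Vec.head (proj₂ w)) ≡ y × Corner H a (tails w)

  -- Entries outside the first row and column are u_i v_j / a, so the corner a, and then one diagonal entry
  -- for each pair (u_i , v_i), determine a rank one matrix up to H^o(1) choices.
  bd-RankOne : ∀ {I : Set} k l → Bdo (RankOne {I} {k} {l}) (2 ℕ.* (k ℕ.⊔ l))
  bd-RankOne zero l = _ , bd-⊆ {Q = λ H i A → ⊤} (λ _ i _ _ _ → i , λ _ _ → tt) z≤n ≤-refl (bd-subsingleton λ { _ _ [] [] _ _ _ → refl })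
  bd-RankOne k@(suc _) zero = _ , bd-⊆ {Q = λ H i A → ⊤} (λ _ i _ _ _ → i , λ _ _ → tt) z≤n ≤-refl
    (bd-subsingleton λ { _ _ A B _ _ _ → matrix-ext A B λ _ () })
  bd-RankOne {I} (suc k) (suc l) = _ , bd-weaken (≤-reflexive (sym (*-suc 2 (k ℕ.⊔ l)))) ≤-refl
    (bd-fibration {T = λ H i a → 1 ≤ ∣ a ∣ × ∣ a ∣ ≤ H} {R = Framed} {p = 2} {e = 0} ℤ._≟_ (λ _ a → a)
      (λ { H i A _ (eg , minors) → let (a , 1≤a , a≤H , h) = eg zero zero in a , (1≤a , a≤H) , h , (1≤a , a≤H) , eg , minors }) (bd-sign bd-interval)
      (bd-inj (Product.≡-dec _≟ᵛ_ _≟ᵛ_) (λ _ → frame) id (λ H a A _ → corner H a A) same (proj₂ (bd-Corner k l))))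
    where
    open +-*-Solver
    frame : Matrix (suc k) (suc l) → Vec ℚ k × Vec ℚ l
    frame A = Vec.tabulate (λ i → entry A (suc i) zero) , Vec.tabulate (λ j → entry A zero (suc j))
    Framed : ℕ → ℤ → Matrix (suc k) (suc l) → Set
    Framed H a A = Inverse a (entry A zero zero) × (1 ≤ ∣ a ∣ × ∣ a ∣ ≤ H) × RankOne H a A
    corner : ∀ H a A → Framed H a A → Corner H a (frame A)
    corner H a A (h , a-bounds , eg , minors) = a-bounds ,
      (λ i → subst (IsEgyptian H) (sym (Vec.lookup∘tabulate (λ i → entry A (suc i) zero) i)) (eg (suc i) zero)) ,
      (λ j → subst (IsEgyptian H) (sym (Vec.lookup∘tabulate (λ j → entry A zero (suc j)) j)) (eg zero (suc j))) ,
      λ i j → let (w , 1≤w , w≤H , k) = eg (suc i) (suc j) in w , (1≤w , w≤H) , (begin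
        lookup (proj₁ (frame A)) i * lookup (proj₂ (frame A)) j * ι (a ℤ.* w)
          ≡⟨ cong₂ _*_ (cong₂ _*_ (Vec.lookup∘tabulate (λ i → entry A (suc i) zero) i) (Vec.lookup∘tabulate (λ j → entry A zero (suc j)) j)) (ι-* a w) ⟩
        entry A (suc i) zero * entry A zero (suc j) * (ι a * ι w)
          ≡⟨ cong (_* (ι a * ι w)) (minors (suc i) zero zero (suc j)) ⟩
        entry A (suc i) (suc j) * entry A zero zero * (ι a * ι w)
          ≡⟨ solve 4 (λ x y a w → x :* y :* (a :* w) := (x :* w) :* (y :* a)) refl (entry A (suc i) (suc j)) (entry A zero zero) (ι a) (ι w) ⟩
        entry A (suc i) (suc j) * ι w * (entry A zero zero * ι a)
          ≡⟨ cong₂ _*_ k h ⟩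
        1ℚ ∎)
      where open ≡-Reasoning
    same : ∀ H a A B → 1 ≤ H → Framed H a A → Framed H a B → frame A ≡ frame B → A ≡ B
    same H a A B _ (hA , _ , eg , minorsA) (hB , _ , _ , minorsB) e = matrix-ext A B ext
      where
      00≡ : entry A zero zero ≡ entry B zero zero
      00≡ = inverse-unique {a} hA hB
      i0≡ : ∀ i → entry A (suc i) zero ≡ entry B (suc i) zero
      i0≡ i = trans (sym (Vec.lookup∘tabulate (λ i → entry A (suc i) zero) i)) (trans (cong (λ z → lookup (proj₁ z) i) e) (Vec.lookup∘tabulate (λ i → entry B (suc i) zero) i))
      0j≡ : ∀ j → entry A zero (suc j) ≡ entry B zero (suc j)
      0j≡ j = trans (sym (Vec.lookup∘tabulate (λ j → entry A zero (suc j)) j)) (trans (cong (λ z → lookup (proj₂ z) j) e) (Vec.lookup∘tabulate (λ j → entry B zero (suc j)) j))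
      ext : ∀ i j → entry A i j ≡ entry B i j
      ext zero zero = 00≡
      ext (suc i) zero = i0≡ i
      ext zero (suc j) = 0j≡ j
      ext (suc i) (suc j) = *-cancelˡ {entry A zero zero} (egyptian≢0 {H} (eg zero zero)) (begin
        entry A zero zero * entry A (suc i) (suc j) ≡⟨ minorsA zero (suc i) zero (suc j) ⟩
        entry A zero (suc j) * entry A (suc i) zero ≡⟨ cong₂ _*_ (0j≡ j) (i0≡ i) ⟩
        entry B zero (suc j) * entry B (suc i) zero ≡⟨ sym (minorsB zero (suc i) zero (suc j)) ⟩
        entry B zero zero * entry B (suc i) (suc j) ≡⟨ cong (_* entry B (suc i) (suc j)) (sym 00≡) ⟩
        entry A zero zero * entry B (suc i) (suc j) ∎)
        where open ≡-Reasoning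

  -- Splitting a matrix into two classes of proportional rows

  module _ {X : Set} where

    selectT : ∀ {n} (b : Vec Bool n) → Vec X n → Vec X (countT b)
    selectT [] [] = []
    selectT (true ∷ b) (x ∷ v) = x ∷ selectT b v
    selectT (false ∷ b) (x ∷ v) = selectT b v

    selectF : ∀ {n} (b : Vec Bool n) → Vec X n → Vec X (countF b)
    selectF [] [] = []
    selectF (true ∷ b) (x ∷ v) = selectF b v
    selectF (false ∷ b) (x ∷ v) = x ∷ selectF b v

    select-injective : ∀ {n} (b : Vec Bool n) (v w : Vec X n) → selectT b v ≡ selectT b w → selectF b v ≡ selectF b w → v ≡ w
    select-injective [] [] [] _ _ = refl
    select-injective (true ∷ b) (x ∷ v) (y ∷ w) e f = cong₂ _∷_ (cong Vec.head e) (select-injective b v w (cong Vec.tail e) f)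
    select-injective (false ∷ b) (x ∷ v) (y ∷ w) e f = cong₂ _∷_ (cong Vec.head f) (select-injective b v w e (cong Vec.tail f))

  indexT : ∀ {n} (b : Vec Bool n) → Fin (countT b) → Fin n
  indexT (true ∷ b) zero = zero
  indexT (true ∷ b) (suc i) = suc (indexT b i)
  indexT (false ∷ b) i = suc (indexT b i)

  indexF : ∀ {n} (b : Vec Bool n) → Fin (countF b) → Fin n
  indexF (true ∷ b) i = suc (indexF b i)
  indexF (false ∷ b) zero = zero
  indexF (false ∷ b) (suc i) = suc (indexF b i)

  lookup-indexT : ∀ {n} (b : Vec Bool n) i → lookup b (indexT b i) ≡ true
  lookup-indexT (true ∷ b) zero = refl
  lookup-indexT (true ∷ b) (suc i) = lookup-indexT b i
  lookup-indexT (false ∷ b) i = lookup-indexT b i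

  lookup-indexF : ∀ {n} (b : Vec Bool n) i → lookup b (indexF b i) ≡ false
  lookup-indexF (true ∷ b) i = lookup-indexF b i
  lookup-indexF (false ∷ b) zero = refl
  lookup-indexF (false ∷ b) (suc i) = lookup-indexF b i

  lookup-selectT : ∀ {X : Set} {n} (b : Vec Bool n) (v : Vec X n) i → lookup (selectT b v) i ≡ lookup v (indexT b i)
  lookup-selectT (true ∷ b) (x ∷ v) zero = refl
  lookup-selectT (true ∷ b) (x ∷ v) (suc i) = lookup-selectT b v i
  lookup-selectT (false ∷ b) (x ∷ v) i = lookup-selectT b v i

  lookup-selectF : ∀ {X : Set} {n} (b : Vec Bool n) (v : Vec X n) i → lookup (selectF b v) i ≡ lookup v (indexF b i)
  lookup-selectF (true ∷ b) (x ∷ v) i = lookup-selectF b v i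
  lookup-selectF (false ∷ b) (x ∷ v) zero = refl
  lookup-selectF (false ∷ b) (x ∷ v) (suc i) = lookup-selectF b v i

  TwoClasses : ∀ {m} → Vec Bool m → (Fin m → Fin m → Set) → Set
  TwoClasses b _~_ = ∀ i k → lookup b i ≡ lookup b k → i ~ k

  rankOne-submatrix : ∀ {I : Set} {m n s H} {i : I} (A : Matrix m n) (B : Matrix s n) (f : Fin s → Fin m) → AllEgyptian H A →
    (∀ i → lookup B i ≡ lookup A (f i)) → (∀ i k → Minors (entry A) (f i) (f k)) → RankOne H i B
  rankOne-submatrix {H = H} A B f eg e minors = (λ i j → subst (λ v → IsEgyptian H (lookup v j)) (sym (e i)) (eg (f i) j)) ,
    λ i k j l → subst₂ (λ u v → lookup u j * lookup v l ≡ lookup u l * lookup v j) (sym (e i)) (sym (e k)) (minors i k j l)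

  -- Each class of rows forms a rank one matrix with n columns. The two are counted independently,
  -- after a bounded choice of the classes.
  bdo-TwoClasses : ∀ {I : Set} m n M → (∀ (b : Vec Bool m) → (countT b ℕ.⊔ n) ℕ.+ (countF b ℕ.⊔ n) ≤ M) →
    Bdo {I} {Matrix m n} (λ H _ A → Σ (Vec Bool m) λ b → AllEgyptian H A × TwoClasses b (Minors (entry A))) (2 ℕ.* M)
  bdo-TwoClasses {I} m n M h = bdo-⋃Bool m λ b → _ , bd-weaken
    (≤-trans (≤-reflexive (sym (*-distribˡ-+ 2 (countT b ℕ.⊔ n) (countF b ℕ.⊔ n)))) (*-monoʳ-≤ 2 (h b))) ≤-refl
    (bd-inj (Product.≡-dec _≟ᵐ_ _≟ᵐ_) (λ _ A → selectT b A , selectF b A) id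
      (λ { H i A _ (eg , two) →
           rankOne-submatrix {i = i} A (selectT b A) (indexT b) eg (lookup-selectT b A) (λ i k → two _ _ (trans (lookup-indexT b i) (sym (lookup-indexT b k)))) ,
           rankOne-submatrix {i = i} A (selectF b A) (indexF b) eg (lookup-selectF b A) (λ i k → two _ _ (trans (lookup-indexF b i) (sym (lookup-indexF b k)))) })
      (λ _ _ A B _ _ _ e → select-injective b A B (cong proj₁ e) (cong proj₂ e))
      (bd-× _≟ᵐ_ _≟ᵐ_ (proj₂ (bd-RankOne {I} (countT b) n)) (proj₂ (bd-RankOne {I} (countF b) n))))

  countT+countF : ∀ {n} (b : Vec Bool n) → countT b ℕ.+ countF b ≡ n
  countT+countF b = trans (cong (countT b ℕ.+_) (countF≡ b)) (m+[n∸m]≡n (countT≤ b))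

  -- The extreme case puts everything into one class: s + t on one side and 0 on the other.
  ⊔+⊔≤ : ∀ s t n → (s ℕ.⊔ n) ℕ.+ (t ℕ.⊔ n) ≤ (s ℕ.+ t ℕ.⊔ n) ℕ.+ n
  ⊔+⊔≤ s t n with ≤-total s n | ≤-total t n
  ... | inj₁ s≤n | inj₁ t≤n = +-mono-≤ (≤-trans (≤-reflexive (m≤n⇒m⊔n≡n s≤n)) (m≤n⊔m (s ℕ.+ t) n)) (≤-reflexive (m≤n⇒m⊔n≡n t≤n))
  ... | inj₁ s≤n | inj₂ n≤t = ≤-trans (≤-reflexive (trans (cong₂ ℕ._+_ (m≤n⇒m⊔n≡n s≤n) (m≥n⇒m⊔n≡m n≤t)) (+-comm n t)))
    (+-monoˡ-≤ n (≤-trans (m≤n+m t s) (m≤m⊔n (s ℕ.+ t) n)))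
  ... | inj₂ n≤s | inj₁ t≤n = +-mono-≤ (≤-trans (≤-reflexive (m≥n⇒m⊔n≡m n≤s)) (≤-trans (m≤m+n s t) (m≤m⊔n (s ℕ.+ t) n))) (≤-reflexive (m≤n⇒m⊔n≡n t≤n))
  ... | inj₂ n≤s | inj₂ n≤t = ≤-trans (≤-reflexive (cong₂ ℕ._+_ (m≥n⇒m⊔n≡m n≤s) (m≥n⇒m⊔n≡m n≤t))) (≤-trans (m≤m⊔n (s ℕ.+ t) n) (m≤m+n _ n))

  classes≤ : ∀ {m} n (b : Vec Bool m) → (countT b ℕ.⊔ n) ℕ.+ (countF b ℕ.⊔ n) ≤ (m ℕ.⊔ n) ℕ.+ n
  classes≤ {m} n b = subst (λ z → (countT b ℕ.⊔ n) ℕ.+ (countF b ℕ.⊔ n) ≤ (z ℕ.⊔ n) ℕ.+ n) (countT+countF b) (⊔+⊔≤ (countT b) (countF b) n)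

  -- One class is that of `zero`. If `p` lies outside it, then either everything else outside is
  -- related to `p`, or some `q` is related to neither.
  two-classes-or-triple : ∀ m {_~_ : Fin m → Fin m → Set} → (∀ i k → Dec (i ~ k)) →
    (∀ {i k} → i ~ k → k ~ i) → (∀ {i k l} → i ~ k → k ~ l → i ~ l) →
    (Σ (Vec Bool m) λ b → TwoClasses b _~_) ⊎ (Σ (Fin m × Fin m × Fin m) λ (i , k , l) → ¬ (i ~ k) × ¬ (i ~ l) × ¬ (k ~ l))
  two-classes-or-triple zero _ _ _ = inj₁ ([] , λ ())
  two-classes-or-triple (suc m) {_~_} _~?_ ~-sym ~-trans with Fin.any? (λ k → ¬? (zero ~? k))
  ... | no one = inj₁ (Vec.replicate _ true , λ i k _ → ~-trans (~-sym (to0 i)) (to0 k))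
    where
    to0 : ∀ k → zero ~ k
    to0 k with zero ~? k
    ... | yes r = r
    ... | no ¬r = ⊥-elim (one (k , ¬r))
  ... | yes (p , 0≁p) with Fin.any? (λ k → ¬? (zero ~? k) ×-dec ¬? (p ~? k))
  ... | yes (q , 0≁q , p≁q) = inj₂ ((zero , p , q) , 0≁p , 0≁q , p≁q)
  ... | no two = inj₁ (Vec.tabulate (λ k → does (zero ~? k)) , λ i k e → same i k
      (trans (sym (Vec.lookup∘tabulate (λ k → does (zero ~? k)) i)) (trans e (Vec.lookup∘tabulate (λ k → does (zero ~? k)) k))))
    where
    same : ∀ i k → does (zero ~? i) ≡ does (zero ~? k) → i ~ k
    same i k e with zero ~? i | zero ~? k
    ... | yes r | yes s = ~-trans (~-sym r) s
    ... | no ¬r | no ¬s with p ~? i | p ~? k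
    ... | yes r | yes s = ~-trans (~-sym r) s
    ... | no ¬r′ | _ = ⊥-elim (two (i , ¬r , ¬r′))
    ... | _ | no ¬s′ = ⊥-elim (two (k , ¬s , ¬s′))

  -- Proportionality, minors and determinants

  module _ {m n : ℕ} (F : Fin m → Fin n → ℚ) where

    open +-*-Solver

    minors? : ∀ i k → Dec (Minors F i k)
    minors? i k = Fin.all? λ j → Fin.all? λ l → F i j * F k l ℚ.≟ F i l * F k j

    minors-sym : ∀ {i k} → Minors F i k → Minors F k i
    minors-sym {i} {k} h j l = trans (ℚ.*-comm (F k j) (F i l)) (trans (sym (h j l)) (ℚ.*-comm (F i j) (F k l)))

    -- Proportionality passes through the middle row because an entry of that row can be cancelled;
    -- this is where nonvanishing entries matter.
    minors-trans : (∀ i j → F i j ≢ 0ℚ) → ∀ {i k q} → Minors F i k → Minors F k q → Minors F i q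
    minors-trans F≢0 {i} {k} {q} h g j l = *-cancelˡ {F k l} (F≢0 k l) (begin
      F k l * (F i j * F q l) ≡⟨ solve 3 (λ x y z → x :* (y :* z) := y :* x :* z) refl (F k l) (F i j) (F q l) ⟩
      F i j * F k l * F q l ≡⟨ cong (_* F q l) (h j l) ⟩
      F i l * F k j * F q l ≡⟨ ℚ.*-assoc (F i l) (F k j) (F q l) ⟩
      F i l * (F k j * F q l) ≡⟨ cong (F i l *_) (g j l) ⟩
      F i l * (F k l * F q j) ≡⟨ solve 3 (λ x y z → y :* (x :* z) := x :* (y :* z)) refl (F k l) (F i l) (F q j) ⟩
      F k l * (F i l * F q j) ∎)
      where open ≡-Reasoning

  minor : ∀ {m n} → (Fin m → Fin n → ℚ) → Fin m → Fin m → Fin n → Fin n → ℚ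
  minor F i k j l = F i j * F k l - F i l * F k j

  −≡0⇒≡ : ∀ {x y} → x - y ≡ 0ℚ → x ≡ y
  −≡0⇒≡ {x} {y} e = trans (solve 2 (λ x y → x := (x :- y) :+ y) refl x y) (trans (cong (_+ y) e) (ℚ.+-identityˡ y))
    where open +-*-Solver

  ≡⇒−≡0 : ∀ {x y} → x ≡ y → x - y ≡ 0ℚ
  ≡⇒−≡0 {x} refl = ℚ.+-inverseʳ x

  -- The vector product. Its components are 2 × 2 minors up to sign, and its scalar product with a
  -- third column is the 3 × 3 determinant. A vanishing determinant thus becomes a three-term
  -- equation for the third column.
  cross : ℚ × ℚ × ℚ → ℚ × ℚ × ℚ → ℚ × ℚ × ℚ
  cross (a , d , g) (b , e , h) = d * h - e * g , b * g - a * h , a * e - b * d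

  _∙_ : ℚ × ℚ × ℚ → ℚ × ℚ × ℚ → ℚ
  (α , β , γ) ∙ (x , y , z) = α * x + β * y + γ * z

  column : ∀ {m n} → (Fin m → Fin n → ℚ) → Fin m → Fin m → Fin m → Fin n → ℚ × ℚ × ℚ
  column F i k q j = F i j , F k j , F q j

  ZeroDets : ∀ {m n} → (Fin m → Fin n → ℚ) → Set
  ZeroDets F = ∀ i k q j l c → cross (column F i k q j) (column F i k q l) ∙ column F i k q c ≡ 0ℚ

  rowTriple : ∀ {m n} → (Fin m → Fin n → ℚ) → Fin n → Fin n → Fin n → Fin m → ℚ × ℚ × ℚ
  rowTriple F j l c i = F i j , F i l , F i c

  cross-transpose : ∀ {m n} (F : Fin m → Fin n → ℚ) i k q j l c →
    cross (rowTriple F j l c i) (rowTriple F j l c k) ∙ rowTriple F j l c q ≡ cross (column F i k q j) (column F i k q l) ∙ column F i k q c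
  cross-transpose F i k q j l c = solve 9 (λ a b c d e f g h i →
      (b :* f :- e :* c) :* g :+ (d :* c :- a :* f) :* h :+ (a :* e :- d :* b) :* i := (d :* h :- e :* g) :* c :+ (b :* g :- a :* h) :* f :+ (a :* e :- b :* d) :* i)
    refl (F i j) (F i l) (F i c) (F k j) (F k l) (F k c) (F q j) (F q l) (F q c)
    where open +-*-Solver

  module _ {m n : ℕ} (F : Fin m → Fin n → ℚ) (dets : ZeroDets F) where

    private
      α β : Fin m → Fin m → Fin n → Fin n → Fin m → ℚ
      α i k j l q = F k j * F q l - F k l * F q j
      β i k j l q = F i l * F q j - F i j * F q l

      -- The vanishing determinant, expanded along column c and solved for the entry in row q.
      combination : ∀ i k j l q c → minor F i k j l * F q c ≡ - (α i k j l q * F i c + β i k j l q * F k c)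
      combination i k j l q c = trans (solve 2 (λ s t → t := (s :+ t) :- s) refl s t) (trans (cong (_- s) (dets i k q j l c)) (ℚ.+-identityˡ (- s)))
        where
        open +-*-Solver
        s = α i k j l q * F i c + β i k j l q * F k c
        t = minor F i k j l * F q c

    -- If the minor vanished, columns j and l would be proportional on rows i and k, which span all rows.
    minor≢0 : ∀ {i k j l} → ¬ Minors F i k → ¬ Minors (λ j i → F i j) j l → minor F i k j l ≢ 0ℚ
    minor≢0 {i} {k} {j} {l} rows cols e with Fin.any? (λ j′ → Fin.any? λ l′ → ¬? (F i j′ * F k l′ ℚ.≟ F i l′ * F k j′))
    ... | no none = rows λ j′ l′ → case F i j′ * F k l′ ℚ.≟ F i l′ * F k j′ of λ { (yes r) → r ; (no ¬r) → ⊥-elim (none (j′ , l′ , ¬r)) }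
    ... | yes (j′ , l′ , D′≢0) = cols λ q p → −≡0⇒≡ (*≡0⇒ D≢0 (*≡0⇒ D≢0 (vanish q p)))
      where
      D = minor F i k j′ l′
      D≢0 : D ≢ 0ℚ
      D≢0 e = D′≢0 (−≡0⇒≡ e)
      open ≡-Reasoning
      open +-*-Solver
      -- Both D times row q and D times row p are combinations of rows i and k. So D * D times their
      -- minor in columns j and l is the determinant of the coefficients times the minor of rows i
      -- and k, which is zero.
      vanish : ∀ q p → D * (D * (F q j * F p l - F p j * F q l)) ≡ 0ℚ
      vanish q p = begin
        D * (D * (F q j * F p l - F p j * F q l))
          ≡⟨ solve 5 (λ D a b c d → D :* (D :* (a :* b :- c :* d)) := (D :* a) :* (D :* b) :- (D :* c) :* (D :* d)) refl D (F q j) (F p l) (F p j) (F q l) ⟩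
        (D * F q j) * (D * F p l) - (D * F p j) * (D * F q l)
          ≡⟨ cong₂ _-_ (cong₂ _*_ (combination i k j′ l′ q j) (combination i k j′ l′ p l)) (cong₂ _*_ (combination i k j′ l′ p j) (combination i k j′ l′ q l)) ⟩
        - (α′ q * F i j + β′ q * F k j) * - (α′ p * F i l + β′ p * F k l) - - (α′ p * F i j + β′ p * F k j) * - (α′ q * F i l + β′ q * F k l)
          ≡⟨ solve 8 (λ a b a′ b′ u u′ v v′ → (:- (a :* u :+ b :* u′)) :* (:- (a′ :* v :+ b′ :* v′)) :- (:- (a′ :* u :+ b′ :* u′)) :* (:- (a :* v :+ b :* v′))
               := (a :* b′ :- a′ :* b) :* (u :* v′ :- v :* u′)) refl (α′ q) (β′ q) (α′ p) (β′ p) (F i j) (F k j) (F i l) (F k l) ⟩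
        (α′ q * β′ p - α′ p * β′ q) * minor F i k j l
          ≡⟨ trans (cong ((α′ q * β′ p - α′ p * β′ q) *_) e) (ℚ.*-zeroʳ (α′ q * β′ p - α′ p * β′ q)) ⟩
        0ℚ ∎
        where
        α′ = α i k j′ l′
        β′ = β i k j′ l′

  -- Rank two matrices with a 3 × 3 core

  _⟨_⟩ : ∀ {n} → Vec Bool n → Fin n → Vec Bool n
  b ⟨ j ⟩ = b Vec.[ j ]≔ true

  countT-set : ∀ {n} (b : Vec Bool n) j → lookup b j ≡ false → countT (b ⟨ j ⟩) ≡ suc (countT b)
  countT-set (false ∷ b) zero _ = refl
  countT-set (true ∷ b) (suc j) e = cong suc (countT-set b j e)
  countT-set (false ∷ b) (suc j) e = countT-set b j e

  lookup-set : ∀ {n} (b : Vec Bool n) j i → lookup (b ⟨ j ⟩) i ≡ true → i ≡ j ⊎ lookup b i ≡ true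
  lookup-set b j i e with i Fin.≟ j
  ... | yes i≡j = inj₁ i≡j
  ... | no i≢j = inj₂ (trans (sym (Vec.lookup∘update′ i≢j b true)) e)

  empty : ∀ n → Vec Bool n
  empty n = Vec.replicate n false

  countT-empty : ∀ n → countT (empty n) ≡ 0
  countT-empty zero = refl
  countT-empty (suc n) = countT-empty n

  lookup-pair : ∀ {n} (j l : Fin n) i → lookup (empty n ⟨ j ⟩ ⟨ l ⟩) i ≡ true → i ≡ l ⊎ i ≡ j
  lookup-pair {n} j l i e with lookup-set (empty n ⟨ j ⟩) l i e
  ... | inj₁ i≡l = inj₁ i≡l
  ... | inj₂ e′ with lookup-set (empty n) j i e′
  ... | inj₁ i≡j = inj₂ i≡j
  ... | inj₂ e″ = case trans (sym (Vec.lookup-replicate i false)) e″ of λ ()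

  countT-pair : ∀ {n} (j l : Fin n) → l ≢ j → countT (empty n ⟨ j ⟩ ⟨ l ⟩) ≡ 2
  countT-pair {n} j l l≢j = trans (countT-set (empty n ⟨ j ⟩) l (trans (Vec.lookup∘update′ l≢j (empty n) true) (Vec.lookup-replicate l false)))
    (cong suc (trans (countT-set (empty n) j (Vec.lookup-replicate j false)) (cong suc (countT-empty n))))

  lookup-triple : ∀ {n} (j l c : Fin n) i → lookup (empty n ⟨ j ⟩ ⟨ l ⟩ ⟨ c ⟩) i ≡ true → i ≡ c ⊎ i ≡ l ⊎ i ≡ j
  lookup-triple {n} j l c i e with lookup-set (empty n ⟨ j ⟩ ⟨ l ⟩) c i e
  ... | inj₁ i≡c = inj₁ i≡c
  ... | inj₂ e′ = inj₂ (lookup-pair j l i e′)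

  countT-triple : ∀ {n} (j l c : Fin n) → l ≢ j → c ≢ j → c ≢ l → countT (empty n ⟨ j ⟩ ⟨ l ⟩ ⟨ c ⟩) ≡ 3
  countT-triple {n} j l c l≢j c≢j c≢l = trans (countT-set (empty n ⟨ j ⟩ ⟨ l ⟩) c (trans (Vec.lookup∘update′ c≢l (empty n ⟨ j ⟩) true)
    (trans (Vec.lookup∘update′ c≢j (empty n) true) (Vec.lookup-replicate c false)))) (cong suc (countT-pair j l l≢j))

  -- The five minors are the coefficients that occur when the core is extended by a column or by a row.
  module _ {m n : ℕ} where

    CoreIndex = (Fin m × Fin m × Fin m) × (Fin n × Fin n × Fin n)

    record Core (H : ℕ) (ι : CoreIndex) (A : Matrix m n) : Set where
      constructor core
      F = entry A
      i₁ = proj₁ (proj₁ ι)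
      i₂ = proj₁ (proj₂ (proj₁ ι))
      i₃ = proj₂ (proj₂ (proj₁ ι))
      j₁ = proj₁ (proj₂ ι)
      j₂ = proj₁ (proj₂ (proj₂ ι))
      j₃ = proj₂ (proj₂ (proj₂ ι))
      field
        egyptian : AllEgyptian H A
        dets : ZeroDets F
        minor₁ : minor F i₂ i₃ j₁ j₂ ≢ 0ℚ
        minor₂ : minor F i₁ i₃ j₁ j₂ ≢ 0ℚ
        minor₃ : minor F i₁ i₂ j₁ j₂ ≢ 0ℚ
        minor₄ : minor F i₁ i₂ j₂ j₃ ≢ 0ℚ
        minor₅ : minor F i₁ i₂ j₁ j₃ ≢ 0ℚ

    private
      Egyptian³ : ∀ {I : Set} → ℕ → I → ℚ × ℚ × ℚ → Set
      Egyptian³ H _ t = IsEgyptian H (proj₁ t) × IsEgyptian H (proj₁ (proj₂ t)) × IsEgyptian H (proj₂ (proj₂ t))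

      bd-Egyptian³ : ∀ {I : Set} → Bd (Egyptian³ {I}) 6 0
      bd-Egyptian³ = bd-× ℚ._≟_ (Product.≡-dec ℚ._≟_ ℚ._≟_) bd-Egyptian (bd-× ℚ._≟_ ℚ._≟_ bd-Egyptian bd-Egyptian)

      -- Serves the marked coordinates of a vector, which share a single predicate: a core column is
      -- recorded only as one of the two already chosen, a loss of a constant factor.
      bd-two : ∀ {X : Set} → DecidableEquality X → Bd {X × X} {X} (λ H (y , z) x → x ≡ y ⊎ x ≡ z) 0 0
      bd-two _≟_ = bd-fibration {R = λ { H ((y , z) , b) x → x ≡ (if b then y else z) }} {p = 0} {q = 0} Bool._≟_ _,_
        (λ { H _ x _ (inj₁ e) → true , tt , e ; H _ x _ (inj₂ e) → false , tt , e }) bd-Bool (bd-subsingleton λ { _ _ _ _ _ refl refl → refl })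

      bd-three : ∀ {X : Set} → DecidableEquality X → Bd {X × X × X} {X} (λ H (y , z , w) x → x ≡ y ⊎ x ≡ z ⊎ x ≡ w) 0 0
      bd-three {X} _≟_ = bd-fibration {R = R} {p = 0} {q = 0} Bool._≟_ _,_
        (λ { H _ x _ (inj₁ e) → true , tt , e ; H _ x _ (inj₂ e) → false , tt , e }) bd-Bool
        (bd-⊆ {Q = λ H (y , z) x → x ≡ y ⊎ x ≡ z} (λ { H ((y , z , w) , true) x _ _ → (y , y) , λ _ → inj₁ ; H ((y , z , w) , false) x _ _ → (z , w) , λ _ e → e })
          z≤n z≤n (bd-two _≟_))
        where
        R : ℕ → (X × X × X) × Bool → X → Set
        R H ((y , z , w) , b) x = if b then x ≡ y else (x ≡ z ⊎ x ≡ w)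

      -- Height 5 = 1 + 2 + 2: a product of two unit fractions has height 2, and a difference adds
      -- one.
      ht-minor : ∀ {H} x y z w → 1 ≤ H → IsEgyptian H x → IsEgyptian H y → IsEgyptian H z → IsEgyptian H w → Ht 5 H (x * y - z * w)
      ht-minor {H} x y z w 1≤H ex ey ez ew = ht-− 1≤H (ht-* 1≤H (egyptian x ex) (egyptian y ey)) (ht-* 1≤H (egyptian z ez) (egyptian w ew))
        where
        egyptian : ∀ x → IsEgyptian H x → Ht 1 H x
        egyptian x = ht-Egyptian 1≤H {x}

      neg-minor≢0 : ∀ {x y z w} → x * y - z * w ≢ 0ℚ → z * w - x * y ≢ 0ℚ
      neg-minor≢0 {x} {y} {z} {w} h e = h (≡⇒−≡0 {x * y} {z * w} (sym (−≡0⇒≡ {z * w} {x * y} e)))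

      threeTerm-cross : ∀ {H} (u v t : ℚ × ℚ × ℚ) → 1 ≤ H → Egyptian³ H u u → Egyptian³ H v v → Egyptian³ H t t →
        (let (α , β , γ) = cross u v in α ≢ 0ℚ × β ≢ 0ℚ × γ ≢ 0ℚ) → cross u v ∙ t ≡ 0ℚ → ThreeTerm 5 H (cross u v) t
      threeTerm-cross u@(a , d , g) v@(b , e , h) t 1≤H (ea , ed , eg) (eb , ee , eh) et n eq = n ,
        (ht-minor d h e g 1≤H ed eh ee eg , ht-minor b g a h 1≤H eb eg ea eh , ht-minor a e b d 1≤H ea ee eb ed) , et , eq

      RowData = (Fin n × Fin n × Fin n) × (Vec ℚ n × Vec ℚ n × Vec ℚ n)

      at³ : Vec ℚ n → Fin n × Fin n × Fin n → ℚ × ℚ × ℚ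
      at³ v (j , l , c) = lookup v j , lookup v l , lookup v c

      -- The first clause is the three-term equation that costs H. The second ties every entry of x
      -- to its entries in columns j₁ and j₂, and the last makes the coefficient of the tied entry
      -- nonzero.
      OtherRow : ℕ → RowData → Vec ℚ n → Set
      OtherRow H (js@(j₁ , j₂ , _) , (r₁ , r₂ , _)) x = ThreeTerm 5 H (cross (at³ r₁ js) (at³ r₂ js)) (at³ x js) ×
        (∀ c → cross (at³ r₁ (j₁ , j₂ , c)) (at³ r₂ (j₁ , j₂ , c)) ∙ at³ x (j₁ , j₂ , c) ≡ 0ℚ) ×
        lookup r₁ j₁ * lookup r₂ j₂ - lookup r₂ j₁ * lookup r₁ j₂ ≢ 0ℚ

      bd-OtherRow : Bdo OtherRow 2
      bd-OtherRow = _ , bd-inj _≟³_ (λ i x → at³ x (proj₁ i)) (λ { (js , (r₁ , r₂ , _)) → cross (at³ r₁ js) (at³ r₂ js) }) (λ _ _ _ _ → proj₁) same (proj₂ (bd-ThreeTerm 5))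
        where
        open import Algebra.Properties.Group ℚ.+-0-group using (∙-cancelˡ)
        same : ∀ H i x y → 1 ≤ H → OtherRow H i x → OtherRow H i y → at³ x (proj₁ i) ≡ at³ y (proj₁ i) → x ≡ y
        same H ((j₁ , j₂ , _) , (r₁ , r₂ , _)) x y _ (_ , hx , nz) (_ , hy , _) e = vec-ext x y λ c →
          let (α , β , γ) = cross (at³ r₁ (j₁ , j₂ , c)) (at³ r₂ (j₁ , j₂ , c)) in
          *-cancelˡ {γ} nz (∙-cancelˡ (α * lookup x j₁ + β * lookup x j₂) (γ * lookup x c) (γ * lookup y c) (trans (hx c) (trans (sym (hy c))
            (cong₂ (λ u v → α * u + β * v + γ * lookup y c) (sym (cong proj₁ e)) (sym (cong (proj₁ ∘ proj₂) e))))))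

      Columns : ℕ → CoreIndex × ((ℚ × ℚ × ℚ) × (ℚ × ℚ × ℚ)) → Vec (ℚ × ℚ × ℚ) n → Set
      Columns H ((_ , (j₁ , j₂ , _)) , (y₁ , y₂)) v = countT (empty n ⟨ j₁ ⟩ ⟨ j₂ ⟩) ≡ 2 ×
        (∀ j → (if lookup (empty n ⟨ j₁ ⟩ ⟨ j₂ ⟩) j then (λ x → x ≡ y₁ ⊎ x ≡ y₂) else ThreeTerm 5 H (cross y₁ y₂)) (lookup v j))

      bd-Columns : Bdo Columns ((n ∸ 2) ℕ.* 2)
      bd-Columns = _ , bd-⊆ (λ { H ((_ , (j₁ , j₂ , _)) , y) v _ _ → (empty n ⟨ j₁ ⟩ ⟨ j₂ ⟩ , λ _ → y) , λ _ q → q }) ≤-refl ≤-refl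
        (bd-Vec {Q₀ = λ { H (y₁ , y₂) x → ThreeTerm 5 H (cross y₁ y₂) x }} {Q₁ = λ { H (y₁ , y₂) x → x ≡ y₁ ⊎ x ≡ y₂ }} 2 _≟³_
          (bd-⊆ (λ { H (y₁ , y₂) x _ _ → cross y₁ y₂ , λ _ q → q }) ≤-refl ≤-refl (proj₂ (bd-ThreeTerm 5))) (bd-two _≟³_))

      Rows : ℕ → (Fin m × Fin m × Fin m) × RowData → Matrix m n → Set
      Rows H ((i₁ , i₂ , i₃) , d@(_ , (r₁ , r₂ , r₃))) A = countT (empty m ⟨ i₁ ⟩ ⟨ i₂ ⟩ ⟨ i₃ ⟩) ≡ 3 ×
        (∀ i → (if lookup (empty m ⟨ i₁ ⟩ ⟨ i₂ ⟩ ⟨ i₃ ⟩) i then (λ x → x ≡ r₁ ⊎ x ≡ r₂ ⊎ x ≡ r₃) else OtherRow H d) (lookup A i))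

      bd-Rows : Bdo Rows ((m ∸ 3) ℕ.* 2)
      bd-Rows = _ , bd-⊆ (λ { H ((i₁ , i₂ , i₃) , d) A _ _ → (empty m ⟨ i₁ ⟩ ⟨ i₂ ⟩ ⟨ i₃ ⟩ , λ _ → d) , λ _ q → q }) ≤-refl ≤-refl
        (bd-Vec {Q₀ = OtherRow} {Q₁ = λ { H (_ , (r₁ , r₂ , r₃)) x → x ≡ r₁ ⊎ x ≡ r₂ ⊎ x ≡ r₃ }} 3 _≟ᵛ_
          (proj₂ bd-OtherRow) (bd-⊆ {p′ = 0} {e′ = 0} (λ { H (_ , r) x _ _ → r , λ _ q → q }) z≤n z≤n (bd-three _≟ᵛ_)))

    -- In halves, the six entries of two core columns cost 12. Each of the n - 2 other columns, cut
    -- down to the three core rows, solves a three-term equation, and so does each of the m - 3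
    -- other rows in the core columns; its remaining entries follow from vanishing determinants.
    bd-Core : Bdo Core (12 ℕ.+ ((n ∸ 2) ℕ.* 2 ℕ.+ (m ∸ 3) ℕ.* 2))
    bd-Core = _ , bd-fibration {T = Labels} {R = R₁} (Product.≡-dec _≟³_ _≟³_) _,_
      (λ { H ι A _ c → (coreColumn c (j₁ c) , coreColumn c (j₂ c)) ,
           ((egyptian c (i₁ c) (j₁ c) , egyptian c (i₂ c) (j₁ c) , egyptian c (i₃ c) (j₁ c)) , (egyptian c (i₁ c) (j₂ c) , egyptian c (i₂ c) (j₂ c) , egyptian c (i₃ c) (j₂ c))) ,
           c , refl })
      (bd-× _≟³_ _≟³_ bd-Egyptian³ bd-Egyptian³)
      (bd-fibration {R = R₂} (Vec.≡-dec _≟³_) _,_ columns (proj₂ bd-Columns)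
        (bd-⊆ (λ { H ((ι@(is , js) , y) , v) A 1≤H _ → (is , (js , (Vec.map proj₁ v , Vec.map (proj₁ ∘ proj₂) v , Vec.map (proj₂ ∘ proj₂) v))) , rows H ((ι , y) , v) 1≤H })
          ≤-refl ≤-refl (proj₂ bd-Rows)))
      where
      open Core
      Labels : ℕ → CoreIndex → (ℚ × ℚ × ℚ) × (ℚ × ℚ × ℚ) → Set
      Labels H ι y = Egyptian³ H ι (proj₁ y) × Egyptian³ H ι (proj₂ y)
      coreColumn : ∀ {H ι A} → Core H ι A → Fin n → ℚ × ℚ × ℚ
      coreColumn c = column (F c) (i₁ c) (i₂ c) (i₃ c)
      R₁ : ℕ → CoreIndex × ((ℚ × ℚ × ℚ) × (ℚ × ℚ × ℚ)) → Matrix m n → Set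
      R₁ H (ι , y) A = Σ (Core H ι A) λ c → (coreColumn c (j₁ c) , coreColumn c (j₂ c)) ≡ y
      coreColumns : ∀ {H ι A} → Core H ι A → Vec (ℚ × ℚ × ℚ) n
      coreColumns c = Vec.tabulate (coreColumn c)
      R₂ : ℕ → (CoreIndex × ((ℚ × ℚ × ℚ) × (ℚ × ℚ × ℚ))) × Vec (ℚ × ℚ × ℚ) n → Matrix m n → Set
      R₂ H ((ι , _) , v) A = Σ (Core H ι A) λ c → coreColumns c ≡ v
      columns : ∀ H i A → 1 ≤ H → R₁ H i A → Σ (Vec (ℚ × ℚ × ℚ) n) λ v → Columns H i v × R₂ H (i , v) A
      columns H (ι , _) A 1≤H (c , refl) = coreColumns c ,
        (countT-pair (j₁ c) (j₂ c) (λ e → minor₁ c (≡⇒−≡0 {F c (i₂ c) (j₁ c) * F c (i₃ c) (j₂ c)} (cong₂ (λ j l → F c (i₂ c) l * F c (i₃ c) j) e (sym e)))) , entries) , c , refl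
        where
        entries : ∀ j → (if lookup (empty n ⟨ j₁ c ⟩ ⟨ j₂ c ⟩) j then (λ x → x ≡ coreColumn c (j₁ c) ⊎ x ≡ coreColumn c (j₂ c))
            else ThreeTerm 5 H (cross (coreColumn c (j₁ c)) (coreColumn c (j₂ c)))) (lookup (coreColumns c) j)
        entries j rewrite Vec.lookup∘tabulate (coreColumn c) j with lookup (empty n ⟨ j₁ c ⟩ ⟨ j₂ c ⟩) j in e
        ... | true = case lookup-pair (j₁ c) (j₂ c) j e of λ { (inj₁ refl) → inj₂ refl ; (inj₂ refl) → inj₁ refl }
        ... | false = threeTerm-cross (coreColumn c (j₁ c)) (coreColumn c (j₂ c)) (coreColumn c j) 1≤H (col (j₁ c)) (col (j₂ c)) (col j)
              (minor₁ c , neg-minor≢0 {F c (i₁ c) (j₁ c)} {F c (i₃ c) (j₂ c)} {F c (i₁ c) (j₂ c)} {F c (i₃ c) (j₁ c)} (minor₂ c) , minor₃ c) (dets c (i₁ c) (i₂ c) (i₃ c) (j₁ c) (j₂ c) j)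
          where
          col : ∀ j → Egyptian³ H j (coreColumn c j)
          col j = egyptian c (i₁ c) j , egyptian c (i₂ c) j , egyptian c (i₃ c) j
      rows : ∀ H i → 1 ≤ H → ∀ A → R₂ H i A → Rows H (proj₁ (proj₁ (proj₁ i)) , (proj₂ (proj₁ (proj₁ i)) ,
        (Vec.map proj₁ (proj₂ i) , Vec.map (proj₁ ∘ proj₂) (proj₂ i) , Vec.map (proj₂ ∘ proj₂) (proj₂ i)))) A
      rows H ((ι , _) , _) 1≤H A (c , refl) = subst (λ r → Rows H (proj₁ ι , (proj₂ ι , r)) A)
        (cong₂ _,_ (coreRow proj₁ (i₁ c) (λ _ → refl)) (cong₂ _,_ (coreRow (proj₁ ∘ proj₂) (i₂ c) (λ _ → refl)) (coreRow (proj₂ ∘ proj₂) (i₃ c) (λ _ → refl))))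
        (countT-triple (i₁ c) (i₂ c) (i₃ c) (λ e → minor₃ c (equal-rows e)) (λ e → minor₂ c (equal-rows e)) (λ e → minor₁ c (equal-rows e)) , entries)
        where
        coreRow : ∀ (f : ℚ × ℚ × ℚ → ℚ) i → (∀ j → f (coreColumn c j) ≡ entry A i j) → lookup A i ≡ Vec.map f (coreColumns c)
        coreRow f i e = vec-ext (lookup A i) (Vec.map f (coreColumns c)) λ j → sym (trans (Vec.lookup-map j f (coreColumns c))
          (trans (cong f (Vec.lookup∘tabulate (coreColumn c) j)) (e j)))
        equal-rows : ∀ {i k j l} → k ≡ i → minor (F c) i k j l ≡ 0ℚ
        equal-rows {i} {_} {j} {l} refl = ≡⇒−≡0 {F c i j * F c i l} (ℚ.*-comm (F c i j) (F c i l))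
        commute : ∀ j l → minor (F c) (i₁ c) (i₂ c) j l ≢ 0ℚ → F c (i₁ c) j * F c (i₂ c) l - F c (i₂ c) j * F c (i₁ c) l ≢ 0ℚ
        commute j l = subst (λ t → F c (i₁ c) j * F c (i₂ c) l - t ≢ 0ℚ) (ℚ.*-comm (F c (i₁ c) l) (F c (i₂ c) j))
        row : ∀ i → Egyptian³ H i (rowTriple (F c) (j₁ c) (j₂ c) (j₃ c) i)
        row i = egyptian c i (j₁ c) , egyptian c i (j₂ c) , egyptian c i (j₃ c)
        entries : ∀ i → (if lookup (empty m ⟨ i₁ c ⟩ ⟨ i₂ c ⟩ ⟨ i₃ c ⟩) i then (λ x → x ≡ lookup A (i₁ c) ⊎ x ≡ lookup A (i₂ c) ⊎ x ≡ lookup A (i₃ c))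
            else OtherRow H (proj₂ ι , (lookup A (i₁ c) , lookup A (i₂ c) , lookup A (i₃ c)))) (lookup A i)
        entries i with lookup (empty m ⟨ i₁ c ⟩ ⟨ i₂ c ⟩ ⟨ i₃ c ⟩) i in e
        ... | true = case lookup-triple (i₁ c) (i₂ c) (i₃ c) i e of λ { (inj₁ refl) → inj₂ (inj₂ refl) ; (inj₂ (inj₁ refl)) → inj₂ (inj₁ refl) ; (inj₂ (inj₂ refl)) → inj₁ refl }
        ... | false = threeTerm-cross (rowTriple (F c) (j₁ c) (j₂ c) (j₃ c) (i₁ c)) (rowTriple (F c) (j₁ c) (j₂ c) (j₃ c) (i₂ c)) (rowTriple (F c) (j₁ c) (j₂ c) (j₃ c) i)
                1≤H (row (i₁ c)) (row (i₂ c)) (row i)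
                (commute (j₂ c) (j₃ c) (minor₄ c) ,
                 subst (λ t → t - F c (i₁ c) (j₁ c) * F c (i₂ c) (j₃ c) ≢ 0ℚ) (ℚ.*-comm (F c (i₁ c) (j₃ c)) (F c (i₂ c) (j₁ c)))
                   (neg-minor≢0 {F c (i₁ c) (j₁ c)} {F c (i₂ c) (j₃ c)} {F c (i₁ c) (j₃ c)} {F c (i₂ c) (j₁ c)} (minor₅ c)) ,
                 commute (j₁ c) (j₂ c) (minor₃ c))
                (det (j₃ c)) ,
              det , commute (j₁ c) (j₂ c) (minor₃ c)
          where
          det : ∀ q → cross (rowTriple (F c) (j₁ c) (j₂ c) q (i₁ c)) (rowTriple (F c) (j₁ c) (j₂ c) q (i₂ c)) ∙ rowTriple (F c) (j₁ c) (j₂ c) q i ≡ 0ℚ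
          det q = trans (cross-transpose (F c) (i₁ c) (i₂ c) i (j₁ c) (j₂ c) q) (dets c (i₁ c) (i₂ c) i (j₁ c) (j₂ c) q)

  -- Cramer's rule: a nonzero minor annihilates the coefficients of any relation between the two
  -- columns and so makes them independent. Equality of rationals is decidable, so refuting this
  -- suffices.
  dependent⇒minors : ∀ {m n} (A : Matrix m n) → (∀ (g : Fin 2 → Fin n) → ¬ ColsIndep A g) → ∀ i k → Minors (entry A) i k
  dependent⇒minors {m} {n} A dep i k j l = decidable-stable (entry A i j * entry A k l ℚ.≟ entry A i l * entry A k j)
    λ ne → dep g (independent λ e → ne (−≡0⇒≡ e))
    where
    open +-*-Solver
    g : Fin 2 → Fin n
    g zero = j
    g (suc _) = l
    zero-combination : ∀ {x y s t} → x ≡ 0ℚ → y ≡ 0ℚ → x * s - y * t ≡ 0ℚ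
    zero-combination {s = s} {t} refl refl = solve 2 (λ s t → con 0ℚ :* s :- con 0ℚ :* t := con 0ℚ) refl s t
    independent : minor (entry A) i k j l ≢ 0ℚ → ColsIndep A g
    independent D≢0 c h zero = *≡0⇒ {minor (entry A) i k j l} D≢0 (trans
      (solve 6 (λ a b c d x y → (a :* d :- b :* c) :* x := (x :* a :+ (y :* b :+ con 0ℚ)) :* d :- (x :* c :+ (y :* d :+ con 0ℚ)) :* b) refl
        (entry A i j) (entry A i l) (entry A k j) (entry A k l) (c zero) (c (suc zero)))
      (zero-combination (h i) (h k)))
    independent D≢0 c h (suc zero) = *≡0⇒ {minor (entry A) i k j l} D≢0 (trans
      (solve 6 (λ a b c d x y → (a :* d :- b :* c) :* y := (x :* c :+ (y :* d :+ con 0ℚ)) :* a :- (x :* a :+ (y :* b :+ con 0ℚ)) :* c) refl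
        (entry A i j) (entry A i l) (entry A k j) (entry A k l) (c zero) (c (suc zero)))
      (zero-combination (h k) (h i)))

  -- Cramer's rule for three columns: D times a coefficient is the sum of the equations in rows i, k
  -- and q, weighted by the cofactors of the corresponding column.
  dependent⇒dets : ∀ {m n} (A : Matrix m n) → (∀ (g : Fin 3 → Fin n) → ¬ ColsIndep A g) → ZeroDets (entry A)
  dependent⇒dets {m} {n} A dep i k q j l c′ = decidable-stable (D ℚ.≟ 0ℚ) λ D≢0 → dep g (independent D≢0)
    where
    open +-*-Solver
    F = entry A
    D = cross (column F i k q j) (column F i k q l) ∙ column F i k q c′
    g : Fin 3 → Fin n
    g zero = j
    g (suc zero) = l
    g (suc (suc _)) = c′
    zero-combination : ∀ {x y z r s t} → x ≡ 0ℚ → y ≡ 0ℚ → z ≡ 0ℚ → x * r + y * s + z * t ≡ 0ℚ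
    zero-combination {r = r} {s} {t} refl refl refl = solve 3 (λ r s t → con 0ℚ :* r :+ con 0ℚ :* s :+ con 0ℚ :* t := con 0ℚ) refl r s t
    independent : D ≢ 0ℚ → ColsIndep A g
    independent D≢0 x h zero = *≡0⇒ {D} D≢0 (trans (solve 12 (λ a d g b e h c f i x y z →
        ((d :* h :- e :* g) :* c :+ (b :* g :- a :* h) :* f :+ (a :* e :- b :* d) :* i) :* x :=
        (x :* a :+ (y :* b :+ (z :* c :+ con 0ℚ))) :* (e :* i :- f :* h) :+ (x :* d :+ (y :* e :+ (z :* f :+ con 0ℚ))) :* (c :* h :- b :* i)
          :+ (x :* g :+ (y :* h :+ (z :* i :+ con 0ℚ))) :* (b :* f :- c :* e)) refl
        (F i j) (F k j) (F q j) (F i l) (F k l) (F q l) (F i c′) (F k c′) (F q c′) (x zero) (x (suc zero)) (x (suc (suc zero))))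
      (zero-combination (h i) (h k) (h q)))
    independent D≢0 x h (suc zero) = *≡0⇒ {D} D≢0 (trans (solve 12 (λ a d g b e h c f i x y z →
        ((d :* h :- e :* g) :* c :+ (b :* g :- a :* h) :* f :+ (a :* e :- b :* d) :* i) :* y :=
        (x :* a :+ (y :* b :+ (z :* c :+ con 0ℚ))) :* (f :* g :- d :* i) :+ (x :* d :+ (y :* e :+ (z :* f :+ con 0ℚ))) :* (a :* i :- c :* g)
          :+ (x :* g :+ (y :* h :+ (z :* i :+ con 0ℚ))) :* (c :* d :- a :* f)) refl
        (F i j) (F k j) (F q j) (F i l) (F k l) (F q l) (F i c′) (F k c′) (F q c′) (x zero) (x (suc zero)) (x (suc (suc zero))))
      (zero-combination (h i) (h k) (h q)))
    independent D≢0 x h (suc (suc zero)) = *≡0⇒ {D} D≢0 (trans (solve 12 (λ a d g b e h c f i x y z →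
        ((d :* h :- e :* g) :* c :+ (b :* g :- a :* h) :* f :+ (a :* e :- b :* d) :* i) :* z :=
        (x :* a :+ (y :* b :+ (z :* c :+ con 0ℚ))) :* (d :* h :- e :* g) :+ (x :* d :+ (y :* e :+ (z :* f :+ con 0ℚ))) :* (b :* g :- a :* h)
          :+ (x :* g :+ (y :* h :+ (z :* i :+ con 0ℚ))) :* (a :* e :- b :* d)) refl
        (F i j) (F k j) (F q j) (F i l) (F k l) (F q l) (F i c′) (F k c′) (F q c′) (x zero) (x (suc zero)) (x (suc (suc zero))))
      (zero-combination (h i) (h k) (h q)))

  L : (m n r : ℕ) → ℕ → ⊤ → Matrix m n → Set
  L m n r H _ A = InL m n r H A

  bdo-rank-one : ∀ {m n} → m ≤ n → Bdo (L m n 1) (2 ℕ.* n)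
  bdo-rank-one {m} {n} m≤n = _ , bd-⊆ (λ { H i A _ _ → i , λ { B (eg , _ , dep) → eg , dependent⇒minors B dep } })
    (*-monoʳ-≤ 2 (≤-reflexive (m≤n⇒m⊔n≡n m≤n))) ≤-refl (proj₂ (bd-RankOne m n))

  -- Either the rows or the columns fall into two classes, or there are three pairwise
  -- nonproportional rows and three such columns, whose minors cannot vanish. The three inequalities
  -- are the costs of these cases in halves.
  bdo-rank-two : ∀ {m n} p → 2 ℕ.* ((m ℕ.⊔ n) ℕ.+ n) ≤ p → 2 ℕ.* ((n ℕ.⊔ m) ℕ.+ m) ≤ p → 12 ℕ.+ ((n ∸ 2) ℕ.* 2 ℕ.+ (m ∸ 3) ℕ.* 2) ≤ p → Bdo (L m n 2) p
  bdo-rank-two {m} {n} p p₁ p₂ p₃ = bdo-⊎ {P = RowClasses} {Q = λ H i A → ColumnClasses H i A ⊎ HasCore H i A} split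
    (_ , bd-weaken p₁ ≤-refl (proj₂ (bdo-TwoClasses m n _ (classes≤ n))))
    (bdo-⊎ {P = ColumnClasses} {Q = HasCore} (λ _ _ _ _ q → q)
      (_ , bd-weaken p₂ ≤-refl
        (bd-inj _≟ᵐ_ (λ _ → transposed) id (λ _ _ _ _ q → q) (λ _ _ A B _ _ _ → transposed-injective A B) (proj₂ (bdo-TwoClasses n m _ (classes≤ m)))))
      (_ , bd-weaken p₃ ≤-refl bd-HasCore))
    where
    RowClasses ColumnClasses HasCore : ℕ → ⊤ → Matrix m n → Set
    RowClasses H _ A = Σ (Vec Bool m) λ b → AllEgyptian H A × TwoClasses b (Minors (entry A))
    ColumnClasses H _ A = Σ (Vec Bool n) λ b → AllEgyptian H (transposed A) × TwoClasses b (Minors (entry (transposed A)))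
    HasCore H _ A = Σ CoreIndex λ ι → Core H ι A
    bd-index : Bd {⊤} {CoreIndex {m} {n}} (λ _ _ _ → ⊤) 0 0
    bd-index = bd-⊆ (λ _ i _ _ _ → i , λ _ _ → _) ≤-refl ≤-refl
      (bd-× (Product.≡-dec Fin._≟_ (Product.≡-dec Fin._≟_ Fin._≟_)) (Product.≡-dec Fin._≟_ (Product.≡-dec Fin._≟_ Fin._≟_)) (fins m) (fins n))
      where
      fins : ∀ n → Bd {⊤} {Fin n × Fin n × Fin n} _ 0 0
      fins n = bd-× Fin._≟_ (Product.≡-dec Fin._≟_ Fin._≟_) (bd-Fin n) (bd-× Fin._≟_ Fin._≟_ (bd-Fin n) (bd-Fin n))
    bd-HasCore : Bd HasCore _ _
    bd-HasCore = bd-fibration {R = Core} (Product.≡-dec (Product.≡-dec Fin._≟_ (Product.≡-dec Fin._≟_ Fin._≟_)) (Product.≡-dec Fin._≟_ (Product.≡-dec Fin._≟_ Fin._≟_)))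
      (λ _ ι → ι) (λ { H _ A _ (ι , c) → ι , tt , c }) bd-index (proj₂ bd-Core)
    split : ∀ H i A → 1 ≤ H → L m n 2 H i A → RowClasses H i A ⊎ ColumnClasses H i A ⊎ HasCore H i A
    split H i A _ (eg , _ , dep) = rows (two-classes-or-triple m (minors? F) (minors-sym F) (minors-trans F λ i j → egyptian≢0 {H} (eg i j)))
      where
      F = entry A
      Fᵀ : Fin n → Fin m → ℚ
      Fᵀ j i = entry A i j
      dets = dependent⇒dets A dep
      Triple : ∀ m → (Fin m → Fin m → Set) → Set
      Triple m _~_ = Σ (Fin m × Fin m × Fin m) λ (i , k , l) → ¬ (i ~ k) × ¬ (i ~ l) × ¬ (k ~ l)
      columns : Triple m (Minors F) → (Σ (Vec Bool n) λ b → TwoClasses b (Minors Fᵀ)) ⊎ Triple n (Minors Fᵀ) → ColumnClasses H i A ⊎ HasCore H i A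
      columns _ (inj₁ (b , two)) = inj₁ (b , (λ j i → subst (IsEgyptian H) (sym (entry-transposed A i j)) (eg i j)) ,
          λ j l e i k → subst₂ _≡_ (sym (cong₂ _*_ (entry-transposed A i j) (entry-transposed A k l)))
            (sym (cong₂ _*_ (entry-transposed A k j) (entry-transposed A i l))) (two j l e i k))
      columns ((i₁ , i₂ , i₃) , i₁≁i₂ , i₁≁i₃ , i₂≁i₃) (inj₂ ((j₁ , j₂ , j₃) , j₁≁j₂ , j₁≁j₃ , j₂≁j₃)) = inj₂ (((i₁ , i₂ , i₃) , (j₁ , j₂ , j₃)) ,
          core eg dets (minor≢0 F dets i₂≁i₃ j₁≁j₂) (minor≢0 F dets i₁≁i₃ j₁≁j₂) (minor≢0 F dets i₁≁i₂ j₁≁j₂)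
            (minor≢0 F dets i₁≁i₂ j₂≁j₃) (minor≢0 F dets i₁≁i₂ j₁≁j₃))
      rows : (Σ (Vec Bool m) λ b → TwoClasses b (Minors F)) ⊎ Triple m (Minors F) → RowClasses H i A ⊎ ColumnClasses H i A ⊎ HasCore H i A
      rows (inj₁ (b , two)) = inj₁ (b , eg , two)
      rows (inj₂ t) = inj₂ (columns t (two-classes-or-triple n (minors? Fᵀ) (minors-sym Fᵀ) (minors-trans Fᵀ λ j i → egyptian≢0 {H} (eg i j))))

  -- Linear algebra over ℚ

  Σ-cong : ∀ n {f g : Fin n → ℚ} → (∀ i → f i ≡ g i) → Σℚ n f ≡ Σℚ n g
  Σ-cong zero h = refl
  Σ-cong (suc n) h = cong₂ _+_ (h zero) (Σ-cong n (h ∘ suc))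

  Σ-0 : ∀ n {f : Fin n → ℚ} → (∀ i → f i ≡ 0ℚ) → Σℚ n f ≡ 0ℚ
  Σ-0 zero h = refl
  Σ-0 (suc n) {f} h = trans (cong₂ _+_ (h zero) (Σ-0 n (h ∘ suc))) (ℚ.+-identityˡ 0ℚ)

  Σ-+ : ∀ n (f g : Fin n → ℚ) → Σℚ n (λ i → f i + g i) ≡ Σℚ n f + Σℚ n g
  Σ-+ zero f g = refl
  Σ-+ (suc n) f g = trans (cong (λ z → f zero + g zero + z) (Σ-+ n (f ∘ suc) (g ∘ suc)))
    (solve 4 (λ a b c d → a :+ b :+ (c :+ d) := a :+ c :+ (b :+ d)) refl (f zero) (g zero) (Σℚ n (f ∘ suc)) (Σℚ n (g ∘ suc)))
    where open +-*-Solver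

  Σ-*ʳ : ∀ n (f : Fin n → ℚ) c → Σℚ n (λ i → f i * c) ≡ Σℚ n f * c
  Σ-*ʳ zero f c = sym (ℚ.*-zeroˡ c)
  Σ-*ʳ (suc n) f c = trans (cong (λ z → f zero * c + z) (Σ-*ʳ n (f ∘ suc) c)) (sym (ℚ.*-distribʳ-+ c (f zero) (Σℚ n (f ∘ suc))))

  Σ-*ˡ : ∀ n c (f : Fin n → ℚ) → Σℚ n (λ i → c * f i) ≡ c * Σℚ n f
  Σ-*ˡ n c f = trans (Σ-cong n (λ i → ℚ.*-comm c (f i))) (trans (Σ-*ʳ n f c) (ℚ.*-comm (Σℚ n f) c))

  Σ-swap : ∀ m n (f : Fin m → Fin n → ℚ) → Σℚ m (λ i → Σℚ n (f i)) ≡ Σℚ n (λ j → Σℚ m (λ i → f i j))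
  Σ-swap zero n f = sym (Σ-0 n (λ _ → refl))
  Σ-swap (suc m) n f = trans (cong (λ z → Σℚ n (f zero) + z) (Σ-swap m n (f ∘ suc))) (sym (Σ-+ n (f zero) (λ j → Σℚ m (λ i → f (suc i) j))))

  point : ∀ {n} → Fin n → ℚ → Fin n → ℚ
  point p s k = if does (k Fin.≟ p) then s else 0ℚ

  point-≢ : ∀ {n} {p k : Fin n} s → k ≢ p → point p s k ≡ 0ℚ
  point-≢ {p = p} {k} s k≢p = cong (if_then s else 0ℚ) (dec-false (k Fin.≟ p) k≢p)

  point-≡ : ∀ {n} (p : Fin n) s → point p s p ≡ s
  point-≡ p s = cong (if_then s else 0ℚ) (dec-true (p Fin.≟ p) refl)

  Σ-point : ∀ n (p : Fin n) s (f : Fin n → ℚ) → Σℚ n (λ k → point p s k * f k) ≡ s * f p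
  Σ-point (suc n) zero s f = trans (cong (λ z → s * f zero + z) (Σ-0 n (λ i → ℚ.*-zeroˡ (f (suc i))))) (ℚ.+-identityʳ (s * f zero))
  Σ-point (suc n) (suc p) s f = trans (cong₂ _+_ (ℚ.*-zeroˡ (f zero)) (trans (Σ-cong n step) (Σ-point n p s (f ∘ suc)))) (ℚ.+-identityˡ (s * f (suc p)))
    where
    step : ∀ k → point (suc p) s (suc k) * f (suc k) ≡ point p s k * f (suc k)
    step k with k Fin.≟ p
    ... | yes _ = refl
    ... | no _ = refl

  Σ-eliminate : ∀ n (c f u : Fin n → ℚ) v → Σℚ n (λ k → c k * (u k - f k * v)) ≡ Σℚ n (λ k → c k * u k) - Σℚ n (λ k → c k * f k) * v
  Σ-eliminate n c f u v = begin
    Σℚ n (λ k → c k * (u k - f k * v)) ≡⟨ Σ-cong n (λ k → solve 4 (λ c u f v → c :* (u :- f :* v) := c :* u :+ c :* f :* (:- v)) refl (c k) (u k) (f k) v) ⟩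
    Σℚ n (λ k → c k * u k + c k * f k * (- v)) ≡⟨ Σ-+ n (λ k → c k * u k) (λ k → c k * f k * (- v)) ⟩
    Σℚ n (λ k → c k * u k) + Σℚ n (λ k → c k * f k * (- v)) ≡⟨ cong (λ z → Σℚ n (λ k → c k * u k) + z) (Σ-*ʳ n (λ k → c k * f k) (- v)) ⟩
    Σℚ n (λ k → c k * u k) + Σℚ n (λ k → c k * f k) * (- v) ≡⟨ solve 3 (λ s t v → s :+ t :* (:- v) := s :- t :* v) refl (Σℚ n (λ k → c k * u k)) (Σℚ n (λ k → c k * f k)) v ⟩
    Σℚ n (λ k → c k * u k) - Σℚ n (λ k → c k * f k) * v ∎
    where
    open ≡-Reasoning
    open +-*-Solver

  countT-set≤ : ∀ {n} (b : Vec Bool n) j → countT (b ⟨ j ⟩) ≤ suc (countT b)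
  countT-set≤ (true ∷ b) zero = n≤1+n _
  countT-set≤ (false ∷ b) zero = ≤-refl
  countT-set≤ (true ∷ b) (suc j) = s≤s (countT-set≤ b j)
  countT-set≤ (false ∷ b) (suc j) = countT-set≤ b j

  lookup-set-false : ∀ {n} (b : Vec Bool n) j i → lookup (b ⟨ j ⟩) i ≡ false → i ≢ j × lookup b i ≡ false
  lookup-set-false b j i e = i≢j , trans (sym (Vec.lookup∘update′ i≢j b true)) e
    where
    i≢j : i ≢ j
    i≢j refl = case trans (sym (Vec.lookup∘updateAt j b)) e of λ ()

  module _ {N : ℕ} where

    Spans : ∀ {m} → (Fin N → Fin m → ℚ) → ℕ → ℕ → Vec Bool N → Fin N → Set
    Spans V G H h i = Σ (Fin N → ℚ) λ ρ → (∀ k → lookup h k ≡ false → ρ k ≡ 0ℚ) × (∀ k → Ht G H (ρ k)) ×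
      (∀ j → V i j ≡ Σℚ N (λ k → ρ k * V k j))

    Independent : ∀ {m r} → (Fin N → Fin m → ℚ) → (Fin r → Fin N) → Set
    Independent {r = r} V g = ∀ (c : Fin r → ℚ) → (∀ j → Σℚ r (λ k → c k * V (g k) j) ≡ 0ℚ) → ∀ k → c k ≡ 0ℚ

    -- Follows one elimination step: the reduced entries have height 1 + B + 3B, a multiplier has
    -- height 2B, and the coefficient of the pivot is a multiplier minus a sum of N products. The
    -- maximum covers a column of zeros, where nothing is eliminated.
    spanHeight : ℕ → ℕ → ℕ
    spanHeight zero B = 0
    spanHeight (suc m) B = let G = spanHeight m (suc (B ℕ.+ (B ℕ.+ B ℕ.+ B))) in
      suc (G ℕ.+ suc (B ℕ.+ B ℕ.+ N ℕ.* suc (G ℕ.+ (B ℕ.+ B)))) ℕ.⊔ spanHeight m B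

    module _ {H : ℕ} (1≤H : 1 ≤ H) where

      -- Gaussian elimination, one coordinate at a time, with r as a budget of pivots. If the budget
      -- suffices, the pivots span everything with controlled heights; otherwise one pivot too many
      -- yields independent vectors. Each pivot uses up a coordinate in `b`, hence the bound r <
      -- `countT b`.
      span-or-independent : ∀ m r B (V : Fin N → Fin m → ℚ) (b : Vec Bool m) → (∀ i j → Ht B H (V i j)) →
        (∀ i j → lookup b j ≡ false → V i j ≡ 0ℚ) →
        (Σ (Vec Bool N) λ h → countT h ≤ r × (∀ i → Spans V (spanHeight m B) H h i)) ⊎
        (Σ (Fin (suc r) → Fin N) λ g → r < countT b × Independent V g)
      span-or-independent zero r B V b hts off = inj₁ (empty N , subst (_≤ r) (sym (countT-empty N)) z≤n ,
        λ i → (λ _ → 0ℚ) , (λ _ _ → refl) , (λ _ → ht-0 1≤H) , λ ())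
      span-or-independent (suc m) r B V (b₀ ∷ b) hts off = pivot (Fin.any? λ i → ¬? (V i zero ℚ.≟ 0ℚ))
        where
        open +-*-Solver
        open ≡-Reasoning
        Result : Set
        Result = (Σ (Vec Bool N) λ h → countT h ≤ r × (∀ i → Spans V (spanHeight (suc m) B) H h i)) ⊎
          (Σ (Fin (suc r) → Fin N) λ g → r < countT (b₀ ∷ b) × Independent V g)
        countT-tail : countT b ≤ countT (b₀ ∷ b)
        countT-tail = go b₀
          where
          go : ∀ b₀ → countT b ≤ countT (b₀ ∷ b)
          go true = n≤1+n _
          go false = ≤-refl
        zero-column : (∀ i → V i zero ≡ 0ℚ) → Result
        zero-column V₀ = case span-or-independent m r B (λ i j → V i (suc j)) b (λ i j → hts i (suc j)) (λ i j → off i (suc j)) of λ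
          { (inj₁ (h , h≤ , spans)) → inj₁ (h , h≤ , λ i → let (ρ , supp , ρ-ht , e) = spans i in ρ , supp ,
              (λ k → ht-mono 1≤H (m≤n⊔m _ (spanHeight m B)) (ρ-ht k)) ,
              λ { zero → trans (V₀ i) (sym (Σ-0 N λ k → trans (cong (ρ k *_) (V₀ k)) (ℚ.*-zeroʳ (ρ k)))) ; (suc j) → e j })
          ; (inj₂ (g , r< , indep)) → inj₂ (g , ≤-trans r< countT-tail , λ c e → indep c (e ∘ suc)) }
        module Pivot (p : Fin N) (Vp≢0 : V p zero ≢ 0ℚ) where
          q = proj₁ (recip (V p zero) Vp≢0)
          Vp*q : V p zero * q ≡ 1ℚ
          Vp*q = proj₂ (recip (V p zero) Vp≢0)
          f : Fin N → ℚ
          f i = V i zero * q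
          f*Vp : ∀ i → f i * V p zero ≡ V i zero
          f*Vp i = trans (solve 3 (λ v q w → v :* q :* w := v :* (w :* q)) refl (V i zero) q (V p zero)) (trans (cong (V i zero *_) Vp*q) (ℚ.*-identityʳ (V i zero)))
          V′ : Fin N → Fin m → ℚ
          V′ i j = V i (suc j) - f i * V p (suc j)
          f-ht : ∀ i → Ht (B ℕ.+ B) H (f i)
          f-ht i = ht-* 1≤H (hts i zero) (ht-recip 1≤H Vp≢0 Vp*q (hts p zero))
          B′ = suc (B ℕ.+ (B ℕ.+ B ℕ.+ B))
          G = spanHeight m B′
          V′-ht : ∀ i j → Ht B′ H (V′ i j)
          V′-ht i j = ht-− 1≤H (hts i (suc j)) (ht-* 1≤H (f-ht i) (hts p (suc j)))
          V′-off : ∀ i j → lookup b j ≡ false → V′ i j ≡ 0ℚ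
          V′-off i j e = trans (cong₂ (λ u v → u - f i * v) (off i (suc j) e) (off p (suc j) e)) (solve 1 (λ f → con 0ℚ :- f :* con 0ℚ := con 0ℚ) refl (f i))
          countT-b : suc (countT b) ≡ countT (b₀ ∷ b)
          countT-b = go b₀ refl
            where
            go : ∀ b′ → b′ ≡ b₀ → suc (countT b) ≡ countT (b′ ∷ b)
            go true _ = refl
            go false e = ⊥-elim (Vp≢0 (off p zero (sym e)))
          single : Independent {r = 1} V (λ _ → p)
          single c e zero = *≡0⇒ Vp≢0 (trans (ℚ.*-comm (V p zero) (c zero)) (trans (sym (ℚ.+-identityʳ (c zero * V p zero))) (e zero)))
          extend-span : ∀ {h} → (∀ i → Spans V′ G H h i) → ∀ i → Spans V (spanHeight (suc m) B) H (h ⟨ p ⟩) i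
          extend-span {h} spans i = ρ , supp , (λ k → ht-mono 1≤H (m≤m⊔n _ (spanHeight m B)) (ρ-ht k)) , span
            where
            ρ′ = proj₁ (spans i)
            supp′ = proj₁ (proj₂ (spans i))
            ρ′-ht = proj₁ (proj₂ (proj₂ (spans i)))
            span′ = proj₂ (proj₂ (proj₂ (spans i)))
            t = Σℚ N (λ k → ρ′ k * f k)
            -- A vector is its reduction plus f times the pivot vector. Restoring this in the
            -- combination ρ′ leaves the pivot with coefficient f i minus the multipliers already
            -- used.
            s = f i - t
            ρ : Fin N → ℚ
            ρ k = ρ′ k + point p s k
            supp : ∀ k → lookup (h ⟨ p ⟩) k ≡ false → ρ k ≡ 0ℚ
            supp k e = let (k≢p , e′) = lookup-set-false h p k e in trans (cong₂ _+_ (supp′ k e′) (point-≢ s k≢p)) (ℚ.+-identityˡ 0ℚ)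
            s-ht : Ht (suc (B ℕ.+ B ℕ.+ N ℕ.* suc (G ℕ.+ (B ℕ.+ B)))) H s
            s-ht = ht-− 1≤H (f-ht i) (ht-Σ 1≤H N (λ k → ht-* 1≤H (ρ′-ht k) (f-ht k)))
            point-ht : ∀ k → Ht (suc (B ℕ.+ B ℕ.+ N ℕ.* suc (G ℕ.+ (B ℕ.+ B)))) H (point p s k)
            point-ht k = go (does (k Fin.≟ p))
              where
              go : ∀ b → Ht (suc (B ℕ.+ B ℕ.+ N ℕ.* suc (G ℕ.+ (B ℕ.+ B)))) H (if b then s else 0ℚ)
              go true = s-ht
              go false = ht-mono 1≤H z≤n (ht-0 1≤H)
            ρ-ht : ∀ k → Ht (suc (G ℕ.+ suc (B ℕ.+ B ℕ.+ N ℕ.* suc (G ℕ.+ (B ℕ.+ B))))) H (ρ k)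
            ρ-ht k = ht-+ 1≤H (ρ′-ht k) (point-ht k)
            Σρ : ∀ j → Σℚ N (λ k → ρ k * V k j) ≡ Σℚ N (λ k → ρ′ k * V k j) + s * V p j
            Σρ j = trans (Σ-cong N (λ k → ℚ.*-distribʳ-+ (V k j) (ρ′ k) (point p s k))) (trans (Σ-+ N (λ k → ρ′ k * V k j) (λ k → point p s k * V k j))
              (cong (λ z → Σℚ N (λ k → ρ′ k * V k j) + z) (Σ-point N p s (λ k → V k j))))
            span : ∀ j → V i j ≡ Σℚ N (λ k → ρ k * V k j)
            span zero = sym (begin
              Σℚ N (λ k → ρ k * V k zero) ≡⟨ Σρ zero ⟩
              Σℚ N (λ k → ρ′ k * V k zero) + s * V p zero ≡⟨ cong (λ z → z + s * V p zero) (Σ-cong N (λ k → trans (cong (ρ′ k *_) (sym (f*Vp k))) (sym (ℚ.*-assoc (ρ′ k) (f k) (V p zero))))) ⟩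
              Σℚ N (λ k → ρ′ k * f k * V p zero) + s * V p zero ≡⟨ cong (λ z → z + s * V p zero) (Σ-*ʳ N (λ k → ρ′ k * f k) (V p zero)) ⟩
              t * V p zero + s * V p zero ≡⟨ solve 3 (λ t f v → t :* v :+ (f :- t) :* v := f :* v) refl t (f i) (V p zero) ⟩
              f i * V p zero ≡⟨ f*Vp i ⟩
              V i zero ∎)
            span (suc j) = sym (begin
              Σℚ N (λ k → ρ k * V k (suc j)) ≡⟨ Σρ (suc j) ⟩
              Σℚ N (λ k → ρ′ k * V k (suc j)) + s * V p (suc j) ≡⟨ solve 4 (λ u t f v → u :+ (f :- t) :* v := (u :- t :* v) :+ f :* v) refl (Σℚ N (λ k → ρ′ k * V k (suc j))) t (f i) (V p (suc j)) ⟩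
              Σℚ N (λ k → ρ′ k * V k (suc j)) - t * V p (suc j) + f i * V p (suc j)
                ≡⟨ cong (λ z → z + f i * V p (suc j)) (sym (Σ-eliminate N ρ′ f (λ k → V k (suc j)) (V p (suc j)))) ⟩
              Σℚ N (λ k → ρ′ k * V′ k j) + f i * V p (suc j) ≡⟨ cong (λ z → z + f i * V p (suc j)) (sym (span′ j)) ⟩
              V′ i j + f i * V p (suc j) ≡⟨ solve 2 (λ v w → v :- w :+ w := v) refl (V i (suc j)) (f i * V p (suc j)) ⟩
              V i (suc j) ∎)
          extend-independent : ∀ {r} {g : Fin r → Fin N} (g⁺ : Fin (suc r) → Fin N) → g⁺ zero ≡ p → (∀ k → g⁺ (suc k) ≡ g k) → Independent V′ g → Independent V g⁺
          extend-independent {r} {g} g⁺ g₀ gₛ indep c e = λ { zero → c₀ ; (suc k) → cₛ k }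
            where
            t = Σℚ r (λ k → c (suc k) * f (g k))
            e′ : ∀ j → c zero * V p j + Σℚ r (λ k → c (suc k) * V (g k) j) ≡ 0ℚ
            e′ j = trans (sym (cong₂ _+_ (cong (λ i → c zero * V i j) g₀) (Σ-cong r (λ k → cong (λ i → c (suc k) * V i j) (gₛ k))))) (e j)
            -- In the first coordinate every vector is its multiplier times the pivot entry, which
            -- can be cancelled.
            total : c zero + t ≡ 0ℚ
            total = *≡0⇒ Vp≢0 (begin
              V p zero * (c zero + t) ≡⟨ solve 3 (λ v c t → v :* (c :+ t) := c :* v :+ t :* v) refl (V p zero) (c zero) t ⟩
              c zero * V p zero + t * V p zero ≡⟨ cong (λ z → c zero * V p zero + z) (sym (Σ-*ʳ r (λ k → c (suc k) * f (g k)) (V p zero))) ⟩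
              c zero * V p zero + Σℚ r (λ k → c (suc k) * f (g k) * V p zero)
                ≡⟨ cong (λ z → c zero * V p zero + z) (Σ-cong r (λ k → trans (ℚ.*-assoc (c (suc k)) (f (g k)) (V p zero)) (cong (c (suc k) *_) (f*Vp (g k))))) ⟩
              c zero * V p zero + Σℚ r (λ k → c (suc k) * V (g k) zero) ≡⟨ e′ zero ⟩
              0ℚ ∎)
            cₛ : ∀ k → c (suc k) ≡ 0ℚ
            cₛ = indep (c ∘ suc) λ j → begin
              Σℚ r (λ k → c (suc k) * V′ (g k) j) ≡⟨ Σ-eliminate r (c ∘ suc) (f ∘ g) (λ k → V (g k) (suc j)) (V p (suc j)) ⟩
              Σℚ r (λ k → c (suc k) * V (g k) (suc j)) - t * V p (suc j)
                ≡⟨ solve 4 (λ u t c v → u :- t :* v := (c :* v :+ u) :- (c :+ t) :* v) refl (Σℚ r (λ k → c (suc k) * V (g k) (suc j))) t (c zero) (V p (suc j)) ⟩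
              (c zero * V p (suc j) + Σℚ r (λ k → c (suc k) * V (g k) (suc j))) - (c zero + t) * V p (suc j)
                ≡⟨ cong₂ (λ u v → u - v * V p (suc j)) (e′ (suc j)) total ⟩
              0ℚ - 0ℚ * V p (suc j)
                ≡⟨ solve 1 (λ v → con 0ℚ :- con 0ℚ :* v := con 0ℚ) refl (V p (suc j)) ⟩
              0ℚ ∎
            c₀ : c zero ≡ 0ℚ
            c₀ = trans (sym (ℚ.+-identityʳ (c zero))) (trans (cong (λ z → c zero + z) (sym (Σ-0 r λ k → trans (cong (_* f (g k)) (cₛ k)) (ℚ.*-zeroˡ (f (g k)))))) total)
          recurse : ∀ r′ → r′ ≡ r → Result
          -- With no budget left, the pivot alone is the required family of one independent vector.
          recurse zero refl = inj₂ ((λ _ → p) , subst (0 <_) countT-b (s≤s z≤n) , single)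
          recurse (suc r′) refl = case span-or-independent m r′ B′ V′ b V′-ht V′-off of λ
            { (inj₁ (h , h≤ , spans)) → inj₁ (h ⟨ p ⟩ , ≤-trans (countT-set≤ h p) (s≤s h≤) , extend-span {h} spans)
            ; (inj₂ (g , r< , indep)) → inj₂ (cons g , subst (suc r′ <_) countT-b (s≤s r<) , extend-independent {g = g} (cons g) refl (λ _ → refl) indep) }
            where
            cons : (Fin (suc r′) → Fin N) → Fin (suc (suc r′)) → Fin N
            cons g zero = p
            cons g (suc k) = g k
        pivot : Dec (Σ (Fin N) λ i → ¬ V i zero ≡ 0ℚ) → Result
        pivot (no none) = zero-column λ i → decidable-stable (V i zero ℚ.≟ 0ℚ) (λ ne → none (i , ne))
        pivot (yes (p , Vp≢0)) = Pivot.recurse p Vp≢0 r refl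

  -- A spanning set may have fewer than r members, whereas the counts are made for masks with
  -- exactly r; adding members keeps it spanning.
  pad : ∀ {n} (b : Vec Bool n) r → countT b ≤ r → r ≤ n → Σ (Vec Bool n) λ b′ → countT b′ ≡ r × (∀ k → lookup b′ k ≡ false → lookup b k ≡ false)
  pad [] zero _ _ = [] , refl , λ ()
  pad (true ∷ b) (suc r) (s≤s b≤r) (s≤s r≤n) = let (b′ , e , sub) = pad b r b≤r r≤n in true ∷ b′ , cong suc e , λ { zero () ; (suc k) → sub k }
  pad {suc n} (false ∷ b) r b≤r r≤n = case m≤n⇒m<n∨m≡n r≤n of λ
    { (inj₁ (s≤s r≤n′)) → let (b′ , e , sub) = pad b r b≤r r≤n′ in false ∷ b′ , e , λ { zero _ → refl ; (suc k) → sub k }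
    ; (inj₂ refl) → let (b′ , e , sub) = pad b n (countT≤ b) ≤-refl in true ∷ b′ , cong suc e , λ { zero () ; (suc k) → sub k } }

  countT-unset : ∀ {n} (b : Vec Bool n) j → lookup b j ≡ true → suc (countT (b Vec.[ j ]≔ false)) ≡ countT b
  countT-unset (true ∷ b) zero _ = refl
  countT-unset (true ∷ b) (suc j) e = cong suc (countT-unset b j e)
  countT-unset (false ∷ b) (suc j) e = countT-unset b j e

  -- The offset `w` makes induction possible: once a coordinate has been fixed, the remaining ones
  -- range over a translate of a smaller span.
  AffineSpan : ∀ {M n} → (Fin n → ℚ → Set) → (Fin n → ℚ) → (Fin M → Fin n → ℚ) → Vec Bool M → Vec ℚ n → Set
  AffineSpan {M} E w V T x = (∀ j → E j (lookup x j)) × Σ (Fin M → ℚ) λ c → (∀ l → lookup T l ≡ false → c l ≡ 0ℚ) ×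
    (∀ j → lookup x j ≡ w j + Σℚ M (λ l → c l * V l j))

  -- Fixing one more coordinate of x on which some vector in the span is nonzero drops the dimension by one.
  card-AffineSpan : ∀ {M} κ S → 1 ≤ S → ∀ n (E : Fin n → ℚ → Set) → (∀ j → Card (E j) (suc κ) S) → (w : Fin n → ℚ) (V : Fin M → Fin n → ℚ) (T : Vec Bool M) →
    Card (AffineSpan E w V T) (suc κ) (S ^ countT T)
  card-AffineSpan κ S 1≤S zero E cE w V T = card-mono (1≤^ S (countT T) 1≤S) (card-subsingleton λ { [] [] _ _ → refl })
  card-AffineSpan {M} κ S 1≤S (suc n) E cE w V T = go (Fin.any? λ p → (lookup T p Bool.≟ true) ×-dec ¬? (V p zero ℚ.≟ 0ℚ))
    where
    open +-*-Solver
    go : Dec (Σ (Fin M) λ p → lookup T p ≡ true × ¬ V p zero ≡ 0ℚ) → Card (AffineSpan E w V T) (suc κ) (S ^ countT T)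
    -- No vector on `T` moves the first coordinate, which is therefore equal to `w zero` and costs
    -- nothing.
    go (no none) = card-inj _≟ᵛ_ Vec.tail (λ { (x ∷ xs) (e , c , supp , h) → e ∘ suc , c , supp , h ∘ suc })
      (λ { (x ∷ xs) (y ∷ ys) (_ , c , supp , h) (_ , c′ , supp′ , h′) refl → cong (_∷ xs) (trans (trans (h zero) (cong (λ z → w zero + z) (vanish c supp)))
        (sym (trans (h′ zero) (cong (λ z → w zero + z) (vanish c′ supp′))))) })
      (card-AffineSpan κ S 1≤S n (E ∘ suc) (cE ∘ suc) (w ∘ suc) (λ l j → V l (suc j)) T)
      where
      vanish : ∀ c → (∀ l → lookup T l ≡ false → c l ≡ 0ℚ) → Σℚ M (λ l → c l * V l zero) ≡ 0ℚ
      vanish c supp = Σ-0 M λ l → term l (lookup T l) refl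
        where
        term : ∀ l t → lookup T l ≡ t → c l * V l zero ≡ 0ℚ
        term l true e = trans (cong (c l *_) (decidable-stable (V l zero ℚ.≟ 0ℚ) (λ ne → none (l , e , ne)))) (ℚ.*-zeroʳ (c l))
        term l false e = trans (cong (_* V l zero) (supp l e)) (ℚ.*-zeroˡ (V l zero))
    go (yes (p , Tp , Vp≢0)) = subst (λ z → Card (AffineSpan E w V T) (suc κ) (S ^ z)) (countT-unset T p Tp)
      (fibration {R = λ y x → lookup x zero ≡ y × AffineSpan (E ∘ suc) (w′ y) V′ T′ (Vec.tail x)} ℚ._≟_
        (λ { (x ∷ xs) (e , c , supp , h) → x , e zero , refl , e ∘ suc , drop c , drop-supp c supp , λ j → tail-span x (lookup xs j) c j (h zero) (h (suc j)) })
        (cE zero)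
        (λ y _ → card-inj _≟ᵛ_ Vec.tail (λ { (x ∷ xs) (_ , a) → a }) (λ { (x ∷ xs) (.x ∷ .xs) (refl , _) (refl , _) refl → refl })
          (card-AffineSpan κ S 1≤S n (E ∘ suc) (cE ∘ suc) (w′ y) V′ T′)))
      where
      q = proj₁ (recip (V p zero) Vp≢0)
      f : Fin M → ℚ
      f l = V l zero * q
      V′ : Fin M → Fin n → ℚ
      V′ l j = V l (suc j) - f l * V p (suc j)
      w′ : ℚ → Fin n → ℚ
      -- When the first coordinate is y, the sum of the c l * f l must be (y - w zero) * q, so the
      -- multiple of the pivot vector is known and joins the offset.
      w′ y j = w (suc j) + (y - w zero) * q * V p (suc j)
      T′ = T Vec.[ p ]≔ false
      drop : (Fin M → ℚ) → Fin M → ℚ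
      drop c l = if does (l Fin.≟ p) then 0ℚ else c l
      drop-dec : ∀ {P : ℚ → Set} c l → (l ≡ p → P 0ℚ) → (l ≢ p → P (c l)) → P (drop c l)
      drop-dec {P} c l y n = dec-case (l Fin.≟ p)
        where
        dec-case : ∀ d → P (if does d then 0ℚ else c l)
        dec-case (yes e) = y e
        dec-case (no ne) = n ne
      drop-supp : ∀ c → (∀ l → lookup T l ≡ false → c l ≡ 0ℚ) → ∀ l → lookup T′ l ≡ false → drop c l ≡ 0ℚ
      drop-supp c supp l e = drop-dec {_≡ 0ℚ} c l (λ _ → refl) (λ l≢p → supp l (trans (sym (Vec.lookup∘update′ l≢p T false)) e))
      V′p≡0 : ∀ j → V′ p j ≡ 0ℚ
      V′p≡0 j = trans (cong (λ u → V p (suc j) - u * V p (suc j)) (proj₂ (recip (V p zero) Vp≢0))) (solve 1 (λ v → v :- con 1ℚ :* v := con 0ℚ) refl (V p (suc j)))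
      drop-term : ∀ c j l → c l * V′ l j ≡ drop c l * V′ l j
      drop-term c j l = drop-dec {λ u → c l * V′ l j ≡ u * V′ l j} c l
        (λ { refl → trans (cong (c p *_) (V′p≡0 j)) (trans (ℚ.*-zeroʳ (c p)) (sym (ℚ.*-zeroˡ (V′ p j)))) }) (λ _ → refl)
      tail-span : ∀ x₀ x c j → x₀ ≡ w zero + Σℚ M (λ l → c l * V l zero) → x ≡ w (suc j) + Σℚ M (λ l → c l * V l (suc j)) →
        x ≡ w′ x₀ j + Σℚ M (λ l → drop c l * V′ l j)
      tail-span x₀ x c j e₀ e = begin
        x ≡⟨ e ⟩
        w (suc j) + u ≡⟨ solve 5 (λ w₀ w u t v → w :+ u := (w :+ t :* v) :+ (u :- t :* v)) refl (w zero) (w (suc j)) u t (V p (suc j)) ⟩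
        (w (suc j) + t * V p (suc j)) + (u - t * V p (suc j)) ≡⟨ cong₂ (λ a b → w (suc j) + a * V p (suc j) + b) t≡ (sym (Σ-eliminate M c f (λ l → V l (suc j)) (V p (suc j)))) ⟩
        w′ x₀ j + Σℚ M (λ l → c l * V′ l j) ≡⟨ cong (λ z → w′ x₀ j + z) (Σ-cong M (drop-term c j)) ⟩
        w′ x₀ j + Σℚ M (λ l → drop c l * V′ l j) ∎
        where
        open ≡-Reasoning
        u = Σℚ M (λ l → c l * V l (suc j))
        t = Σℚ M (λ l → c l * f l)
        s = Σℚ M (λ l → c l * V l zero)
        t≡ : t ≡ (x₀ - w zero) * q
        t≡ = trans (Σ-cong M (λ l → sym (ℚ.*-assoc (c l) (V l zero) q))) (trans (Σ-*ʳ M (λ l → c l * V l zero) q)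
          (cong (_* q) (trans (solve 2 (λ s w → s := (w :+ s) :- w) refl s (w zero)) (cong (_- w zero) (sym e₀)))))

  -- Rank at least three

  mask : ∀ {n} → Vec Bool n → Vec ℚ n → Vec ℚ n
  mask b v = Vec.tabulate λ j → if lookup b j then lookup v j else 0ℚ

  lookup-mask : ∀ {n} (b : Vec Bool n) v j → lookup (mask b v) j ≡ (if lookup b j then lookup v j else 0ℚ)
  lookup-mask b v = Vec.lookup∘tabulate λ j → if lookup b j then lookup v j else 0ℚ

  lookup-mask-true : ∀ {n} (b : Vec Bool n) v j → lookup b j ≡ true → lookup (mask b v) j ≡ lookup v j
  lookup-mask-true b v j e = trans (lookup-mask b v j) (cong (if_then lookup v j else 0ℚ) e)

  lookup-mask-false : ∀ {n} (b : Vec Bool n) v j → lookup b j ≡ false → lookup (mask b v) j ≡ 0ℚ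
  lookup-mask-false b v j e = trans (lookup-mask b v j) (cong (if_then lookup v j else 0ℚ) e)

  -- Entries off the mask are zero rather than free: submatrices are kept as matrices of full size,
  -- padded with zeros.
  OnMask : ∀ {n} → ℕ → Vec Bool n → Vec ℚ n → Set
  OnMask H b v = ∀ j → (if lookup b j then IsEgyptian H else (_≡ 0ℚ)) (lookup v j)

  mask-OnMask : ∀ {n H} (b : Vec Bool n) v → (∀ j → lookup b j ≡ true → IsEgyptian H (lookup v j)) → OnMask H b (mask b v)
  mask-OnMask {H = H} b v eg j = subst (if lookup b j then IsEgyptian H else (_≡ 0ℚ)) (sym (lookup-mask b v j)) (go (lookup b j) (eg j))
    where
    go : ∀ c → (c ≡ true → IsEgyptian H (lookup v j)) → (if c then IsEgyptian H else (_≡ 0ℚ)) (if c then lookup v j else 0ℚ)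
    go true e = e refl
    go false _ = refl

  bd-0ℚ : ∀ {I : Set} → Bd {I} (λ _ _ → _≡ 0ℚ) 0 0
  bd-0ℚ = bd-subsingleton λ { _ _ _ _ _ refl refl → refl }

  bd-OnMask : ∀ {n} d → Bd {Vec Bool n} (λ H b v → countT b ≡ d × OnMask H b v) (d ℕ.* 2) 0
  bd-OnMask {n} d = bd-⊆ (λ H b v _ _ → (b , λ _ → tt) , λ _ q → q)
    (≤-reflexive (trans (cong (d ℕ.* 2 ℕ.+_) (*-zeroʳ (n ∸ d))) (+-identityʳ _)))
    (≤-reflexive (cong₂ ℕ._+_ (*-zeroʳ d) (*-zeroʳ (n ∸ d)))) (bd-Vec {⊤} {Q₀ = λ _ _ → _≡ 0ℚ} {Q₁ = λ H _ → IsEgyptian H} d ℚ._≟_ bd-0ℚ bd-Egyptian)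

  bd-BoolVec : ∀ {I : Set} n → Bd {I} {Vec Bool n} (λ _ _ _ → ⊤) 0 0
  bd-BoolVec n = bd-⊆ (λ _ i _ _ _ → i , λ _ _ _ → tt) (≤-reflexive (*-zeroʳ n)) (≤-reflexive (*-zeroʳ n)) (bd-Vec-all n Bool._≟_ bd-Bool)

  supp : ∀ {m} → (Fin m → ℚ) → Vec Bool m
  supp ρ = Vec.tabulate λ k → not (does (ρ k ℚ.≟ 0ℚ))

  supp-true : ∀ {m} (ρ : Fin m → ℚ) k → lookup (supp ρ) k ≡ true → ρ k ≢ 0ℚ
  supp-true ρ k e = go (ρ k ℚ.≟ 0ℚ) (trans (sym (Vec.lookup∘tabulate (λ k → not (does (ρ k ℚ.≟ 0ℚ))) k)) e)
    where
    go : (d : Dec (ρ k ≡ 0ℚ)) → not (does d) ≡ true → ρ k ≢ 0ℚ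
    go (no ne) _ = ne

  supp-false : ∀ {m} (ρ : Fin m → ℚ) k → lookup (supp ρ) k ≡ false → ρ k ≡ 0ℚ
  supp-false ρ k e = go (ρ k ℚ.≟ 0ℚ) (trans (sym (Vec.lookup∘tabulate (λ k → not (does (ρ k ℚ.≟ 0ℚ))) k)) e)
    where
    go : (d : Dec (ρ k ≡ 0ℚ)) → not (does d) ≡ false → ρ k ≡ 0ℚ
    go (yes e) _ = e

  bool-contra : ∀ {x : Bool} {A : Set} → x ≡ true → x ≡ false → A
  bool-contra refl ()

  _∖_ : ∀ {n} → Vec Bool n → Vec Bool n → Vec Bool n
  _∖_ = Vec.zipWith λ x y → x ∧ not y

  countT-∖ : ∀ {n} (b s : Vec Bool n) → (∀ k → lookup s k ≡ true → lookup b k ≡ true) → countT (b ∖ s) ℕ.+ countT s ≡ countT b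
  countT-∖ [] [] h = refl
  countT-∖ (true ∷ b) (true ∷ s) h = trans (+-suc _ _) (cong suc (countT-∖ b s (h ∘ suc)))
  countT-∖ (true ∷ b) (false ∷ s) h = cong suc (countT-∖ b s (h ∘ suc))
  countT-∖ (false ∷ b) (true ∷ s) h = bool-contra (h zero refl) refl
  countT-∖ (false ∷ b) (false ∷ s) h = countT-∖ b s (h ∘ suc)

  countT≡0 : ∀ {n} (b : Vec Bool n) → countT b ≡ 0 → ∀ k → lookup b k ≡ false
  countT≡0 (false ∷ b) e zero = refl
  countT≡0 (false ∷ b) e (suc k) = countT≡0 b e k

  find-true : ∀ {n} (b : Vec Bool n) → 1 ≤ countT b → Σ (Fin n) λ j → lookup b j ≡ true
  find-true (true ∷ b) _ = zero , refl
  find-true (false ∷ b) h = let (j , e) = find-true b h in suc j , e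

  find-false : ∀ {n} (b : Vec Bool n) → countT b < n → Σ (Fin n) λ j → lookup b j ≡ false
  find-false (false ∷ b) _ = zero , refl
  find-false (true ∷ b) (s≤s h) = let (j , e) = find-false b h in suc j , e

  argmax : ∀ {n} (f : Fin n → ℕ) (b : Vec Bool n) → (Σ (Fin n) λ j → lookup b j ≡ false) →
    Σ (Fin n) λ i → lookup b i ≡ false × (∀ j → lookup b j ≡ false → f j ≤ f i)
  argmax {suc n} f (c ∷ b) some = tail? (Fin.any? λ j → lookup b j Bool.≟ false)
    where
    Result : Set
    Result = Σ (Fin (suc n)) λ i → lookup (c ∷ b) i ≡ false × (∀ j → lookup (c ∷ b) j ≡ false → f j ≤ f i)
    tail? : Dec (Σ (Fin n) λ j → lookup b j ≡ false) → Result
    tail? (no none) = first some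
      where
      first : (Σ (Fin (suc n)) λ j → lookup (c ∷ b) j ≡ false) → Result
      first (suc j , e) = ⊥-elim (none (j , e))
      first (zero , e) = zero , e , λ { zero _ → ≤-refl ; (suc j) e → ⊥-elim (none (j , e)) }
    tail? (yes t) = compare c refl (argmax (f ∘ suc) b t)
      where
      compare : ∀ c′ → c′ ≡ c → (Σ (Fin n) λ i → lookup b i ≡ false × (∀ j → lookup b j ≡ false → f (suc j) ≤ f (suc i))) → Result
      compare true refl (i , e , mx) = suc i , e , λ { zero () ; (suc j) → mx j }
      compare false refl (i , e , mx) = case ≤-total (f zero) (f (suc i)) of λ
        { (inj₁ le) → suc i , e , λ { zero _ → le ; (suc j) → mx j }
        ; (inj₂ ge) → zero , refl , λ { zero _ → ≤-refl ; (suc j) e′ → ≤-trans (mx j e′) ge } }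

  module _ {m n : ℕ} where

    SpanRow : ℕ → ℕ → Vec Bool n × Matrix m n → Vec ℚ n → Set
    SpanRow t H (b , B) x = OnMask H b x × Σ (Vec Bool m) λ T → countT T ≤ t × Σ (Fin m → ℚ) λ c →
      (∀ k → lookup T k ≡ false → c k ≡ 0ℚ) × (∀ j → lookup x j ≡ Σℚ m (λ k → c k * entry B k j))

    -- Which basis rows take part is a bounded choice. Their span has dimension at most t, so at
    -- most t entries determine the row, with no loss; the bound without o(1) relies on this.
    bd-SpanRow : ∀ t → Bd (SpanRow t) (t ℕ.* 2) 0
    bd-SpanRow t = bd-fibration {R = R} {p = 0} {e = 0} (Vec.≡-dec Bool._≟_) _,_
      (λ { H i x _ (on , T , T≤t , c , supp , e) → T , tt , on , T≤t , c , supp , e }) (bd-BoolVec m) bd-R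
      where
      R : ℕ → (Vec Bool n × Matrix m n) × Vec Bool m → Vec ℚ n → Set
      R H ((b , B) , T) x = OnMask H b x × countT T ≤ t × Σ (Fin m → ℚ) λ c →
        (∀ k → lookup T k ≡ false → c k ≡ 0ℚ) × (∀ j → lookup x j ≡ Σℚ m (λ k → c k * entry B k j))
      bd-R : Bd R (t ℕ.* 2) 0
      bd-R = bd λ k → let (C , 1≤C , c) = at (bd-Egyptian {⊤}) k in C ^ t , 1≤^ C t 1≤C , λ { H 1≤H ((b , B) , T) →
        let S = C ℕ.* H ^ (2 ℕ.* suc k ℕ.+ 0)
            1≤S = *-mono-≤ 1≤C (1≤^ H (2 ℕ.* suc k ℕ.+ 0) 1≤H) in
        card-witness λ { _ (_ , T≤t , _) → card-⊆ {Q = AffineSpan (λ j → if lookup b j then IsEgyptian H else (_≡ 0ℚ)) (λ _ → 0ℚ) (entry B) T}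
          (λ { x (on , _ , c , supp , e) → on , c , supp , λ j → trans (e j) (sym (ℚ.+-identityˡ (Σℚ m (λ k → c k * entry B k j)))) })
          (card-mono (≤-trans (^-monoʳ-≤ S {{>-nonZero 1≤S}} T≤t) (≤-reflexive (bound′ k C H)))
            (card-AffineSpan _ S 1≤S n (λ j → if lookup b j then IsEgyptian H else (_≡ 0ℚ)) (λ j → entries k H S 1≤S (c H 1≤H tt) (lookup b j)) (λ _ → 0ℚ) (entry B) T)) } }
        where
        entries : ∀ k H S → 1 ≤ S → Card (IsEgyptian H) (2 ℕ.* suc k) S → ∀ c → Card (if c then IsEgyptian H else (_≡ 0ℚ)) (2 ℕ.* suc k) S
        entries k H S 1≤S c true = c
        entries k H S 1≤S c false = card-mono 1≤S (card-subsingleton λ { _ _ refl refl → refl })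
        bound′ : ∀ k C H → (C ℕ.* H ^ (2 ℕ.* suc k ℕ.+ 0)) ^ t ≡ C ^ t ℕ.* H ^ (t ℕ.* 2 ℕ.* suc k ℕ.+ 0)
        bound′ k C H = trans (^-distribʳ-* t C (H ^ (2 ℕ.* suc k ℕ.+ 0))) (cong (C ^ t ℕ.*_) (trans (^-*-assoc H (2 ℕ.* suc k ℕ.+ 0) t)
          (cong (H ^_) (solve 2 (λ k t → (con 2 :* k :+ con 0) :* t := t :* con 2 :* k :+ con 0) refl (suc k) t))))
          where open ℕSolver

  -- Relations between rows and the columns that satisfy them

  module _ {m n : ℕ} where

    columnsOnly : Vec Bool n → Matrix m n → Matrix m n
    columnsOnly b A = Vec.map (mask b) A

    entry-columnsOnly : ∀ b A i j → entry (columnsOnly b A) i j ≡ (if lookup b j then entry A i j else 0ℚ)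
    entry-columnsOnly b A i j = trans (cong (λ v → lookup v j) (Vec.lookup-map i (mask b) A)) (lookup-mask b (lookup A i) j)

    rowsOnly : Vec Bool m → Matrix m n → Matrix m n
    rowsOnly h A = Vec.tabulate λ i → if lookup h i then lookup A i else Vec.replicate n 0ℚ

    lookup-rowsOnly : ∀ h A i → lookup (rowsOnly h A) i ≡ (if lookup h i then lookup A i else Vec.replicate n 0ℚ)
    lookup-rowsOnly h A = Vec.lookup∘tabulate λ i → if lookup h i then lookup A i else Vec.replicate n 0ℚ

  -- Maximality of t bounds the cost of each row outside the basis, while the row `i⋆` that attains
  -- it gives every column an equation with t + 1 terms. The two effects pull in opposite
  -- directions.
  record Relations (m G t H : ℕ) (h : Vec Bool m) (ρ : Fin m → Fin m → ℚ) (i⋆ : Fin m) : Set where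
    field
      off : ∀ i k → lookup h k ≡ false → ρ i k ≡ 0ℚ
      heights : ∀ i k → Ht G H (ρ i k)
      outside : lookup h i⋆ ≡ false
      maximal : ∀ i → lookup h i ≡ false → countT (supp (ρ i)) ≤ t
      attained : countT (supp (ρ i⋆)) ≡ t

    supp⊆ : ∀ i k → lookup (supp (ρ i)) k ≡ true → lookup h k ≡ true
    supp⊆ i k e = go (lookup h k) refl
      where
      go : ∀ c → lookup h k ≡ c → c ≡ true
      go true _ = refl
      go false e′ = ⊥-elim (supp-true (ρ i) k e (off i k e′))

  open Relations

  ColumnIndex : ℕ → Set
  ColumnIndex m = Vec Bool m × (Fin m → Fin m → ℚ) × Fin m

  Column : ∀ {m} → ℕ → ℕ → ℕ → ℕ → ColumnIndex m → Vec ℚ m → Set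
  Column {m} G r t H (h , ρ , i⋆) x = countT h ≡ r × Relations m G t H h ρ i⋆ × (∀ i → IsEgyptian H (lookup x i)) ×
    (∀ i → lookup x i ≡ Σℚ m (λ k → ρ i k * lookup x k))

  module _ {m : ℕ} (G r t : ℕ) where

    private
      determined : ∀ {H h ρ i⋆} {x y : Vec ℚ m} → Column G r t H (h , ρ , i⋆) x → Column G r t H (h , ρ , i⋆) y →
        (∀ k → lookup h k ≡ true → lookup x k ≡ lookup y k) → x ≡ y
      determined {H} {h} {ρ} {i⋆} {x} {y} (_ , rel , _ , ex) (_ , _ , _ , ey) agree =
        vec-ext x y λ i → trans (ex i) (trans (Σ-cong m λ k → term i k (lookup h k) refl) (sym (ey i)))
        where
        term : ∀ i k c → lookup h k ≡ c → ρ i k * lookup x k ≡ ρ i k * lookup y k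
        term i k true e = cong (ρ i k *_) (agree k e)
        term i k false e = trans (cong (_* lookup x k) (off rel i k e)) (trans (ℚ.*-zeroˡ (lookup x k)) (sym (trans (cong (_* lookup y k) (off rel i k e)) (ℚ.*-zeroˡ (lookup y k)))))

    -- The entries in the r basis rows determine the column. For t = 1 this matches the exponent
    -- obtained from the linear equation, and it carries no loss.
    bd-Column : Bd (Column {m} G r t) (r ℕ.* 2) 0
    bd-Column = bd-inj _≟ᵛ_ (λ i → mask (proj₁ i)) proj₁ (λ { H (h , _) x _ (count , _ , eg , _) → count , mask-OnMask h x (λ k _ → eg k) })
      (λ { H (h , ρ , i⋆) x y _ cx cy e → determined cx cy λ k hk →
           trans (sym (lookup-mask-true h x k hk)) (trans (cong (λ v → lookup v k) e) (lookup-mask-true h y k hk)) })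
      (bd-OnMask r)

    private
      -- The relation for row `i⋆` with all terms on one side, where `i⋆` has coefficient -1; this
      -- coefficient explains the t + 1 terms.
      equation : (Fin m → Fin m → ℚ) → Fin m → Fin m → ℚ
      equation ρ i⋆ k = ρ i⋆ k + point i⋆ (- 1ℚ) k

      touched : ColumnIndex m → Vec Bool m
      touched (h , ρ , i⋆) = supp (ρ i⋆) ⟨ i⋆ ⟩

      Split : ℕ → ColumnIndex m → Vec ℚ m × Vec ℚ m → Set
      Split H i@(h , ρ , i⋆) (u , v) = (countT (h ∖ supp (ρ i⋆)) ≡ r ∸ t × OnMask H (h ∖ supp (ρ i⋆)) u) ×
        LinearEquation (suc (G ℕ.+ 0)) (suc t) H (touched i , equation ρ i⋆) v

      bdo-Split : Bdo Split ((r ∸ t) ℕ.* 2 ℕ.+ suc t)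
      bdo-Split = _ , (bd-× _≟ᵛ_ _≟ᵛ_
          (bd-⊆ (λ { H (h , ρ , i⋆) _ _ _ → h ∖ supp (ρ i⋆) , λ _ q → q }) ≤-refl ≤-refl (bd-OnMask (r ∸ t)))
          (bd-⊆ (λ { H i@(h , ρ , i⋆) _ _ _ → (touched i , equation ρ i⋆) , λ _ q → q }) ≤-refl ≤-refl (proj₂ (bd-LinearEquation (suc (G ℕ.+ 0)) (suc t)))))

      module _ {H : ℕ} (1≤H : 1 ≤ H) {h : Vec Bool m} {ρ : Fin m → Fin m → ℚ} {i⋆ : Fin m} (x : Vec ℚ m) (c : Column G r t H (h , ρ , i⋆) x) where

        private
          rel = proj₁ (proj₂ c)
          eg = proj₁ (proj₂ (proj₂ c))
          S = supp (ρ i⋆)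
          T = S ⟨ i⋆ ⟩
          y = mask T x
          i⋆∉S : lookup S i⋆ ≡ false
          i⋆∉S = go (lookup S i⋆) refl
            where
            go : ∀ b → lookup S i⋆ ≡ b → b ≡ false
            go false _ = refl
            go true e = bool-contra (supp⊆ rel i⋆ i⋆ e) (outside rel)
          nonzero : ∀ k → lookup T k ≡ true → equation ρ i⋆ k ≢ 0ℚ
          nonzero k e = go (k Fin.≟ i⋆)
            where
            go : Dec (k ≡ i⋆) → equation ρ i⋆ k ≢ 0ℚ
            go (yes refl) z = -1≢0 (trans (sym (trans (cong₂ _+_ (off rel i⋆ i⋆ (outside rel)) (point-≡ i⋆ (- 1ℚ))) (ℚ.+-identityˡ (- 1ℚ)))) z)
              where
              -1≢0 : - 1ℚ ≢ 0ℚ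
              -1≢0 ()
            go (no k≢) z = supp-true (ρ i⋆) k (trans (sym (Vec.lookup∘update′ k≢ S true)) e)
              (trans (sym (ℚ.+-identityʳ (ρ i⋆ k))) (trans (cong (λ z → ρ i⋆ k + z) (sym (point-≢ (- 1ℚ) k≢))) z))
          y≡x : ∀ k → ρ i⋆ k * lookup y k ≡ ρ i⋆ k * lookup x k
          y≡x k = go (lookup S k) refl
            where
            go : ∀ b → lookup S k ≡ b → ρ i⋆ k * lookup y k ≡ ρ i⋆ k * lookup x k
            go true e = cong (ρ i⋆ k *_) (lookup-mask-true T x k (trans (Vec.lookup∘update′ (λ { refl → bool-contra e i⋆∉S }) S true) e))
            go false e = trans (cong (_* lookup y k) (supp-false (ρ i⋆) k e)) (trans (ℚ.*-zeroˡ (lookup y k)) (sym (trans (cong (_* lookup x k) (supp-false (ρ i⋆) k e)) (ℚ.*-zeroˡ (lookup x k)))))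
          sum : Σℚ m (λ k → equation ρ i⋆ k * lookup y k) ≡ 0ℚ
          sum = begin
            Σℚ m (λ k → equation ρ i⋆ k * lookup y k)
              ≡⟨ trans (Σ-cong m (λ k → ℚ.*-distribʳ-+ (lookup y k) (ρ i⋆ k) (point i⋆ (- 1ℚ) k))) (Σ-+ m (λ k → ρ i⋆ k * lookup y k) (λ k → point i⋆ (- 1ℚ) k * lookup y k)) ⟩
            Σℚ m (λ k → ρ i⋆ k * lookup y k) + Σℚ m (λ k → point i⋆ (- 1ℚ) k * lookup y k)
              ≡⟨ cong₂ _+_ (trans (Σ-cong m y≡x) (sym (proj₂ (proj₂ (proj₂ c)) i⋆))) (trans (Σ-point m i⋆ (- 1ℚ) (lookup y)) (cong (- 1ℚ *_) (lookup-mask-true T x i⋆ (Vec.lookup∘updateAt i⋆ S)))) ⟩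
            lookup x i⋆ + - 1ℚ * lookup x i⋆
              ≡⟨ solve 1 (λ x → x :+ (:- con 1ℚ) :* x := con 0ℚ) refl (lookup x i⋆) ⟩
            0ℚ ∎
            where
            open ≡-Reasoning
            open +-*-Solver

        column-split : Split H (h , ρ , i⋆) (mask (h ∖ S) x , mask T x)
        column-split = (trans (sym (m+n∸n≡m (countT (h ∖ S)) (countT S))) (cong₂ _∸_ (trans (countT-∖ h S (supp⊆ rel i⋆)) (proj₁ c)) (attained rel)) ,
            mask-OnMask (h ∖ S) x (λ k _ → eg k)) ,
          trans (countT-set S i⋆ i⋆∉S) (cong suc (attained rel)) ,
          (λ k → ht-+ 1≤H (heights rel i⋆ k) (point-ht k)) , nonzero ,
          (λ k e → subst (IsEgyptian H) (sym (lookup-mask-true T x k e)) (eg k)) , lookup-mask-false T x , sum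
          where
          point-ht : ∀ k → Ht 0 H (point i⋆ (- 1ℚ) k)
          point-ht k = go (does (k Fin.≟ i⋆))
            where
            go : ∀ b → Ht 0 H (if b then - 1ℚ else 0ℚ)
            go true = ht-neg 1≤H (ht-1 1≤H)
            go false = ht-0 1≤H

      split-injective : ∀ H i (x y : Vec ℚ m) → 1 ≤ H → Column G r t H i x → Column G r t H i y →
        (mask (proj₁ i ∖ supp (proj₁ (proj₂ i) (proj₂ (proj₂ i)))) x , mask (touched i) x) ≡ (mask (proj₁ i ∖ supp (proj₁ (proj₂ i) (proj₂ (proj₂ i)))) y , mask (touched i) y) → x ≡ y
      split-injective H (h , ρ , i⋆) x y _ cx cy e = determined cx cy λ k hk → go k hk (lookup S k) refl
        where
        S = supp (ρ i⋆)
        rel = proj₁ (proj₂ cx)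
        agree : ∀ b → mask b x ≡ mask b y → ∀ k → lookup b k ≡ true → lookup x k ≡ lookup y k
        agree b e k t = trans (sym (lookup-mask-true b x k t)) (trans (cong (λ v → lookup v k) e) (lookup-mask-true b y k t))
        go : ∀ k → lookup h k ≡ true → ∀ b → lookup S k ≡ b → lookup x k ≡ lookup y k
        go k hk true s = agree (S ⟨ i⋆ ⟩) (cong proj₂ e) k (trans (Vec.lookup∘update′ (λ { refl → bool-contra hk (outside rel) }) S true) s)
        go k hk false s = agree (h ∖ S) (cong proj₁ e) k (trans (Vec.lookup-zipWith (λ x y → x ∧ not y) k h S) (cong₂ (λ x y → x ∧ not y) hk s))

    -- The r - t basis entries outside the support are free. The t + 1 entries touched by the
    -- relation of `i⋆` solve a linear equation and cost (t + 1)/2 together.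
    bdo-Column : Bdo (Column {m} G r t) ((r ∸ t) ℕ.* 2 ℕ.+ suc t)
    bdo-Column = _ , bd-inj (Product.≡-dec _≟ᵛ_ _≟ᵛ_) (λ { i@(h , ρ , i⋆) x → mask (h ∖ supp (ρ i⋆)) x , mask (touched i) x }) id
      (λ H i x 1≤H c → column-split 1≤H x c) split-injective (proj₂ bdo-Split)

  -- Counting matrices through bases of columns and rows

  module _ (m n r t : ℕ) where

    private
      G = spanHeight {m} n 1

      ColumnSpan : Vec Bool n → Matrix m n → Set
      ColumnSpan b A = ∀ j → Σ (Fin n → ℚ) λ c → (∀ l → lookup b l ≡ false → c l ≡ 0ℚ) ×
        (∀ i → entry A i j ≡ Σℚ n (λ l → c l * entry A i l))

      RowRelations : (Fin m → Fin m → ℚ) → Matrix m n → Set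
      RowRelations ρ A = ∀ i j → entry A i j ≡ Σℚ m (λ k → ρ i k * entry A k j)

    -- The row relations are imposed only on the columns in `b`. They can then be fixed together
    -- with that block, before the other columns are chosen.
    record Structure (H : ℕ) (i : Vec Bool n × Vec Bool m) (A : Matrix m n) : Set where
      constructor structure
      b = proj₁ i
      h = proj₂ i
      field
        egyptian : AllEgyptian H A
        countb : countT b ≡ r
        counth : countT h ≡ r
        columnSpan : ColumnSpan b A
        ρ : Fin m → Fin m → ℚ
        i⋆ : Fin m
        relations : Relations m G t H h ρ i⋆
        rowRelations : RowRelations ρ (columnsOnly b A)

    private
      -- Columns of A are combinations of the columns in b, so relations between rows extend from those columns to A.
      extend-relations : ∀ b ρ A → ColumnSpan b A → RowRelations ρ (columnsOnly b A) → RowRelations ρ A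
      extend-relations b ρ A span rel i j = begin
        entry A i j ≡⟨ e i ⟩
        Σℚ n (λ l → c l * entry A i l) ≡⟨ Σ-cong n (restrict i) ⟩
        Σℚ n (λ l → c l * entry C i l) ≡⟨ Σ-cong n (λ l → trans (cong (c l *_) (rel i l)) (sym (Σ-*ˡ m (c l) (λ k → ρ i k * entry C k l)))) ⟩
        Σℚ n (λ l → Σℚ m (λ k → c l * (ρ i k * entry C k l))) ≡⟨ Σ-swap n m (λ l k → c l * (ρ i k * entry C k l)) ⟩
        Σℚ m (λ k → Σℚ n (λ l → c l * (ρ i k * entry C k l)))
          ≡⟨ Σ-cong m (λ k → trans (Σ-cong n λ l → solve 3 (λ c r x → c :* (r :* x) := r :* (c :* x)) refl (c l) (ρ i k) (entry C k l)) (Σ-*ˡ n (ρ i k) (λ l → c l * entry C k l))) ⟩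
        Σℚ m (λ k → ρ i k * Σℚ n (λ l → c l * entry C k l)) ≡⟨ Σ-cong m (λ k → cong (ρ i k *_) (sym (trans (e k) (Σ-cong n (restrict k))))) ⟩
        Σℚ m (λ k → ρ i k * entry A k j) ∎
        where
        open ≡-Reasoning
        open +-*-Solver
        C = columnsOnly b A
        c = proj₁ (span j)
        off′ = proj₁ (proj₂ (span j))
        e = proj₂ (proj₂ (span j))
        restrict : ∀ i l → c l * entry A i l ≡ c l * entry C i l
        restrict i l = trans (go (lookup b l) refl) (cong (c l *_) (sym (entry-columnsOnly b A i l)))
          where
          go : ∀ d → lookup b l ≡ d → c l * entry A i l ≡ c l * (if d then entry A i l else 0ℚ)
          go true _ = refl
          go false f = trans (cong (_* entry A i l) (off′ l f)) (trans (ℚ.*-zeroˡ (entry A i l)) (sym (ℚ.*-zeroʳ (c l))))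

      Masks = Vec Bool n × Vec Bool m

      BasisRows : ℕ → Masks → Matrix m n → Set
      BasisRows H (b , h) B = countT h ≡ r × (∀ i → (if lookup h i then (λ x → countT b ≡ r × OnMask H b x) else (_≡ Vec.replicate n 0ℚ)) (lookup B i))

      bd-BasisRows : Bd BasisRows (r ℕ.* (r ℕ.* 2)) 0
      bd-BasisRows = bd-⊆ (λ { H (b , h) _ _ _ → (h , λ _ → b) , λ _ q → q })
        (≤-reflexive (trans (cong (r ℕ.* (r ℕ.* 2) ℕ.+_) (*-zeroʳ (m ∸ r))) (+-identityʳ _)))
        (≤-reflexive (cong₂ ℕ._+_ (*-zeroʳ r) (*-zeroʳ (m ∸ r))))
        (bd-Vec {Q₀ = λ _ _ → _≡ Vec.replicate n 0ℚ} {Q₁ = λ H b x → countT b ≡ r × OnMask H b x} r _≟ᵛ_ (bd-subsingleton λ { _ _ _ _ _ refl refl → refl }) (bd-OnMask r))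

      AllRows : ℕ → Masks × Matrix m n → Matrix m n → Set
      AllRows H ((b , h) , B) C = countT h ≡ r × (∀ i → (if lookup h i then (_≡ lookup B i) else SpanRow t H (b , B)) (lookup C i))

      bd-AllRows : Bd AllRows ((m ∸ r) ℕ.* (t ℕ.* 2)) 0
      bd-AllRows = bd-⊆ (λ { H ((b , h) , B) _ _ _ → (h , λ i → (b , B) , i) , λ _ q → q })
        (≤-reflexive (cong (ℕ._+ (m ∸ r) ℕ.* (t ℕ.* 2)) (*-zeroʳ r)))
        (≤-reflexive (cong₂ ℕ._+_ (*-zeroʳ r) (*-zeroʳ (m ∸ r))))
        (bd-Vec {(Vec Bool n × Matrix m n) × Fin m} {Q₀ = λ H i → SpanRow t H (proj₁ i)} {Q₁ = λ { _ ((_ , B) , i) x → x ≡ lookup B i }} r _≟ᵛ_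
          (bd-⊆ (λ { H i _ _ _ → proj₁ i , λ _ q → q }) ≤-refl ≤-refl (bd-SpanRow t)) (bd-subsingleton λ { _ _ _ _ _ refl refl → refl }))

      Completion : ℕ → (Vec Bool n × Matrix m n) × ColumnIndex m → Matrix m n → Set
      Completion H ((b , C) , (h , ρ , i⋆)) A = AllEgyptian H A × columnsOnly b A ≡ C × countT b ≡ r × countT h ≡ r ×
        Relations m G t H h ρ i⋆ × RowRelations ρ A

      bd-Completion : ∀ {p e} → Bd (Column {m} G r t) p e → Bd Completion ((n ∸ r) ℕ.* p) ((n ∸ r) ℕ.* e)
      bd-Completion {p} {e} q = bd-inj _≟ᵐ_ (λ _ → transposed)
        (λ { ((b , C) , i) → b , λ j → (C , i) , j }) columns (λ _ _ A B _ _ _ → transposed-injective A B)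
        (bd-⊆ {Q = λ H i v → countT (proj₁ i) ≡ r × (∀ j → (if lookup (proj₁ i) j then Q₁ H (proj₂ i j) else Q₀ H (proj₂ i j)) (lookup v j))}
          (λ H i _ _ _ → i , λ _ q → q) (≤-reflexive (cong (ℕ._+ (n ∸ r) ℕ.* p) (*-zeroʳ r))) (≤-reflexive (cong (ℕ._+ (n ∸ r) ℕ.* e) (*-zeroʳ r)))
          (bd-Vec {Q₀ = Q₀} {Q₁ = Q₁} r _≟ᵛ_
            (bd-⊆ (λ { H ((_ , i) , _) _ _ _ → i , λ _ q → q }) ≤-refl ≤-refl q)
            (bd-subsingleton λ { H ((C , _) , j) x y _ ex ey → vec-ext x y λ i → trans (ex i) (sym (ey i)) })))
        where
        Q₀ Q₁ : ℕ → (Matrix m n × ColumnIndex m) × Fin n → Vec ℚ m → Set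
        Q₀ H ((_ , i) , _) x = Column G r t H i x
        Q₁ H ((C , _) , j) x = ∀ i → lookup x i ≡ entry C i j
        columns : ∀ H i A → 1 ≤ H → Completion H i A → countT (proj₁ (proj₁ i)) ≡ r ×
          (∀ j → (if lookup (proj₁ (proj₁ i)) j then Q₁ H ((proj₂ (proj₁ i) , proj₂ i) , j) else Q₀ H ((proj₂ (proj₁ i) , proj₂ i) , j)) (lookup (transposed A) j))
        columns H ((b , _) , (h , ρ , i⋆)) A _ (eg , refl , countb , counth , rel , rows) = countb , λ j → go j (lookup b j) refl
          where
          go : ∀ j d → lookup b j ≡ d → (if d then Q₁ H ((columnsOnly b A , (h , ρ , i⋆)) , j) else Q₀ H ((columnsOnly b A , (h , ρ , i⋆)) , j)) (lookup (transposed A) j)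
          go j true e i = trans (entry-transposed A i j) (sym (trans (entry-columnsOnly b A i j) (cong (if_then entry A i j else 0ℚ) e)))
          go j false e = counth , rel , (λ i → subst (IsEgyptian H) (sym (entry-transposed A i j)) (eg i j)) ,
            λ i → trans (entry-transposed A i j) (trans (rows i j) (Σ-cong m λ k → cong (ρ i k *_) (sym (entry-transposed A k j))))

    -- The choices are the r × r block, then the other rows inside the r chosen columns at cost t
    -- each, then the other columns. Only the last choice can incur a loss.
    bd-Structure : ∀ {p e} → Bd (Column {m} G r t) p e →
      Bd Structure (r ℕ.* (r ℕ.* 2) ℕ.+ ((m ∸ r) ℕ.* (t ℕ.* 2) ℕ.+ (n ∸ r) ℕ.* p)) ((n ∸ r) ℕ.* e)
    bd-Structure q = bd-fibration {R = R₁} _≟ᵐ_ _,_ basisRows bd-BasisRows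
      (bd-fibration {R = R₂} _≟ᵐ_ _,_ allRows bd-AllRows
        (bd-⊆ completion ≤-refl ≤-refl (bd-Completion q)))
      where
      open Structure
      R₁ : ℕ → Masks × Matrix m n → Matrix m n → Set
      R₁ H ((b , h) , B) A = Structure H (b , h) A × rowsOnly h (columnsOnly b A) ≡ B
      R₂ : ℕ → (Masks × Matrix m n) × Matrix m n → Matrix m n → Set
      R₂ H (((b , h) , _) , C) A = Structure H (b , h) A × columnsOnly b A ≡ C
      onMask : ∀ {H b h A} → Structure H (b , h) A → ∀ i → OnMask H b (lookup (columnsOnly b A) i)
      onMask {H} {b} {h} {A} s i = subst (OnMask H b) (sym (Vec.lookup-map i (mask b) A)) (mask-OnMask b (lookup A i) (λ j _ → egyptian s i j))
      basisRows : ∀ H i A → 1 ≤ H → Structure H i A → Σ (Matrix m n) λ B → BasisRows H i B × R₁ H (i , B) A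
      basisRows H (b , h) A _ s = rowsOnly h C , (counth s , λ i → subst (if lookup h i then (λ x → countT b ≡ r × OnMask H b x) else (_≡ Vec.replicate n 0ℚ))
          (sym (lookup-rowsOnly h C i)) (go i (lookup h i))) , s , refl
        where
        C = columnsOnly b A
        go : ∀ i d → (if d then (λ x → countT b ≡ r × OnMask H b x) else (_≡ Vec.replicate n 0ℚ)) (if d then lookup C i else Vec.replicate n 0ℚ)
        go i true = countb s , onMask s i
        go i false = refl
      allRows : ∀ H i A → 1 ≤ H → R₁ H i A → Σ (Matrix m n) λ C → AllRows H i C × R₂ H (i , C) A
      allRows H ((b , h) , _) A _ (s , refl) = C , (counth s , λ i → go i (lookup h i) refl) , s , refl
        where
        C = columnsOnly b A
        B = rowsOnly h C
        B≡C : ∀ k → lookup h k ≡ true → lookup B k ≡ lookup C k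
        B≡C k e = trans (lookup-rowsOnly h C k) (cong (if_then lookup C k else Vec.replicate n 0ℚ) e)
        go : ∀ i d → lookup h i ≡ d → (if d then (_≡ lookup B i) else SpanRow t H (b , B)) (lookup C i)
        go i true e = sym (B≡C i e)
        go i false e = onMask s i , supp (ρ s i) , maximal (relations s) i e , ρ s i , supp-false (ρ s i) ,
          λ j → trans (rowRelations s i j) (Σ-cong m λ k → term j k (lookup h k) refl)
          where
          term : ∀ j k d → lookup h k ≡ d → ρ s i k * entry C k j ≡ ρ s i k * entry B k j
          term j k true e = cong (λ v → ρ s i k * lookup v j) (sym (B≡C k e))
          term j k false e = trans (cong (_* entry C k j) (off (relations s) i k e)) (trans (ℚ.*-zeroˡ (entry C k j))
            (sym (trans (cong (_* entry B k j) (off (relations s) i k e)) (ℚ.*-zeroˡ (entry B k j)))))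
      completion : ∀ H i A → 1 ≤ H → R₂ H i A → Σ ((Vec Bool n × Matrix m n) × ColumnIndex m) λ j → ∀ A′ → R₂ H i A′ → Completion H j A′
      -- The relations of one witness serve every A′ with the same block of columns: they speak only
      -- of that block, and extend to A′ because its own columns in b span the others.
      completion H (((b , h) , _) , _) A _ (s , refl) = ((b , columnsOnly b A) , (h , ρ s , i⋆ s)) , λ A′ → λ { (s′ , e) →
        egyptian s′ , e , countb s′ , counth s′ , relations s ,
        extend-relations b (ρ s) A′ (columnSpan s′) (subst (RowRelations (ρ s)) (sym e) (rowRelations s)) }

    SomeStructure : ℕ → ⊤ → Matrix m n → Set
    SomeStructure H _ A = 1 ≤ t × t ≤ r × Σ (Vec Bool n × Vec Bool m) λ i → Structure H i A

    bd-SomeStructure : ∀ {p e} → Bd (Column {m} G r t) p e →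
      Bd SomeStructure (r ℕ.* (r ℕ.* 2) ℕ.+ ((m ∸ r) ℕ.* (t ℕ.* 2) ℕ.+ (n ∸ r) ℕ.* p)) ((n ∸ r) ℕ.* e)
    bd-SomeStructure q = bd-fibration {R = λ H i A → Structure H i A} {p = 0} {e = 0} (Product.≡-dec (Vec.≡-dec Bool._≟_) (Vec.≡-dec Bool._≟_)) (λ _ i → i)
      (λ { H _ A _ (_ , _ , i , s) → i , (tt , tt) , s }) (bd-× (Vec.≡-dec Bool._≟_) (Vec.≡-dec Bool._≟_) (bd-BoolVec n) (bd-BoolVec m)) (bd-Structure q)

  -- Bases extracted from the rank

  module _ {m n r H : ℕ} (1≤r : 1 ≤ r) (r<m : r < m) (m≤n : m ≤ n) (1≤H : 1 ≤ H) (A : Matrix m n) (inL : InL m n r H A) where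

    private
      eg = proj₁ inL
      dependent = proj₂ (proj₂ inL)

      columnBasis : Σ (Vec Bool n) λ b → countT b ≤ r × (∀ j → Spans (λ j i → entry A i j) (spanHeight {n} m 1) H b j)
      columnBasis = case span-or-independent 1≤H m r 1 (λ j i → entry A i j) (Vec.replicate m true) (λ j i → ht-Egyptian 1≤H {entry A i j} (eg i j))
          (λ _ i e → bool-contra (Vec.lookup-replicate i true) e) of λ
        -- The rank forbids r + 1 independent columns.
        { (inj₁ s) → s ; (inj₂ (g , _ , indep)) → ⊥-elim (dependent g indep) }

      b-padded : Σ (Vec Bool n) λ b → countT b ≡ r × (∀ l → lookup b l ≡ false → lookup (proj₁ columnBasis) l ≡ false)
      b-padded = pad (proj₁ columnBasis) r (proj₁ (proj₂ columnBasis)) (≤-trans (<⇒≤ r<m) m≤n)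

      b = proj₁ b-padded
      C = columnsOnly b A

      C-ht : ∀ i j → Ht 1 H (entry C i j)
      C-ht i j = subst (Ht 1 H) (sym (entry-columnsOnly b A i j)) (go (lookup b j))
        where
        go : ∀ d → Ht 1 H (if d then entry A i j else 0ℚ)
        go true = ht-Egyptian 1≤H {entry A i j} (eg i j)
        go false = ht-mono 1≤H z≤n (ht-0 1≤H)

      C-off : ∀ i j → lookup b j ≡ false → entry C i j ≡ 0ℚ
      C-off i j e = trans (entry-columnsOnly b A i j) (cong (if_then entry A i j else 0ℚ) e)

      rowBasis : Σ (Vec Bool m) λ h → countT h ≤ r × (∀ i → Spans (entry C) (spanHeight {m} n 1) H h i)
      rowBasis = case span-or-independent 1≤H n r 1 (entry C) b C-ht C-off of λ
        -- More than r independent rows would need more than r columns that are not masked out.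
        { (inj₁ s) → s ; (inj₂ (g , r<b , _)) → ⊥-elim (<⇒≱ r<b (≤-reflexive (proj₁ (proj₂ b-padded)))) }

      h-padded : Σ (Vec Bool m) λ h → countT h ≡ r × (∀ k → lookup h k ≡ false → lookup (proj₁ rowBasis) k ≡ false)
      h-padded = pad (proj₁ rowBasis) r (proj₁ (proj₂ rowBasis)) (<⇒≤ r<m)

      h = proj₁ h-padded

      ρ : Fin m → Fin m → ℚ
      ρ i = proj₁ (proj₂ (proj₂ rowBasis) i)

      ρ-off : ∀ i k → lookup h k ≡ false → ρ i k ≡ 0ℚ
      ρ-off i k e = proj₁ (proj₂ (proj₂ (proj₂ rowBasis) i)) k (proj₂ (proj₂ h-padded) k e)

      ρ-span : ∀ i j → entry C i j ≡ Σℚ m (λ k → ρ i k * entry C k j)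
      ρ-span i = proj₂ (proj₂ (proj₂ (proj₂ (proj₂ rowBasis) i)))

      best : Σ (Fin m) λ i⋆ → lookup h i⋆ ≡ false × (∀ i → lookup h i ≡ false → countT (supp (ρ i)) ≤ countT (supp (ρ i⋆)))
      best = argmax (λ i → countT (supp (ρ i))) h (find-false h (subst (_< m) (sym (proj₁ (proj₂ h-padded))) r<m))

      i⋆ = proj₁ best
      t = countT (supp (ρ i⋆))

      rel : Relations m (spanHeight {m} n 1) t H h ρ i⋆
      rel = record { off = ρ-off ; heights = λ i → proj₁ (proj₂ (proj₂ (proj₂ (proj₂ rowBasis) i))) ; outside = proj₁ (proj₂ best) ;
        maximal = proj₂ (proj₂ best) ; attained = refl }

      t≤r : t ≤ r
      t≤r = ≤-trans (m≤n+m t (countT (h ∖ supp (ρ i⋆)))) (≤-reflexive (trans (countT-∖ h (supp (ρ i⋆)) (supp⊆ rel i⋆)) (proj₁ (proj₂ h-padded))))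

      -- An empty support would make row `i⋆` vanish on a chosen column, and one exists because r ≥
      -- 1.
      1≤t : 1 ≤ t
      1≤t = n≢0⇒n>0 λ t≡0 → let (j , bj) = find-true b (subst (1 ≤_) (sym (proj₁ (proj₂ b-padded))) 1≤r) in
        egyptian≢0 {H} (eg i⋆ j) (trans (sym (trans (entry-columnsOnly b A i⋆ j) (cong (if_then entry A i⋆ j else 0ℚ) bj)))
          (trans (ρ-span i⋆ j) (Σ-0 m λ k → trans (cong (_* entry C k j) (supp-false (ρ i⋆) k (countT≡0 (supp (ρ i⋆)) t≡0 k))) (ℚ.*-zeroˡ (entry C k j)))))

    hasStructure : Σ ℕ λ t → t < suc r × SomeStructure m n r t H tt A
    hasStructure = t , s≤s t≤r , 1≤t , t≤r , (b , h) , structure eg (proj₁ (proj₂ b-padded)) (proj₁ (proj₂ h-padded))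
      (λ j → let (c , c-off , _ , e) = proj₂ (proj₂ columnBasis) j in c , (λ l f → c-off l (proj₂ (proj₂ b-padded) l f)) , e)
      ρ i⋆ rel ρ-span

  -- Comparison of exponents

  card-root : ∀ {X : Set} {P : X → Set} a e {B} → Card P (a ℕ.* suc e) (B ^ suc e) → Card P a B
  card-root a e {B} c = card λ xs u h → ^-cancelˡ-≤ _ B e (≤-trans (≤-reflexive (^-*-assoc _ a (suc e))) (bound c xs u h))

  ≤^suc : ∀ {C} e → 1 ≤ C → C ≤ C ^ suc e
  ≤^suc {C} e 1≤C = ≤-trans (≤-reflexive (sym (*-identityʳ C))) (*-monoʳ-≤ C (1≤^ C e 1≤C))

  -- A gap in the main exponent absorbs the loss: for K = e + 1 one has pK + e < (p + 1)K ≤ qK.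
  -- Taking the K-th root bounds the square of the count by C H^q, which is then raised to any
  -- power.
  bd-sharpen : ∀ {I X : Set} {P : ℕ → I → X → Set} {p q e} → p < q → Bd P p e → Bd P q 0
  bd-sharpen {p = p} {q} {e} p<q h = bd λ k → let (C , 1≤C , c) = at h e in C ^ suc k , 1≤^ C (suc k) 1≤C , λ H 1≤H i →
    let half : Card _ 2 (C ℕ.* H ^ q)
        half = card-root 2 e (card-mono (enough C 1≤C H 1≤H) (c H 1≤H i))
    in card λ xs u a → ≤-trans (≤-reflexive (sym (^-*-assoc (List.length xs) 2 (suc k)))) (≤-trans (^-monoˡ-≤ (suc k) (bound half xs u a))
      (≤-reflexive (trans (^-distribʳ-* (suc k) C (H ^ q)) (cong (C ^ suc k ℕ.*_) (trans (^-*-assoc H q (suc k)) (cong (H ^_) (sym (+-identityʳ (q ℕ.* suc k)))))))))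
    where
    enough : ∀ C → 1 ≤ C → ∀ H → 1 ≤ H → C ℕ.* H ^ (p ℕ.* suc e ℕ.+ e) ≤ (C ℕ.* H ^ q) ^ suc e
    enough C 1≤C H 1≤H = begin
      C ℕ.* H ^ (p ℕ.* suc e ℕ.+ e) ≤⟨ *-mono-≤ (≤^suc e 1≤C) (^-monoʳ-≤ H {{>-nonZero 1≤H}} exponent) ⟩
      C ^ suc e ℕ.* H ^ (q ℕ.* suc e) ≡⟨ cong (C ^ suc e ℕ.*_) (sym (^-*-assoc H q (suc e))) ⟩
      C ^ suc e ℕ.* (H ^ q) ^ suc e ≡⟨ sym (^-distribʳ-* (suc e) C (H ^ q)) ⟩
      (C ℕ.* H ^ q) ^ suc e ∎
      where
      open ≤-Reasoning
      exponent : p ℕ.* suc e ℕ.+ e ≤ q ℕ.* suc e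
      exponent = ≤-trans (≤-trans (+-monoʳ-≤ (p ℕ.* suc e) (n≤1+n e)) (≤-reflexive (+-comm (p ℕ.* suc e) (suc e)))) (*-monoˡ-≤ (suc e) p<q)

  bdo⇒card : ∀ {X : Set} {P : ℕ → ⊤ → X → Set} {p q} → p ≤ q → Bdo P p → ∀ k → 1 ≤ k →
    Σ ℕ λ C → 1 ≤ C × (∀ H → 1 ≤ H → Card (P H tt) (2 ℕ.* k) (C ℕ.* H ^ (k ℕ.* q ℕ.+ 1)))
  -- The argument makes K equal to (k + 1)(e + 1). A root of order e + 1 then shrinks the loss e to
  -- at most 1.
  bdo⇒card {P = P} {p} {q} p≤q (e , h) (suc k) _ = let (C , 1≤C , c) = at h (e ℕ.+ k ℕ.* suc e) in C , 1≤C , λ H 1≤H →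
    card-root (2 ℕ.* suc k) e (card-mono (enough C 1≤C H 1≤H)
      (subst (λ a → Card (P H tt) a (C ℕ.* H ^ (p ℕ.* (suc k ℕ.* suc e) ℕ.+ e))) (sym (*-assoc 2 (suc k) (suc e))) (c H 1≤H tt)))
    where
    enough : ∀ C → 1 ≤ C → ∀ H → 1 ≤ H → C ℕ.* H ^ (p ℕ.* (suc k ℕ.* suc e) ℕ.+ e) ≤ (C ℕ.* H ^ (suc k ℕ.* q ℕ.+ 1)) ^ suc e
    enough C 1≤C H 1≤H = begin
      C ℕ.* H ^ (p ℕ.* (suc k ℕ.* suc e) ℕ.+ e) ≤⟨ *-mono-≤ (≤^suc e 1≤C) (^-monoʳ-≤ H {{>-nonZero 1≤H}} exponent) ⟩
      C ^ suc e ℕ.* H ^ ((suc k ℕ.* q ℕ.+ 1) ℕ.* suc e) ≡⟨ cong (C ^ suc e ℕ.*_) (sym (^-*-assoc H (suc k ℕ.* q ℕ.+ 1) (suc e))) ⟩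
      C ^ suc e ℕ.* (H ^ (suc k ℕ.* q ℕ.+ 1)) ^ suc e ≡⟨ sym (^-distribʳ-* (suc e) C (H ^ (suc k ℕ.* q ℕ.+ 1))) ⟩
      (C ℕ.* H ^ (suc k ℕ.* q ℕ.+ 1)) ^ suc e ∎
      where
      open ≤-Reasoning
      open ℕSolver
      exponent : p ℕ.* (suc k ℕ.* suc e) ℕ.+ e ≤ (suc k ℕ.* q ℕ.+ 1) ℕ.* suc e
      exponent = ≤-trans (+-mono-≤ (*-monoˡ-≤ (suc k ℕ.* suc e) p≤q) (n≤1+n e))
        (≤-reflexive (solve 3 (λ q k e → q :* (k :* e) :+ e := (k :* q :+ con 1) :* e) refl q (suc k) (suc e)))

  o-bound : ∀ {X : Set} {P : ℕ → ⊤ → X → Set} {p q} → p ≤ q → Bdo P p → ∀ k → 1 ≤ k →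
    Σ ℕ λ C → Σ ℕ λ H₀ → ∀ H → H₀ ≤ H → CardPowLE (P H tt) (2 ℕ.* k) (C ℕ.* H ^ (k ℕ.* q ℕ.+ 2))
  o-bound {q = q} p≤q h k 1≤k = let (C , _ , c) = bdo⇒card p≤q h k 1≤k in C , 1 , λ H 1≤H →
    bound (card-mono (*-monoʳ-≤ C (^-monoʳ-≤ H {{>-nonZero 1≤H}} (+-monoʳ-≤ (k ℕ.* q) (s≤s z≤n)))) (c H 1≤H))

  -- The loss can be reduced to 1 while 2 is allowed, and the spare factor H absorbs the constant
  -- once H ≥ C.
  o-bound-without-constant : ∀ {X : Set} {P : ℕ → ⊤ → X → Set} {p q} → p ≤ q → Bdo P p → ∀ k → 1 ≤ k →
    Σ ℕ λ H₀ → ∀ H → H₀ ≤ H → CardPowLE (P H tt) (2 ℕ.* k) (H ^ (k ℕ.* q ℕ.+ 2))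
  o-bound-without-constant {q = q} p≤q h k 1≤k = let (C , 1≤C , c) = bdo⇒card p≤q h k 1≤k in C , λ H C≤H →
    bound (card-mono (≤-trans (*-monoˡ-≤ (H ^ (k ℕ.* q ℕ.+ 1)) C≤H) (≤-reflexive (cong (H ^_) (sym (+-suc (k ℕ.* q) 1))))) (c H (≤-trans 1≤C C≤H)))

  -- A label from a finite set affects only the constant, so a union of lossless counts remains
  -- lossless.
  bd-⋃< : ∀ {I X : Set} n {P : ℕ → ℕ → I → X → Set} {p} → (∀ t → t < n → Bd (P t) p 0) → Bd (λ H i x → Σ ℕ λ t → t < n × P t H i x) p 0
  bd-⋃< {I} {X} n {P} {p} h = bd-fibration {R = λ H (i , t) x → toℕ t < n × P (toℕ t) H i x} {p = 0} {e = 0} Fin._≟_ _,_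
    (λ { H i x _ (t , t<n , q) → fromℕ< t<n , tt , subst (λ t → t < n × P t H i x) (sym (Fin.toℕ-fromℕ< t<n)) (t<n , q) }) (bd-Fin n)
    (bd λ k → let (C , 1≤C , c) = constants k n ≤-refl in C , 1≤C , λ H 1≤H (i , t) → card-⊆ (λ _ → proj₂) (c H 1≤H i (toℕ t) (Fin.toℕ<n t)))
    where
    constants : ∀ k n′ → n′ ≤ n → Σ ℕ λ C → 1 ≤ C × (∀ H → 1 ≤ H → ∀ i t → t < n′ → Card (P t H i) (2 ℕ.* suc k) (C ℕ.* H ^ (p ℕ.* suc k ℕ.+ 0)))
    constants k zero _ = 1 , ≤-refl , λ _ _ _ _ ()
    constants k (suc n′) n′<n = let (C , 1≤C , c) = constants k n′ (<⇒≤ n′<n) ; (D , 1≤D , d) = at (h n′ n′<n) k in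
      C ℕ.* D , *-mono-≤ 1≤C 1≤D , λ { H 1≤H i t (s≤s t≤n′) → case m≤n⇒m<n∨m≡n t≤n′ of λ
        { (inj₁ t<n′) → card-mono (*-monoˡ-≤ _ (m≤m*n C D {{>-nonZero 1≤D}})) (c H 1≤H i t t<n′)
        ; (inj₂ refl) → card-mono (*-monoˡ-≤ _ (m≤n*m D C {{>-nonZero 1≤C}})) (d H 1≤H i) } }

  -- In halves, the right side exceeds the left by (r - t)(2m - n - r), so t = r is the extreme case
  -- when 2m ≥ n + r.
  exponent≤ : ∀ {m n r t} → t ≤ r → r < m → m ≤ n → n ℕ.+ r ≤ 2 ℕ.* m →
    r ℕ.* (r ℕ.* 2) ℕ.+ ((m ∸ r) ℕ.* (t ℕ.* 2) ℕ.+ (n ∸ r) ℕ.* ((r ∸ t) ℕ.* 2 ℕ.+ suc t)) ≤ (n ∸ r) ℕ.* (r ℕ.+ 1) ℕ.+ 2 ℕ.* m ℕ.* r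
  exponent≤ {m} {n} {r} {t} t≤r r<m m≤n n+r≤2m = subst₂ _≤_ lhs rhs (+-monoʳ-≤ base (*-monoˡ-≤ s v≤2u))
    where
    open ℕSolver
    s = r ∸ t
    u = m ∸ r
    v = n ∸ r
    r≡ : t ℕ.+ s ≡ r
    r≡ = m+[n∸m]≡n t≤r
    m≡ : r ℕ.+ u ≡ m
    m≡ = m+[n∸m]≡n (<⇒≤ r<m)
    n≡ : r ℕ.+ v ≡ n
    n≡ = m+[n∸m]≡n (≤-trans (<⇒≤ r<m) m≤n)
    v≤2u : v ≤ 2 ℕ.* u
    v≤2u = +-cancelˡ-≤ (2 ℕ.* r) v (2 ℕ.* u) (subst₂ _≤_
      (trans (cong (ℕ._+ r) (sym n≡)) (solve 2 (λ r v → r :+ v :+ r := con 2 :* r :+ v) refl r v))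
      (trans (cong (2 ℕ.*_) (sym m≡)) (*-distribˡ-+ 2 r u)) n+r≤2m)
    base = r ℕ.* (r ℕ.* 2) ℕ.+ u ℕ.* (t ℕ.* 2) ℕ.+ v ℕ.* (s ℕ.+ suc t)
    lhs : base ℕ.+ v ℕ.* s ≡ r ℕ.* (r ℕ.* 2) ℕ.+ (u ℕ.* (t ℕ.* 2) ℕ.+ v ℕ.* (s ℕ.* 2 ℕ.+ suc t))
    lhs = solve 5 (λ r u t v s → r :* (r :* con 2) :+ u :* (t :* con 2) :+ v :* (s :+ (con 1 :+ t)) :+ v :* s
      := r :* (r :* con 2) :+ (u :* (t :* con 2) :+ v :* (s :* con 2 :+ (con 1 :+ t)))) refl r u t v s
    rhs : base ℕ.+ 2 ℕ.* u ℕ.* s ≡ v ℕ.* (r ℕ.+ 1) ℕ.+ 2 ℕ.* m ℕ.* r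
    rhs = trans (cong (λ r → r ℕ.* (r ℕ.* 2) ℕ.+ u ℕ.* (t ℕ.* 2) ℕ.+ v ℕ.* (s ℕ.+ suc t) ℕ.+ 2 ℕ.* u ℕ.* s) (sym r≡))
      (trans (solve 4 (λ u t v s → (t :+ s) :* ((t :+ s) :* con 2) :+ u :* (t :* con 2) :+ v :* (s :+ (con 1 :+ t)) :+ con 2 :* u :* s
        := v :* ((t :+ s) :+ con 1) :+ con 2 :* ((t :+ s) :+ u) :* (t :+ s)) refl u t v s)
        (trans (cong (λ r → v ℕ.* (r ℕ.+ 1) ℕ.+ 2 ℕ.* (r ℕ.+ u) ℕ.* r) r≡) (cong (λ m → v ℕ.* (r ℕ.+ 1) ℕ.+ 2 ℕ.* m ℕ.* r) m≡)))

  -- Twice the target exponent is precisely the lossless cost of the case t = 1.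
  target≡ : ∀ {m n r} → r < m → m ≤ n → 2 ℕ.* (n ℕ.* r ℕ.+ m ∸ r) ≡ r ℕ.* (r ℕ.* 2) ℕ.+ ((m ∸ r) ℕ.* 2 ℕ.+ (n ∸ r) ℕ.* (r ℕ.* 2))
  target≡ {m} {n} {r} r<m m≤n = trans (cong (2 ℕ.*_) (trans (+-∸-assoc (n ℕ.* r) (<⇒≤ r<m)) (cong (λ n → n ℕ.* r ℕ.+ (m ∸ r)) (sym (m+[n∸m]≡n (≤-trans (<⇒≤ r<m) m≤n))))))
    (solve 3 (λ r u v → con 2 :* ((r :+ v) :* r :+ u) := r :* (r :* con 2) :+ (u :* con 2 :+ v :* (r :* con 2))) refl r (m ∸ r) (n ∸ r))
    where open ℕSolver

  -- In halves, the right side exceeds the left by (t - 1)(n + r - 2m), which is positive for t ≥ 2;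
  -- `w` is t - 2.
  exponent< : ∀ {m n r t} → 2 ≤ t → t ≤ r → r < m → m ≤ n → 2 ℕ.* m < n ℕ.+ r →
    r ℕ.* (r ℕ.* 2) ℕ.+ ((m ∸ r) ℕ.* (t ℕ.* 2) ℕ.+ (n ∸ r) ℕ.* ((r ∸ t) ℕ.* 2 ℕ.+ suc t)) < 2 ℕ.* (n ℕ.* r ℕ.+ m ∸ r)
  exponent< {m} {n} {r} {t} 2≤t t≤r r<m m≤n 2m<n+r = subst₂ _<_ lhs (trans rhs (sym (target≡ r<m m≤n))) (+-monoʳ-< base (*-monoʳ-< (suc w) 2u<v))
    where
    open ℕSolver
    s = r ∸ t
    u = m ∸ r
    v = n ∸ r
    w = t ∸ 2
    t≡ : 2 ℕ.+ w ≡ t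
    t≡ = m+[n∸m]≡n 2≤t
    r≡ : 2 ℕ.+ w ℕ.+ s ≡ r
    r≡ = trans (cong (ℕ._+ s) t≡) (m+[n∸m]≡n t≤r)
    2u<v : 2 ℕ.* u < v
    2u<v = +-cancelˡ-< (2 ℕ.* r) (2 ℕ.* u) v (subst₂ _<_
      (trans (cong (2 ℕ.*_) (sym (m+[n∸m]≡n (<⇒≤ r<m)))) (*-distribˡ-+ 2 r u))
      (trans (cong (ℕ._+ r) (sym (m+[n∸m]≡n (≤-trans (<⇒≤ r<m) m≤n)))) (solve 2 (λ r v → r :+ v :+ r := con 2 :* r :+ v) refl r v)) 2m<n+r)
    base = r ℕ.* (r ℕ.* 2) ℕ.+ u ℕ.* 2 ℕ.+ v ℕ.* (s ℕ.* 2 ℕ.+ (3 ℕ.+ w))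
    lhs : base ℕ.+ suc w ℕ.* (2 ℕ.* u) ≡ r ℕ.* (r ℕ.* 2) ℕ.+ (u ℕ.* (t ℕ.* 2) ℕ.+ v ℕ.* (s ℕ.* 2 ℕ.+ suc t))
    lhs = trans (solve 5 (λ r u v s w → r :* (r :* con 2) :+ u :* con 2 :+ v :* (s :* con 2 :+ (con 3 :+ w)) :+ (con 1 :+ w) :* (con 2 :* u)
        := r :* (r :* con 2) :+ (u :* ((con 2 :+ w) :* con 2) :+ v :* (s :* con 2 :+ (con 1 :+ (con 2 :+ w))))) refl r u v s w)
      (cong (λ t → r ℕ.* (r ℕ.* 2) ℕ.+ (u ℕ.* (t ℕ.* 2) ℕ.+ v ℕ.* (s ℕ.* 2 ℕ.+ suc t))) t≡)
    rhs : base ℕ.+ suc w ℕ.* v ≡ r ℕ.* (r ℕ.* 2) ℕ.+ (u ℕ.* 2 ℕ.+ v ℕ.* (r ℕ.* 2))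
    rhs = trans (solve 5 (λ r u v s w → r :* (r :* con 2) :+ u :* con 2 :+ v :* (s :* con 2 :+ (con 3 :+ w)) :+ (con 1 :+ w) :* v
        := r :* (r :* con 2) :+ (u :* con 2 :+ v :* ((con 2 :+ w :+ s) :* con 2))) refl r u v s w)
      (cong (λ r′ → r ℕ.* (r ℕ.* 2) ℕ.+ (u ℕ.* 2 ℕ.+ v ℕ.* (r′ ℕ.* 2))) r≡)

  module _ {m n r : ℕ} (1≤r : 1 ≤ r) (r<m : r < m) (m≤n : m ≤ n) where

    private
      G = spanHeight {m} n 1

      inStructure : ∀ {p e} → Bd (λ H i A → Σ ℕ λ t → t < suc r × SomeStructure m n r t H i A) p e → Bd (L m n r) p e
      inStructure = bd-⊆ (λ H i A 1≤H _ → i , λ B → hasStructure 1≤r r<m m≤n 1≤H B) ≤-refl ≤-refl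

      bd-no-structure : ∀ {p e} → Bd (SomeStructure m n r 0) p e
      bd-no-structure = bd-⊆ {J = ⊤} {Q = λ H i A → ⊥} (λ { _ _ _ _ (() , _) }) z≤n z≤n (bd-subsingleton λ _ _ _ _ _ ())

    bdo-rank-large : n ℕ.+ r ≤ 2 ℕ.* m → Bdo (L m n r) ((n ∸ r) ℕ.* (r ℕ.+ 1) ℕ.+ 2 ℕ.* m ℕ.* r)
    bdo-rank-large n+r≤2m = _ , inStructure (proj₂ (bdo-⋃< (suc r) λ { t (s≤s t≤r) → _ ,
      bd-weaken (exponent≤ t≤r r<m m≤n n+r≤2m) ≤-refl
        (bd-SomeStructure m n r t (proj₂ (bdo-Column G r t))) }))

    bd-rank-large : 2 ℕ.* m < n ℕ.+ r → Bd (L m n r) (2 ℕ.* (n ℕ.* r ℕ.+ m ∸ r)) 0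
    bd-rank-large 2m<n+r = inStructure (bd-⋃< (suc r) λ
      { zero _ → bd-no-structure
      -- At t = 1 the cost meets the target exactly, so the lossless count of columns is required;
      -- from t = 2 on the strict gap absorbs any loss.
      ; (suc zero) _ → bd-weaken (≤-reflexive (sym (target≡ r<m m≤n))) (≤-reflexive (*-zeroʳ (n ∸ r)))
          (bd-SomeStructure m n r 1 (bd-Column G r 1))
      ; t@(suc (suc _)) (s≤s t≤r) → bd-sharpen (exponent< (s≤s (s≤s z≤n)) t≤r r<m m≤n 2m<n+r) (bd-SomeStructure m n r t (proj₂ (bdo-Column G r t))) })

    -- The case K = 1 bounds the square of the count; replacing C by C * C makes the bound a perfect
    -- square whose root is the claim.
    exact-bound : 2 ℕ.* m < n ℕ.+ r → Σ ℕ λ C → ∀ H → 1 ≤ H → CardPowLE (InL m n r H) 1 (C ℕ.* H ^ (n ℕ.* r ℕ.+ m ∸ r))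
    exact-bound 2m<n+r = let (C , 1≤C , c) = at (bd-rank-large 2m<n+r) 0 ; E = n ℕ.* r ℕ.+ m ∸ r in C , λ H 1≤H →
      bound (card-root 1 1 (card-mono (≤-trans (*-mono-≤ (≤^suc 1 1≤C) (≤-reflexive (trans (cong (H ^_) (exponent E)) (sym (^-*-assoc H E 2)))))
        (≤-reflexive (sym (^-distribʳ-* 2 C (H ^ E))))) (c H 1≤H tt)))
      where
      open ℕSolver
      exponent : ∀ E → 2 ℕ.* E ℕ.* 1 ℕ.+ 0 ≡ E ℕ.* 2
      exponent = solve 1 (λ E → con 2 :* E :* con 1 :+ con 0 := E :* con 2) refl

  -- In halves, either splitting into two classes costs 2(3 + 3) = 12 and the core costs 12 + 2 =
  -- 14.
  rank-two-33 : Bdo (L 3 3 2) 14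
  rank-two-33 = bdo-rank-two 14 (≤ᵇ⇒≤ 12 14 tt) (≤ᵇ⇒≤ 12 14 tt) (≤ᵇ⇒≤ 14 14 tt)

  -- Excluding (3,3) forces n ≥ 4, and then the core fits with slack 2(n - 4) in halves. Two classes
  -- of rows cost 2n, which needs m ≥ 3, and two classes of columns cost no more.
  rank-two-general : ∀ {m n} → 2 < m → m ≤ n → ¬ (m ≡ 3 × n ≡ 3) → Bdo (L m n 2) (2 ℕ.* (2 ℕ.* n ℕ.+ m ∸ 3))
  rank-two-general {m} {n} 2<m m≤n ne = bdo-rank-two (2 ℕ.* (2 ℕ.* n ℕ.+ m ∸ 3)) rows columns core≤
    where
    open ℕSolver
    u = m ∸ 3
    v = n ∸ 4
    m≡ : 3 ℕ.+ u ≡ m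
    m≡ = m+[n∸m]≡n 2<m
    4≤n : 4 ≤ n
    4≤n = case m≤n⇒m<n∨m≡n (≤-trans 2<m m≤n) of λ
      { (inj₁ h) → h ; (inj₂ refl) → ⊥-elim (ne (≤-antisym m≤n 2<m , refl)) }
    n≡ : 4 ℕ.+ v ≡ n
    n≡ = m+[n∸m]≡n 4≤n
    target : 2 ℕ.* n ℕ.+ u ≡ 2 ℕ.* n ℕ.+ m ∸ 3
    target = sym (+-∸-assoc (2 ℕ.* n) 2<m)
    rows : 2 ℕ.* ((m ℕ.⊔ n) ℕ.+ n) ≤ 2 ℕ.* (2 ℕ.* n ℕ.+ m ∸ 3)
    rows = *-monoʳ-≤ 2 (≤-trans (≤-reflexive (trans (cong (ℕ._+ n) (m≤n⇒m⊔n≡n m≤n)) (cong (n ℕ.+_) (sym (+-identityʳ n)))))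
      (≤-trans (m≤m+n (2 ℕ.* n) u) (≤-reflexive target)))
    columns : 2 ℕ.* ((n ℕ.⊔ m) ℕ.+ m) ≤ 2 ℕ.* (2 ℕ.* n ℕ.+ m ∸ 3)
    columns = ≤-trans (*-monoʳ-≤ 2 (≤-trans (≤-reflexive (cong (ℕ._+ m) (m≥n⇒m⊔n≡m m≤n)))
      (≤-trans (+-monoʳ-≤ n m≤n) (≤-reflexive (cong (ℕ._+ n) (sym (m≤n⇒m⊔n≡n m≤n))))))) rows
    core≤ : 12 ℕ.+ ((n ∸ 2) ℕ.* 2 ℕ.+ u ℕ.* 2) ≤ 2 ℕ.* (2 ℕ.* n ℕ.+ m ∸ 3)
    core≤ = subst₂ (λ n t → 12 ℕ.+ ((n ∸ 2) ℕ.* 2 ℕ.+ u ℕ.* 2) ≤ 2 ℕ.* t) n≡ (trans (cong (λ n → 2 ℕ.* n ℕ.+ u) n≡) target)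
      (≤-trans (m≤m+n (12 ℕ.+ ((2 ℕ.+ v) ℕ.* 2 ℕ.+ u ℕ.* 2)) (2 ℕ.* v))
        (≤-reflexive (solve 2 (λ u v → con 12 :+ ((con 2 :+ v) :* con 2 :+ u :* con 2) :+ con 2 :* v := con 2 :* (con 2 :* (con 4 :+ v) :+ u)) refl u v)))

open import Data.Nat using (_+_; _*_)
open import Data.Nat.Properties using (≤-refl)
open EgyptianMatrices using (o-bound; o-bound-without-constant; bdo-rank-one; rank-two-33; rank-two-general; bdo-rank-large; exact-bound)

theorem2p4 : (m n r : ℕ) → 1 ≤ r → r < m → m ≤ n →
    ((r ≡ 1) →
    (k : ℕ) → 1 ≤ k → Σ ℕ λ H₀ → (H : ℕ) → H₀ ≤ H →
    CardPowLE (InL m n 1 H) (2 * k) (H ^ (k * (2 * n) + 2)))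
    ×
    ((r ≡ 2) →
    (((m ≡ 3) × (n ≡ 3)) →
    (k : ℕ) → 1 ≤ k → Σ ℕ λ C → Σ ℕ λ H₀ → (H : ℕ) → H₀ ≤ H →
    CardPowLE (InL m n 2 H) (2 * k) (C * H ^ (k * 14 + 2)))
    ×
    (¬ ((m ≡ 3) × (n ≡ 3)) →
    (k : ℕ) → 1 ≤ k → Σ ℕ λ C → Σ ℕ λ H₀ → (H : ℕ) → H₀ ≤ H →
    CardPowLE (InL m n 2 H) (2 * k) (C * H ^ (k * (2 * (2 * n + m ∸ 3)) + 2))))
    ×
    ((3 ≤ r) →
    ((n + r ≤ 2 * m) →
    (k : ℕ) → 1 ≤ k → Σ ℕ λ C → Σ ℕ λ H₀ → (H : ℕ) → H₀ ≤ H →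
    CardPowLE (InL m n r H) (2 * k) (C * H ^ (k * ((n ∸ r) * (r + 1) + 2 * m * r) + 2)))
    ×
    ((2 * m < n + r) →
    Σ ℕ λ C → (H : ℕ) → 1 ≤ H →
    CardPowLE (InL m n r H) 1 (C * H ^ (n * r + m ∸ r))))
theorem2p4 m n r 1≤r r<m m≤n =
  (λ { refl → o-bound-without-constant ≤-refl (bdo-rank-one m≤n) }) ,
  (λ { refl → (λ { (refl , refl) → o-bound ≤-refl rank-two-33 }) , λ ne → o-bound ≤-refl (rank-two-general r<m m≤n ne) }) ,
  λ _ → (λ h → o-bound ≤-refl (bdo-rank-large 1≤r r<m m≤n h)) , exact-bound 1≤r r<m m≤n
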